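{- Let $a\in\mathbb N^n$ be a weak composition and $C$ a connected component of the directed edge-colored graph on $\mathrm{SSKD}(a)$ with an $i$-edge $T\to e_i(T)$ whenever $e_i(T)\ne0$. Then $C$ is an extremal subcrystal of a normal crystal: there exist a partition $\lambda$ with $n$ parts and a weight-preserving bijection $\Phi$ from $C$ onto an extremal subset $X\subseteq\mathcal B(\lambda)$ such that for all $T,T'\in C$ and all $i$, $e_i(T)=T'$ if and only if $e_i(\Phi(T))=\Phi(T')$.
   Context: The diagram of $a$ has cells $(r,c)$ (row $r$ from the bottom, column $c$ from the left) with $1\le c\le a_r$, augmented (following Haglund–Haiman–Loehr) by a basement column $0$ whose cell $(r,0)$ contains $r$, basement cells being included in the conditions below (row lengths compared without basement). Fillings have entries in $\{1,\dots,n\}$. Cells attack if in the same column, or in adjacent columns with the left cell strictly higher; non-attacking: attacking cells have different entries. A triple: cells $(r,c),(r,c+1)$ with entries $i,j$ and a third with entry $k$, either $(s,c)$, $s>r$, row $r$ strictly longer than row $s$, or $(s,c+1)$, $s<r$, row $r$ weakly longer than row $s$; co-inversion if $i<j<k$, $j<k<i$ or $k<i<j$. $\mathrm{SSKD}(a)$: non-attacking fillings with no co-inversion triples; $\mathrm{wt}(T)_m$ = number of entries $m$. $i$-pairing: pair an $i$ and an $i+1$ in the same column, then iteratively pair an unpaired $i+1$ with an unpaired $i$ to its left whenever all entries $i,i+1$ between them are paired. Raising $e_i$: $0$ if no unpaired $i+1$; otherwise change the rightmost unpaired $i+1$ to $i$, swap $i,i+1$ in each of the consecutive columns immediately to its left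 having an $i+1$ in the same row and an $i$ above, and in each of the consecutive columns immediately to its right having an $i+1$ in the same row and an $i$ below. $\mathcal B(\lambda)$ is the connected normal $\mathfrak{gl}_n$-crystal of highest weight $\lambda$ with operators $e_i,f_i$ and highest weight element $u_\lambda$. $X\subseteq\mathcal B(\lambda)$ is extremal if (1) $u_\lambda\in X$; (2) $x\in X$, $e_i(x)\ne0$ implies $e_i(x)\in X$; (3) if $x\in X$, $f_i(x)\ne0$ and $f_i(x)\notin X$ then $e_i(x)\notin X$. -}

module Defs where

open import Data.Nat using (ℕ; zero; suc; _+_; _∸_; _≤_; _<_; _≡ᵇ_; _<ᵇ_)
open import Data.Nat.Properties using (_≟_)
open import Data.Bool using (Bool; true; false; if_then_else_; _∧_)
open import Data.Maybe as M using (Maybe; just; nothing)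
open import Data.List using (List; []; _∷_; length; reverse; concat; replicate; filter; upTo; map; foldr; foldl)
open import Data.Vec as V using (Vec; toList; lookup; tabulate)
open import Data.Fin as F using (Fin; toℕ)
open import Data.Product using (Σ; _×_; _,_; proj₁; proj₂)
open import Data.Sum using (_⊎_)
open import Relation.Nullary using (¬_)
open import Relation.Binary.PropositionalEquality using (_≡_; _≢_)

nth : {A : Set} → List A → ℕ → Maybe A
nth [] _ = nothing
nth (x ∷ xs) zero = just x
nth (x ∷ xs) (suc k) = nth xs k

updL : {A : Set} → ℕ → A → List A → List A
updL _ v [] = []
updL zero v (x ∷ xs) = v ∷ xs
updL (suc k) v (x ∷ xs) = x ∷ updL k v xs

updV : ∀ {A : Set} {n} → ℕ → (A → A) → Vec A n → Vec A n
updV _ g V.[] = V.[]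
updV zero g (x V.∷ xs) = g x V.∷ xs
updV (suc k) g (x V.∷ xs) = x V.∷ updV k g xs

eqM : Maybe ℕ → ℕ → Bool
eqM (just x) v = x ≡ᵇ v
eqM nothing _ = false

count : ℕ → List ℕ → ℕ
count v xs = length (filter (λ x → x ≟ v) xs)

-- Weak compositions and fillings.
-- A weak composition a ∈ ℕⁿ is a Vec ℕ n (a_r = lookup a (r-1)).
-- A filling is given row by row (row r, r = 1..n from the bottom, is the
-- (r-1)-th component), each row listing the entries of columns 1,2,...
-- Entries are natural numbers (required to lie in {1..n} by SSKD).

Filling : ℕ → Set
Filling n = Vec (List ℕ) n

-- entry T r c : entry of cell (r,c), 1-based row, column 0 = basement
-- (cell (r,0) contains r); nothing if the cell is not in the diagram.
entryRow : ℕ → ℕ → Maybe (List ℕ) → Maybe ℕ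
entryRow r zero (just _) = just (suc r)
entryRow r (suc c) (just row) = nth row c
entryRow _ _ nothing = nothing

entry : ∀ {n} → Filling n → ℕ → ℕ → Maybe ℕ
entry T zero c = nothing
entry T (suc r) c = entryRow r c (nth (toList T) r)

-- row length a_r (without basement), 1-based row; 0 outside 1..n
rowLen : ∀ {n} → Vec ℕ n → ℕ → ℕ
rowLen a zero = 0
rowLen a (suc r) = M.fromMaybe 0 (nth (toList a) r)

Shape : ∀ {n} → Vec ℕ n → Filling n → Set
Shape {n} a T = ∀ (r : Fin n) → length (lookup T r) ≡ lookup a r

EntriesIn : ∀ {n} → Filling n → Set
EntriesIn {n} T = ∀ r c k → entry T r (suc c) ≡ just k → 1 ≤ k × k ≤ n

Attacks : ℕ → ℕ → ℕ → ℕ → Set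
Attacks r c s d = (c ≡ d × r ≢ s) ⊎ ((d ≡ suc c × s < r) ⊎ (c ≡ suc d × r < s))

NonAttacking : ∀ {n} → Filling n → Set
NonAttacking T = ∀ r c s d k l → entry T r c ≡ just k → entry T s d ≡ just l →
  Attacks r c s d → k ≢ l

CoInv : ℕ → ℕ → ℕ → Set
CoInv i j k = (i < j × j < k) ⊎ ((j < k × k < i) ⊎ (k < i × i < j))

-- no co-inversion triples (basement cells included)
NoCoInv : ∀ {n} → Vec ℕ n → Filling n → Set
NoCoInv a T = ∀ r c i j → entry T r c ≡ just i → entry T r (suc c) ≡ just j →
  (∀ s k → r < s → rowLen a s < rowLen a r → entry T s c ≡ just k → ¬ CoInv i j k)
  × (∀ s k → s < r → rowLen a s ≤ rowLen a r → entry T s (suc c) ≡ just k → ¬ CoInv i j k)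

SSKD : ∀ {n} → Vec ℕ n → Filling n → Set
SSKD a T = Shape a T × EntriesIn T × NonAttacking T × NoCoInv a T

wtW : (n : ℕ) → List ℕ → Vec ℕ n
wtW n w = tabulate (λ m → count (suc (toℕ m)) w)

wtF : (n : ℕ) → Filling n → Vec ℕ n
wtF n T = wtW n (concat (toList T))

Valid : ℕ → ℕ → Set
Valid n i = 1 ≤ i × suc i ≤ n

findRow : ℕ → ℕ → ℕ → List (List ℕ) → Maybe ℕ
findRow c v k [] = nothing
findRow c v k (row ∷ rs) = if eqM (nth row c) v then just (suc k) else findRow c v (suc k) rs

rowWith : ∀ {n} → Filling n → ℕ → ℕ → Maybe ℕ
rowWith T v zero = nothing
rowWith T v (suc c) = findRow c v 0 (toList T)

width : ∀ {n} → Filling n → ℕ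
width T = foldr _+_ 0 (map length (toList T))

cols : ∀ {n} → Filling n → List ℕ
cols T = map suc (upTo (width T))

-- i-pairing scan over columns left to right: state = (number of open
-- unpaired i's, last unpaired i+1 seen as (column,row)).
-- Column with both i and i+1: paired in column.
stepF : ℕ → Maybe ℕ → Maybe ℕ → ℕ × Maybe (ℕ × ℕ) → ℕ × Maybe (ℕ × ℕ)
stepF c (just _) (just _) s = s
stepF c (just _) nothing (k , acc) = (suc k , acc)
stepF c nothing (just r) (zero , acc) = (zero , just (c , r))
stepF c nothing (just r) (suc k , acc) = (k , acc)
stepF c nothing nothing s = s

rightmostUnpaired : ∀ {n} → ℕ → Filling n → Maybe (ℕ × ℕ)
rightmostUnpaired i T =
  proj₂ (foldl (λ s c → stepF c (rowWith T i c) (rowWith T (suc i) c) s) (0 , nothing) (cols T))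

setCell : ∀ {n} → Filling n → ℕ → ℕ → ℕ → Filling n
setCell T (suc r) (suc c) v = updV r (updL c v) T
setCell T _ _ _ = T

swapAt : ∀ {n} → Filling n → ℕ → ℕ → ℕ → ℕ → Filling n
swapAt U i r r' c = setCell (setCell U r c i) r' c (suc i)

-- swaps in consecutive columns c, c-1, …, 1 left of the changed cell
-- (conditions read off the original filling T)
goL : ∀ {n} → ℕ → Filling n → ℕ → ℕ → Filling n → Filling n
goL i T r zero U = U
goL {n} i T r (suc c) U = go (eqM (entry T r (suc c)) (suc i)) (rowWith T i (suc c))
  where
  go : Bool → Maybe ℕ → Filling n
  go true (just r') = if r <ᵇ r' then goL i T r c (swapAt U i r r' (suc c)) else U
  go _ _ = U

goR : ∀ {n} → ℕ → ℕ → Filling n → ℕ → ℕ → Filling n → Filling n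
goR zero i T r c U = U
goR {n} (suc f) i T r c U = go (eqM (entry T r c) (suc i)) (rowWith T i c)
  where
  go : Bool → Maybe ℕ → Filling n
  go true (just r') = if r' <ᵇ r then goR f i T r (suc c) (swapAt U i r r' c) else U
  go _ _ = U

raiseAt : ∀ {n} → ℕ → Filling n → ℕ × ℕ → Filling n
raiseAt i T (c , r) = goR (width T) i T r (suc c) (goL i T r (c ∸ 1) (setCell T r c i))

eF : ∀ {n} → ℕ → Filling n → Maybe (Filling n)
eF i T = M.map (raiseAt i T) (rightmostUnpaired i T)

data Comp {n} (a : Vec ℕ n) (T₀ : Filling n) : Filling n → Set where
  base : SSKD a T₀ → Comp a T₀ T₀
  fwd  : ∀ {T T'} i → Valid n i → Comp a T₀ T → eF i T ≡ just T' → SSKD a T' → Comp a T₀ T'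
  bwd  : ∀ {T T'} i → Valid n i → Comp a T₀ T → eF i T' ≡ just T → SSKD a T' → Comp a T₀ T'

-- The normal crystal B(λ): words over {1..n} with the signature rule
-- (an i+1 to the left of an i is bracketed); B(λ) is the connected
-- component of the highest weight word u_λ = n^{λ_n} ⋯ 2^{λ_2} 1^{λ_1}.

-- scan left to right: `a` opens, `b` closes an open `a` if any, else it
-- is unpaired; returns position of the last unpaired `b`
scanU : ℕ → ℕ → ℕ → ℕ → List ℕ → Maybe ℕ → Maybe ℕ
scanU a b p k [] acc = acc
scanU a b p k (x ∷ xs) acc =
  if x ≡ᵇ a then scanU a b (suc p) (suc k) xs acc
  else (if x ≡ᵇ b then close k else scanU a b (suc p) k xs acc)
  where
  close : ℕ → Maybe ℕ
  close zero = scanU a b (suc p) zero xs (just p)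
  close (suc k') = scanU a b (suc p) k' xs acc

fW : ℕ → List ℕ → Maybe (List ℕ)
fW i w = M.map (λ p → updL p (suc i) w) (scanU (suc i) i 0 0 w nothing)

-- e_i: leftmost unpaired i+1 becomes i
eW : ℕ → List ℕ → Maybe (List ℕ)
eW i w = M.map (λ p → reverse (updL p i (reverse w))) (scanU i (suc i) 0 0 (reverse w) nothing)

hwWord : ∀ {n} → Vec ℕ n → List ℕ
hwWord {n} μ = concat (reverse (toList (tabulate {n = n} (λ m → replicate (lookup μ m) (suc (toℕ m))))))

IsPartition : ∀ {n} → Vec ℕ n → Set
IsPartition {n} μ = ∀ (p q : Fin n) → p F.≤ q → lookup μ q ≤ lookup μ p

data InB (n : ℕ) (μ : Vec ℕ n) : List ℕ → Set where
  hw   : InB n μ (hwWord μ)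
  step : ∀ {w w'} i → Valid n i → InB n μ w → fW i w ≡ just w' → InB n μ w'

Extremal : (n : ℕ) → Vec ℕ n → (List ℕ → Set) → Set
Extremal n μ X =
  (∀ x → X x → InB n μ x)
  × X (hwWord μ)
  × (∀ x i y → Valid n i → X x → eW i x ≡ just y → X y)
  × (∀ x i y → Valid n i → X x → fW i x ≡ just y → ¬ X y → ∀ z → eW i x ≡ just z → ¬ X z)

-- Reading the columns of a filling from right to left, each one downwards, sends eF to eW: the cells with entry
-- i or i + 1 are exchanged in an interval of columns, all but one of which contain both letters.
--
-- (1) SSKD means that in each step from column c to column c + 1 the rows, taken from bottom to top, jump down
-- the cycle of values, and none jumps over a row of lower rank (shorter, or as long and below).  For fixed i
-- this becomes a short list of rules on the cells with entries i, i + 1; they are invariant under a half turn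
-- exchanging i and i + 1, so closure under raising and existence of the lowered filling have one proof.
--
-- (2) The column sets determine the filling.  Letting two consecutive rows move in the opposite order turns a
-- process into one with the same column sets, and once the rows move in the order of their ranks each jump is
-- forced.
--
-- (3) A Knuth move at a fixed position is an involution of words commuting with the crystal operators.  A
-- Yamanouchi word is carried to the canonical word of its weight by such moves, and the same moves carry its
-- whole component into B(λ).
module Submission where

open import Defs
open import Data.Nat using (ℕ; zero; suc; _+_; _∸_; _≤_; _<_; z≤n; s≤s; _≡ᵇ_; _<ᵇ_; _≤?_)
open import Data.Nat.Properties
open import Data.Bool using (Bool; true; false; if_then_else_; T)
open import Induction.WellFounded using (Acc; acc)
open import Data.Unit using (⊤; tt)
open import Data.Empty using (⊥; ⊥-elim)
open import Data.Maybe as M using (Maybe; just; nothing)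
open import Data.Maybe.Properties using (just-injective)
open import Data.List using (List; []; _∷_; _++_; length; reverse; concat; replicate; upTo; applyUpTo; map; foldr; foldl)
open import Data.List.Properties using (unfold-reverse; reverse-involutive; length-reverse; length-replicate; length-++; ++-assoc; upTo-∷ʳ; applyUpTo-∷ʳ; ∷-injective; map-++; foldl-++)
open import Data.List.Relation.Unary.All as All using (All; []; _∷_)
open import Data.List.Relation.Binary.Pointwise using (Pointwise; []; _∷_)
open import Data.List.Relation.Unary.AllPairs using (AllPairs; []; _∷_)
open import Data.List.Relation.Unary.Any using (here; there)
open import Data.List.Membership.Propositional using (_∈_)
open import Data.List.Membership.Propositional.Properties using (∈-++⁺ʳ; ∈-++⁻)
open import Data.Vec as V using (Vec; toList; lookup; tabulate)
open import Data.Vec.Properties using (tabulate-cong; lookup∘tabulate)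
open import Data.Fin as F using (Fin; toℕ)
open import Data.Fin.Properties using (toℕ<n)
open import Data.Product using (Σ; ∃; _×_; _,_; proj₁; proj₂)
open import Data.Sum using (_⊎_; inj₁; inj₂; [_,_]′)
open import Relation.Nullary using (¬_; Dec; yes; no)
open import Relation.Binary.Definitions using (tri<; tri≈; tri>)
open import Function using (_∘_; id; case_of_)
open import Function.Bundles using (_⇔_; mk⇔)
open import Relation.Binary.PropositionalEquality using (_≡_; _≢_; refl; sym; trans; cong; cong₂; subst; subst₂)

-- Words and the signature rule

-- Condition (3) is where the basement matters. Lowering exchanges `i` and `i + 1` in an interval of
-- columns that might run into column 0, whose entries are fixed. If `e_i` does not vanish, there is
-- an unpaired `i + 1`, and it lies to the left of the leftmost unpaired `i`, in a column without
-- `i`. The interval cannot cross such a column, so the lowered filling exists.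
--
-- Injectivity is not visible from the rules directly: rows move by height while the prohibition on
-- passing refers to rank, so a single jump is not forced by the column sets as long as the two
-- orders differ.
--
-- The identification with B(λ) needs no insertion algorithm. Descents of a word are constant along
-- strings, so at a fixed position a Knuth relation applies either to all words of a component or to
-- none. Descents also bound a Yamanouchi word letter by letter by a canonical word with the same
-- descents, and this makes the highest weight word of the component unique.

data Letter : Set where low high other : Letter

letter : ℕ → ℕ → Letter
letter i x = if x ≡ᵇ i then low else (if x ≡ᵇ suc i then high else other)

data Letter? (i x : ℕ) : Letter → Set where
  isLo    : x ≡ i → Letter? i x low
  isHi    : x ≡ suc i → Letter? i x high
  isOther : x ≢ i → x ≢ suc i → Letter? i x other

≡ᵇ-true : ∀ {x y} → (x ≡ᵇ y) ≡ true → x ≡ y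
≡ᵇ-true {x} {y} eq = ≡ᵇ⇒≡ x y (subst T (sym eq) tt)

≡ᵇ-refl : ∀ x → (x ≡ᵇ x) ≡ true
≡ᵇ-refl zero = refl
≡ᵇ-refl (suc x) = ≡ᵇ-refl x

≡ᵇ-false : ∀ {x y} → x ≢ y → (x ≡ᵇ y) ≡ false
≡ᵇ-false {x} {y} ne with x ≡ᵇ y in eq
... | true = ⊥-elim (ne (≡ᵇ-true eq))
... | false = refl

≡ᵇ-false⁻¹ : ∀ {x y} → (x ≡ᵇ y) ≡ false → x ≢ y
≡ᵇ-false⁻¹ {x} eq refl = case trans (sym (≡ᵇ-refl x)) eq of λ ()

letter? : ∀ i x → Letter? i x (letter i x)
letter? i x with x ≡ᵇ i in eq
... | true = isLo (≡ᵇ-true eq)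
... | false with x ≡ᵇ suc i in eq'
...   | true = isHi (≡ᵇ-true eq')
...   | false = isOther (≡ᵇ-false⁻¹ eq) (≡ᵇ-false⁻¹ eq')

letter-low : ∀ i → letter i i ≡ low
letter-low i rewrite ≡ᵇ-refl i = refl

letter-high : ∀ i → letter i (suc i) ≡ high
letter-high i rewrite ≡ᵇ-false {suc i} {i} 1+n≢n | ≡ᵇ-refl i = refl

letter-other : ∀ {i x} → x ≢ i → x ≢ suc i → letter i x ≡ other
letter-other ne ne' rewrite ≡ᵇ-false ne | ≡ᵇ-false ne' = refl

φ-step : Letter → ℕ → ℕ
φ-step low k = suc k
φ-step high k = k ∸ 1
φ-step other k = k

-- The number of unpaired letters i.
φ : ℕ → List ℕ → ℕ
φ i [] = 0
φ i (x ∷ w) = φ-step (letter i x) (φ i w)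

-- `k` is the number of unpaired letters `i` behind the head. A head `i + 1` with `k = 0` is
-- unpaired, and being leftmost it is the letter to change, whatever the tail contains.
raise-step : ℕ → Letter → ℕ → ℕ → List ℕ → Maybe (List ℕ) → Maybe (List ℕ)
raise-step i low k x w r = M.map (x ∷_) r
raise-step i high zero x w r = just (i ∷ w)
raise-step i high (suc k) x w r = M.map (x ∷_) r
raise-step i other k x w r = M.map (x ∷_) r

raise : ℕ → List ℕ → Maybe (List ℕ)
raise i [] = nothing
raise i (x ∷ w) = raise-step i (letter i x) (φ i w) x w (raise i w)

-- A leading `i + 1` brackets the leftmost unpaired `i` of the tail, so the rightmost one, which is
-- to be lowered, survives unless it is the only one. A leading `i` is the answer exactly when the
-- tail has no unpaired `i`.
lower-step : Letter → ℕ → Maybe ℕ → Maybe ℕ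
lower-step low zero r = just 0
lower-step low (suc k) r = M.map suc r
lower-step high zero r = M.map suc r
lower-step high (suc zero) r = nothing
lower-step high (suc (suc k)) r = M.map suc r
lower-step other k r = M.map suc r

lowerPos : ℕ → List ℕ → Maybe ℕ
lowerPos i [] = nothing
lowerPos i (x ∷ w) = lower-step (letter i x) (φ i w) (lowerPos i w)

lower : ℕ → List ℕ → Maybe (List ℕ)
lower i w = M.map (λ p → updL p (suc i) w) (lowerPos i w)

map-shift : ∀ p m → M.map (suc p +_) m ≡ M.map (p +_) (M.map suc m)
map-shift p (just q) = cong just (sym (+-suc p q))
map-shift p nothing = refl

-- The scan comes from the left with `k` open letters `i + 1`, whereas `φ` and `lowerPos` are
-- computed from the right. The open letters absorb the leftmost unpaired `i` of `w`, so the
-- rightmost one remains exactly when there are more than `k`.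
scan-lower : ∀ i p k w last →
  (φ i w ≤ k → scanU (suc i) i p k w last ≡ last) ×
  (k < φ i w → scanU (suc i) i p k w last ≡ M.map (p +_) (lowerPos i w))
scan-lower i p k [] last = (λ _ → refl) , λ ()
scan-lower i p k (x ∷ w) last with letter i x | letter? i x
scan-lower i p zero (x ∷ w) last | low | isLo refl rewrite ≡ᵇ-false {i} {suc i} (1+n≢n ∘ sym) | ≡ᵇ-refl i =
  (λ ()) , λ _ → first
  where
  first : scanU (suc i) i (suc p) 0 w (just p) ≡ M.map (p +_) (lower-step low (φ i w) (lowerPos i w))
  first with φ i w | scan-lower i (suc p) 0 w (just p)
  ... | zero | ih , _ = trans (ih z≤n) (cong just (sym (+-identityʳ p)))
  ... | suc m | _ , ih = trans (ih (s≤s z≤n)) (map-shift p (lowerPos i w))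
scan-lower i p (suc k) (x ∷ w) last | low | isLo refl rewrite ≡ᵇ-false {i} {suc i} (1+n≢n ∘ sym) | ≡ᵇ-refl i
  with scan-lower i (suc p) k w last
... | ih , ih' = (λ { (s≤s le) → ih le }) , second
  where
  second : suc k < suc (φ i w) → scanU (suc i) i (suc p) k w last ≡ M.map (p +_) (lower-step low (φ i w) (lowerPos i w))
  second (s≤s lt) with φ i w
  ... | suc m = trans (ih' lt) (map-shift p (lowerPos i w))
scan-lower i p k (x ∷ w) last | high | isHi refl rewrite ≡ᵇ-refl i with scan-lower i (suc p) (suc k) w last
... | ih , ih' = (λ le → ih (first le)) , second
  where
  first : φ i w ∸ 1 ≤ k → φ i w ≤ suc k
  first le with φ i w
  ... | zero = z≤n
  ... | suc m = s≤s le
  second : k < φ i w ∸ 1 → scanU (suc i) i (suc p) (suc k) w last ≡ M.map (p +_) (lower-step high (φ i w) (lowerPos i w))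
  second lt with φ i w
  second () | suc zero
  second lt | suc (suc m) = trans (ih' (s≤s lt)) (map-shift p (lowerPos i w))
scan-lower i p k (x ∷ w) last | other | isOther ne ne' rewrite ≡ᵇ-false ne | ≡ᵇ-false ne' with scan-lower i (suc p) k w last
... | ih , ih' = ih , λ lt → trans (ih' lt) (map-shift p (lowerPos i w))

lowerPos-zero : ∀ i w → φ i w ≡ 0 → lowerPos i w ≡ nothing
lowerPos-zero i [] eq = refl
lowerPos-zero i (x ∷ w) eq with letter i x
... | low = case eq of λ ()
... | other rewrite lowerPos-zero i w eq = refl
... | high with φ i w in eq'
...   | zero rewrite lowerPos-zero i w eq' = refl
...   | suc zero = refl

lower≡fW : ∀ i w → fW i w ≡ lower i w
lower≡fW i w with φ i w in eq | scan-lower i 0 0 w nothing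
... | zero | s , _ rewrite s z≤n | lowerPos-zero i w eq = refl
... | suc k | _ , s rewrite s (s≤s z≤n) with lowerPos i w
...   | just p = refl
...   | nothing = refl

opens : Letter → ℕ → ℕ → Maybe ℕ → Maybe ℕ
opens low k q r = r
opens high zero q r = just q
opens high (suc k) q r = r
opens other k q r = r

runφ : ℕ → ℕ → List ℕ → ℕ
runφ i k [] = k
runφ i k (x ∷ xs) = runφ i (φ-step (letter i x) k) xs

runφ-++ : ∀ i k xs ys → runφ i k (xs ++ ys) ≡ runφ i (runφ i k xs) ys
runφ-++ i k [] ys = refl
runφ-++ i k (x ∷ xs) ys = runφ-++ i _ xs ys

runφ-reverse : ∀ i w → runφ i 0 (reverse w) ≡ φ i w
runφ-reverse i [] = refl
runφ-reverse i (x ∷ w) rewrite unfold-reverse x w | runφ-++ i 0 (reverse w) (x ∷ []) | runφ-reverse i w = refl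

-- `eW` scans the reversed word, so a letter put in front of the word is scanned last; this yields
-- the recursion of `raise`.
scan-snoc : ∀ i p k xs x last →
  scanU i (suc i) p k (xs ++ x ∷ []) last ≡ opens (letter i x) (runφ i k xs) (p + length xs) (scanU i (suc i) p k xs last)
scan-snoc i p k [] x last with letter i x | letter? i x
... | low | isLo refl rewrite ≡ᵇ-refl i = refl
scan-snoc i p zero [] x last | high | isHi refl rewrite ≡ᵇ-false {suc i} {i} 1+n≢n | ≡ᵇ-refl i = cong just (sym (+-identityʳ p))
scan-snoc i p (suc k) [] x last | high | isHi refl rewrite ≡ᵇ-false {suc i} {i} 1+n≢n | ≡ᵇ-refl i = refl
... | other | isOther ne ne' rewrite ≡ᵇ-false ne | ≡ᵇ-false ne' = refl
scan-snoc i p k (y ∷ xs) x last rewrite +-suc p (length xs) with letter i y | letter? i y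
... | low | isLo refl rewrite ≡ᵇ-refl i = scan-snoc i (suc p) (suc k) xs x last
scan-snoc i p zero (y ∷ xs) x last | high | isHi refl rewrite ≡ᵇ-false {suc i} {i} 1+n≢n | ≡ᵇ-refl i = scan-snoc i (suc p) zero xs x (just p)
scan-snoc i p (suc k) (y ∷ xs) x last | high | isHi refl rewrite ≡ᵇ-false {suc i} {i} 1+n≢n | ≡ᵇ-refl i = scan-snoc i (suc p) k xs x last
... | other | isOther ne ne' rewrite ≡ᵇ-false ne | ≡ᵇ-false ne' = scan-snoc i (suc p) k xs x last

updL-++ˡ : ∀ {A : Set} p (v : A) xs ys → p < length xs → updL p v (xs ++ ys) ≡ updL p v xs ++ ys
updL-++ˡ zero v (x ∷ xs) ys lt = refl
updL-++ˡ (suc p) v (x ∷ xs) ys (s≤s lt) = cong (x ∷_) (updL-++ˡ p v xs ys lt)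

updL-++ʳ : ∀ {A : Set} (v : A) xs y ys → updL (length xs) v (xs ++ y ∷ ys) ≡ xs ++ v ∷ ys
updL-++ʳ v [] y ys = refl
updL-++ʳ v (x ∷ xs) y ys = cong (x ∷_) (updL-++ʳ v xs y ys)

reverse-snoc : ∀ {A : Set} (xs : List A) x → reverse (xs ++ x ∷ []) ≡ x ∷ reverse xs
reverse-snoc xs x = trans (cong (λ z → reverse (z ++ x ∷ [])) (sym (reverse-involutive xs)))
  (trans (cong reverse (sym (unfold-reverse x (reverse xs)))) (reverse-involutive (x ∷ reverse xs)))

raiseScan : ℕ → List ℕ → Maybe ℕ
raiseScan i w = scanU i (suc i) 0 0 (reverse w) nothing

raiseScan-∷ : ∀ i x w → raiseScan i (x ∷ w) ≡ opens (letter i x) (φ i w) (length w) (raiseScan i w)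
raiseScan-∷ i x w rewrite unfold-reverse x w | scan-snoc i 0 0 (reverse w) x nothing | runφ-reverse i w | length-reverse w = refl

raiseScan-bound : ∀ i w p → raiseScan i w ≡ just p → p < length w
raiseScan-bound i (x ∷ w) p eq rewrite raiseScan-∷ i x w with letter i x | φ i w
... | low | _ = m<n⇒m<1+n (raiseScan-bound i w p eq)
... | high | suc _ = m<n⇒m<1+n (raiseScan-bound i w p eq)
... | other | _ = m<n⇒m<1+n (raiseScan-bound i w p eq)
raiseScan-bound i (x ∷ w) .(length w) refl | high | zero = ≤-refl

raise≡eW : ∀ i w → eW i w ≡ raise i w
raise≡eW i [] = refl
raise≡eW i (x ∷ w) with raise≡eW i w
... | ih rewrite raiseScan-∷ i x w = cases (letter i x) (φ i w)
  where
  upd : ℕ → List ℕ → List ℕ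
  upd p w = reverse (updL p i (reverse w))
  keep : M.map (λ p → upd p (x ∷ w)) (raiseScan i w) ≡ M.map (x ∷_) (raise i w)
  keep with raiseScan i w in eq
  ... | nothing = cong (M.map (x ∷_)) ih
  ... | just p = trans (cong just (trans (cong (λ z → reverse (updL p i z)) (unfold-reverse x w))
         (trans (cong reverse (updL-++ˡ p i (reverse w) (x ∷ []) (subst (p <_) (sym (length-reverse w)) (raiseScan-bound i w p eq))))
           (reverse-snoc (updL p i (reverse w)) x))))
         (cong (M.map (x ∷_)) ih)
  cases : ∀ l k → M.map (λ p → upd p (x ∷ w)) (opens l k (length w) (raiseScan i w)) ≡ raise-step i l k x w (raise i w)
  cases low k = keep
  cases high zero = cong just (trans (cong (λ z → reverse (updL (length w) i z)) (unfold-reverse x w))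
    (trans (cong (λ m → reverse (updL m i (reverse w ++ x ∷ []))) (sym (length-reverse w)))
    (trans (cong reverse (updL-++ʳ i (reverse w) x [])) (trans (reverse-snoc (reverse w) i) (cong (i ∷_) (reverse-involutive w))))))
  cases high (suc k) = keep
  cases other k = keep

-- The recursion of `lowerPos` producing the word instead of a position, so that it can be compared
-- with `raise` clause by clause.
down-step : ℕ → Letter → ℕ → ℕ → List ℕ → Maybe (List ℕ) → Maybe (List ℕ)
down-step i low zero x w r = just (suc i ∷ w)
down-step i low (suc k) x w r = M.map (x ∷_) r
down-step i high zero x w r = M.map (x ∷_) r
down-step i high (suc zero) x w r = nothing
down-step i high (suc (suc k)) x w r = M.map (x ∷_) r
down-step i other k x w r = M.map (x ∷_) r

down : ℕ → List ℕ → Maybe (List ℕ)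
down i [] = nothing
down i (x ∷ w) = down-step i (letter i x) (φ i w) x w (down i w)

lower≡down : ∀ i w → lower i w ≡ down i w
lower≡down i [] = refl
lower≡down i (x ∷ w) with lower≡down i w
... | ih = cases (letter i x) (φ i w)
  where
  keep : M.map (λ p → updL p (suc i) (x ∷ w)) (M.map suc (lowerPos i w)) ≡ M.map (x ∷_) (down i w)
  keep rewrite sym ih with lowerPos i w
  ... | just p = refl
  ... | nothing = refl
  cases : ∀ l k → M.map (λ p → updL p (suc i) (x ∷ w)) (lower-step l k (lowerPos i w)) ≡ down-step i l k x w (down i w)
  cases low zero = refl
  cases low (suc k) = keep
  cases high zero = keep
  cases high (suc zero) = refl
  cases high (suc (suc k)) = keep
  cases other k = keep

down≡fW : ∀ i w → fW i w ≡ down i w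
down≡fW i w = trans (lower≡fW i w) (lower≡down i w)

map-∷ : ∀ (x : ℕ) (m : Maybe (List ℕ)) {y : List ℕ} → M.map (x ∷_) m ≡ just y → Σ (List ℕ) λ v → m ≡ just v × y ≡ x ∷ v
map-∷ x (just v) refl = v , refl , refl

-- The changed letter has no unpaired `i` to its right, and every `i + 1` to its left is already
-- bracketed, so after the change it is the rightmost unpaired `i`.
raise-down : ∀ i w w' → raise i w ≡ just w' → φ i w' ≡ suc (φ i w) × down i w' ≡ just w
raise-down i (x ∷ w) w' eq with letter i x in lx | letter? i x
raise-down i (x ∷ w) w' eq | low | _ with map-∷ x (raise i w) eq
... | v , eqv , refl with raise-down i w v eqv
...   | p , d rewrite lx | p | d = refl , refl
raise-down i (x ∷ w) w' eq | other | _ with map-∷ x (raise i w) eq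
... | v , eqv , refl with raise-down i w v eqv
...   | p , d rewrite lx | p | d = refl , refl
raise-down i (x ∷ w) w' eq | high | isHi refl with φ i w in ph
raise-down i (x ∷ w) .(i ∷ w) refl | high | isHi refl | zero rewrite letter-low i | ph = refl , refl
... | suc k with map-∷ x (raise i w) eq
...   | v , eqv , refl with raise-down i w v eqv
...     | p , d rewrite lx | p | d | ph = refl , refl

-- Descents along crystal strings

descent : ℕ → List ℕ → Bool
descent x [] = false
descent x (y ∷ w) = y <ᵇ x

descents : List ℕ → List Bool
descents [] = []
descents (x ∷ w) = descent x w ∷ descents w

<ᵇ-true : ∀ {x y} → x < y → (x <ᵇ y) ≡ true
<ᵇ-true {zero} {suc y} lt = refl
<ᵇ-true {suc x} {suc y} (s≤s lt) = <ᵇ-true lt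

<ᵇ-false : ∀ {x y} → y ≤ x → (x <ᵇ y) ≡ false
<ᵇ-false {x} {zero} le = refl
<ᵇ-false {suc x} {suc y} (s≤s le) = <ᵇ-false le

<ᵇ-true⁻¹ : ∀ {x y} → (x <ᵇ y) ≡ true → x < y
<ᵇ-true⁻¹ {x} {y} eq = <ᵇ⇒< x y (subst T (sym eq) tt)

<ᵇ-false⁻¹ : ∀ {x y} → (x <ᵇ y) ≡ false → y ≤ x
<ᵇ-false⁻¹ {x} {y} eq with y ≤? x
... | yes le = le
... | no nle = case trans (sym (<ᵇ-true (≰⇒> nle))) eq of λ ()

<ᵇ-sucʳ : ∀ {x y} → x ≢ y → (x <ᵇ suc y) ≡ (x <ᵇ y)
<ᵇ-sucʳ {x} {y} ne with <-cmp x y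
... | tri< lt _ _ = trans (<ᵇ-true (m<n⇒m<1+n lt)) (sym (<ᵇ-true lt))
... | tri≈ _ eq _ = ⊥-elim (ne eq)
... | tri> _ _ gt = trans (<ᵇ-false gt) (sym (<ᵇ-false (<⇒≤ gt)))

-- Decreasing an `i + 1` to `i` alters the comparison with its left neighbour `x` only if `x` is
-- `i + 1`. The hypothesis says that such an `x` is paired, and then the letter next to it is not
-- the one that changes.
descent-raise : ∀ i x w w' → raise i w ≡ just w' → (x ≡ suc i → φ i w ≢ 0) → descent x w' ≡ descent x w
descent-raise i x (y ∷ w) w' eq ne with letter i y in ly | letter? i y
... | low | _ with map-∷ y (raise i w) eq
...   | v , _ , refl = refl
descent-raise i x (y ∷ w) w' eq ne | other | _ with map-∷ y (raise i w) eq
...   | v , _ , refl = refl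
descent-raise i x (y ∷ w) w' eq ne | high | isHi refl with φ i w in ph
descent-raise i zero (y ∷ w) .(i ∷ w) refl ne | high | isHi refl | zero = refl
descent-raise i (suc x) (y ∷ w) .(i ∷ w) refl ne | high | isHi refl | zero = <ᵇ-sucʳ {i} {x} λ { refl → ne refl refl }
... | suc k with map-∷ y (raise i w) eq
...   | v , _ , refl = refl

-- The dangerous neighbours of the changed letter are `i + 1` on its left and `i` on its right. The
-- first would be an unpaired letter further left, the second would bracket the changed letter.
descents-raise : ∀ i w w' → raise i w ≡ just w' → descents w' ≡ descents w
descents-raise i (x ∷ w) w' eq with letter i x in lx | letter? i x
descents-raise i (x ∷ w) w' eq | low | isLo x≡i with map-∷ x (raise i w) eq
... | v , eqv , refl = cong₂ _∷_ (descent-raise i x w v eqv λ x≡si → case trans (sym x≡i) x≡si of λ ()) (descents-raise i w v eqv)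
descents-raise i (x ∷ w) w' eq | other | isOther ne ne' with map-∷ x (raise i w) eq
... | v , eqv , refl = cong₂ _∷_ (descent-raise i x w v eqv λ x≡si → ⊥-elim (ne' x≡si)) (descents-raise i w v eqv)
descents-raise i (x ∷ w) w' eq | high | isHi refl with φ i w in ph
descents-raise i (x ∷ []) .(i ∷ []) refl | high | isHi refl | zero = refl
descents-raise i (x ∷ y ∷ w) .(i ∷ y ∷ w) refl | high | isHi refl | zero = cong (λ b → b ∷ descents (y ∷ w)) (sym (<ᵇ-sucʳ {y} {i} ne))
  where
  ne : y ≢ i
  ne refl rewrite letter-low i = case ph of λ ()
... | suc k with map-∷ x (raise i w) eq
...   | v , eqv , refl = cong₂ _∷_ (descent-raise i x w v eqv λ _ z → case trans (sym ph) z of λ ()) (descents-raise i w v eqv)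

-- Knuth relations and raising

-- The plactic relations xzy ~ zxy for x ≤ y < z and yzx ~ yxz for x < y ≤ z, at the head of a word
-- only; other positions are handled by `knuth`.
data Knuth : List ℕ → List ℕ → Set where
  swap₁  : ∀ {a b c w} → a ≤ c → c < b → Knuth (a ∷ b ∷ c ∷ w) (b ∷ a ∷ c ∷ w)
  swap₁⁻ : ∀ {a b c w} → a ≤ c → c < b → Knuth (b ∷ a ∷ c ∷ w) (a ∷ b ∷ c ∷ w)
  swap₂  : ∀ {a b c w} → c < a → a ≤ b → Knuth (a ∷ b ∷ c ∷ w) (a ∷ c ∷ b ∷ w)
  swap₂⁻ : ∀ {a b c w} → c < a → a ≤ b → Knuth (a ∷ c ∷ b ∷ w) (a ∷ b ∷ c ∷ w)

Knuth-sym : ∀ {u v} → Knuth u v → Knuth v u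
Knuth-sym (swap₁ p q) = swap₁⁻ p q
Knuth-sym (swap₁⁻ p q) = swap₁ p q
Knuth-sym (swap₂ p q) = swap₂⁻ p q
Knuth-sym (swap₂⁻ p q) = swap₂ p q

data Both (R : List ℕ → List ℕ → Set) : Maybe (List ℕ) → Maybe (List ℕ) → Set where
  neither : Both R nothing nothing
  both    : ∀ {u v} → R u v → Both R (just u) (just v)

Both-sym : ∀ {m m'} → Both Knuth m m' → Both Knuth m' m
Both-sym neither = neither
Both-sym (both k) = both (Knuth-sym k)

keep₁ : ∀ {a b c} → a ≤ c → c < b → ∀ m →
  Both Knuth (M.map (a ∷_) (M.map (b ∷_) (M.map (c ∷_) m))) (M.map (b ∷_) (M.map (a ∷_) (M.map (c ∷_) m)))
keep₁ p q (just w) = both (swap₁ p q)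
keep₁ p q nothing = neither

keep₂ : ∀ {a b c} → c < a → a ≤ b → ∀ m →
  Both Knuth (M.map (a ∷_) (M.map (b ∷_) (M.map (c ∷_) m))) (M.map (a ∷_) (M.map (c ∷_) (M.map (b ∷_) m)))
keep₂ p q (just w) = both (swap₂ p q)
keep₂ p q nothing = neither

≤∧≢⇒≤pred : ∀ {x i} → x ≤ suc i → x ≢ suc i → x ≤ i
≤∧≢⇒≤pred le ne = ≤-pred (≤∧≢⇒< le ne)

Commutes : ℕ → List ℕ → List ℕ → Set
Commutes i u v = φ i u ≡ φ i v × Both Knuth (raise i u) (raise i v)

raise-swap₁ : ∀ i a b c w → a ≤ c → c < b → Commutes i (a ∷ b ∷ c ∷ w) (b ∷ a ∷ c ∷ w)
raise-swap₁ i a b c w p q with letter i a | letter? i a | letter i b | letter? i b | letter i c | letter? i c | φ i w | raise i w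
... | low | isLo refl | high | isHi refl | low | _ | k | m = refl , keep₁ p q m
... | low | isLo refl | high | isHi refl | high | isHi refl | k | m = ⊥-elim (<-irrefl refl q)
... | low | isLo refl | high | isHi refl | other | isOther ne _ | k | m = ⊥-elim (ne (≤-antisym (≤-pred q) p))
... | low | isLo refl | low | isLo refl | _ | _ | k | m = ⊥-elim (<-irrefl refl (≤-<-trans p q))
... | high | isHi refl | high | isHi refl | _ | _ | k | m = ⊥-elim (<-irrefl refl (≤-<-trans p q))
... | high | isHi refl | low | isLo refl | _ | _ | k | m = ⊥-elim (<-asym ≤-refl (≤-<-trans p q))
... | other | _ | low | isLo refl | low | _ | k | m = refl , keep₁ p q m
... | other | _ | low | isLo refl | high | isHi refl | k | m = ⊥-elim (<-asym ≤-refl q)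
... | other | _ | low | isLo refl | other | _ | k | m = refl , keep₁ p q m
... | other | _ | high | isHi refl | low | _ | k | m = refl , keep₁ p q m
... | other | _ | high | isHi refl | high | isHi refl | k | m = ⊥-elim (<-irrefl refl q)
... | other | _ | high | isHi refl | other | isOther ne _ | zero | m = refl , both (swap₁ p (≤∧≢⇒< (≤-pred q) ne))
... | other | _ | high | isHi refl | other | _ | suc k | m = refl , keep₁ p q m
... | other | _ | other | _ | low | _ | k | m = refl , keep₁ p q m
... | other | isOther _ ne | other | _ | high | isHi refl | zero | m = refl , both (swap₁ (≤∧≢⇒≤pred p ne) (<⇒≤ q))
... | other | _ | other | _ | high | _ | suc k | m = refl , keep₁ p q m
... | other | _ | other | _ | other | _ | k | m = refl , keep₁ p q m
... | low | _ | other | _ | low | _ | k | m = refl , keep₁ p q m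
... | low | isLo refl | other | _ | high | isHi refl | zero | m = refl , both (swap₁ ≤-refl (<⇒≤ q))
... | low | _ | other | _ | high | _ | suc k | m = refl , keep₁ p q m
... | low | _ | other | _ | other | _ | k | m = refl , keep₁ p q m
... | high | _ | other | _ | low | _ | k | m = refl , keep₁ p q m
... | high | isHi refl | other | _ | high | _ | zero | m = refl , both (swap₁ (<⇒≤ p) q)
... | high | isHi refl | other | _ | high | _ | suc zero | m = refl , both (swap₁ (<⇒≤ p) q)
... | high | _ | other | _ | high | _ | suc (suc k) | m = refl , keep₁ p q m
... | high | isHi refl | other | _ | other | _ | zero | m = refl , both (swap₁ (<⇒≤ p) q)
... | high | _ | other | _ | other | _ | suc k | m = refl , keep₁ p q m

raise-swap₂ : ∀ i a b c w → c < a → a ≤ b → Commutes i (a ∷ b ∷ c ∷ w) (a ∷ c ∷ b ∷ w)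
raise-swap₂ i a b c w p q with letter i a | letter? i a | letter i b | letter? i b | letter i c | letter? i c | φ i w | raise i w
-- The only case in which the relation changes its type: with i + 1 = j, the heads jji and jij rise
-- to iji and jii.
... | high | isHi refl | high | isHi refl | low | isLo refl | zero | m = refl , both (swap₁ ≤-refl ≤-refl)
... | high | _ | high | _ | low | _ | suc k | m = refl , keep₂ p q m
... | low | isLo refl | high | _ | low | isLo refl | k | m = ⊥-elim (<-irrefl refl p)
... | other | isOther _ ne | high | isHi refl | low | isLo refl | k | m = ⊥-elim (ne (≤-antisym q p))
... | _ | _ | low | isLo refl | low | isLo refl | k | m = ⊥-elim (<-irrefl refl (<-≤-trans p q))
... | _ | _ | high | isHi refl | high | isHi refl | k | m = ⊥-elim (<-irrefl refl (<-≤-trans p q))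
... | _ | _ | low | isLo refl | high | isHi refl | k | m = ⊥-elim (<-asym ≤-refl (<-≤-trans p q))
... | low | _ | low | _ | other | _ | k | m = refl , keep₂ p q m
... | high | _ | low | _ | other | _ | k | m = refl , keep₂ p q m
... | other | _ | low | _ | other | _ | k | m = refl , keep₂ p q m
... | low | isLo refl | high | isHi refl | other | _ | zero | m = refl , both (swap₂ p ≤-refl)
... | low | _ | high | _ | other | _ | suc k | m = refl , keep₂ p q m
... | other | isOther _ ne | high | isHi refl | other | _ | zero | m = refl , both (swap₂ p (≤∧≢⇒≤pred q ne))
... | other | _ | high | _ | other | _ | suc k | m = refl , keep₂ p q m
... | high | isHi refl | high | isHi refl | other | isOther ne _ | zero | m = refl , both (swap₂ (≤∧≢⇒< (≤-pred p) ne) (n≤1+n i))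
... | high | isHi refl | high | isHi refl | other | isOther ne _ | suc zero | m = refl , both (swap₂ (≤∧≢⇒< (≤-pred p) ne) (n≤1+n i))
... | high | _ | high | _ | other | _ | suc (suc k) | m = refl , keep₂ p q m
... | low | _ | other | _ | low | _ | k | m = refl , keep₂ p q m
... | high | _ | other | _ | low | _ | k | m = refl , keep₂ p q m
... | other | _ | other | _ | low | _ | k | m = refl , keep₂ p q m
... | low | isLo refl | other | _ | high | isHi refl | k | m = ⊥-elim (<-asym ≤-refl p)
... | high | isHi refl | other | _ | high | isHi refl | k | m = ⊥-elim (<-irrefl refl p)
... | other | _ | other | _ | high | isHi refl | zero | m = refl , both (swap₂ (<⇒≤ p) q)
... | other | _ | other | _ | high | _ | suc k | m = refl , keep₂ p q m
... | low | _ | other | _ | other | _ | k | m = refl , keep₂ p q m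
... | other | _ | other | _ | other | _ | k | m = refl , keep₂ p q m
... | high | isHi refl | other | _ | other | isOther ne _ | zero | m = refl , both (swap₂ (≤∧≢⇒< (≤-pred p) ne) (<⇒≤ q))
... | high | _ | other | _ | other | _ | suc k | m = refl , keep₂ p q m

raise-Knuth : ∀ i {u v} → Knuth u v → Commutes i u v
raise-Knuth i (swap₁ p q) = raise-swap₁ i _ _ _ _ p q
raise-Knuth i (swap₁⁻ p q) with raise-swap₁ i _ _ _ _ p q
... | e , b = sym e , Both-sym b
raise-Knuth i (swap₂ p q) = raise-swap₂ i _ _ _ _ p q
raise-Knuth i (swap₂⁻ p q) with raise-swap₂ i _ _ _ _ p q
... | e , b = sym e , Both-sym b

-- Knuth moves

knuth-case : Bool → Bool → Bool → ℕ → ℕ → ℕ → List ℕ → List ℕ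
knuth-case false true false a b c w = b ∷ a ∷ c ∷ w
knuth-case false true true a b c w = a ∷ c ∷ b ∷ w
knuth-case true false true a b c w = b ∷ a ∷ c ∷ w
knuth-case true false false a b c w = a ∷ c ∷ b ∷ w
knuth-case false false _ a b c w = a ∷ b ∷ c ∷ w
knuth-case true true _ a b c w = a ∷ b ∷ c ∷ w

-- Total: the identity where the letters at positions p, p+1, p+2 admit no Knuth relation.
knuth : ℕ → List ℕ → List ℕ
knuth zero (a ∷ b ∷ c ∷ w) = knuth-case (b <ᵇ a) (c <ᵇ b) (c <ᵇ a) a b c w
knuth zero w = w
knuth (suc p) [] = []
knuth (suc p) (x ∷ w) = x ∷ knuth p w

-- A relation applies to the first three letters exactly when one of the two adjacent pairs is a
-- descent and the other is not. The failure of this is expressed through descents because raising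
-- preserves them.
Flat : List Bool → Set
Flat (d ∷ e ∷ _ ∷ _) = d ≡ e
Flat _ = ⊤

knuth-flat : ∀ u → Flat (descents u) → knuth 0 u ≡ u
knuth-flat [] fl = refl
knuth-flat (a ∷ []) fl = refl
knuth-flat (a ∷ b ∷ []) fl = refl
knuth-flat (a ∷ b ∷ c ∷ w) fl with b <ᵇ a | c <ᵇ b
knuth-flat (a ∷ b ∷ c ∷ w) refl | true | true = refl
knuth-flat (a ∷ b ∷ c ∷ w) refl | false | false = refl

knuth-or-flat : ∀ u → Knuth u (knuth 0 u) ⊎ Flat (descents u)
knuth-or-flat [] = inj₂ tt
knuth-or-flat (a ∷ []) = inj₂ tt
knuth-or-flat (a ∷ b ∷ []) = inj₂ tt
knuth-or-flat (a ∷ b ∷ c ∷ w) with b <ᵇ a in p | c <ᵇ b in q | c <ᵇ a in r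
... | false | true | false = inj₁ (swap₁ (<ᵇ-false⁻¹ {c} r) (<ᵇ-true⁻¹ q))
... | false | true | true = inj₁ (swap₂ (<ᵇ-true⁻¹ r) (<ᵇ-false⁻¹ {b} p))
... | true | false | true = inj₁ (swap₁⁻ (<ᵇ-false⁻¹ {c} q) (<ᵇ-true⁻¹ r))
... | true | false | false = inj₁ (swap₂⁻ (<ᵇ-true⁻¹ p) (<ᵇ-false⁻¹ {c} r))
... | false | false | _ = inj₂ refl
... | true | true | _ = inj₂ refl

Knuth⇒knuth : ∀ {u v} → Knuth u v → knuth 0 u ≡ v
Knuth⇒knuth (swap₁ p q) rewrite <ᵇ-false (≤-trans p (<⇒≤ q)) | <ᵇ-true q | <ᵇ-false p = refl
Knuth⇒knuth (swap₁⁻ p q) rewrite <ᵇ-false p | <ᵇ-true (≤-<-trans p q) | <ᵇ-true q = refl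
Knuth⇒knuth (swap₂ p q) rewrite <ᵇ-false q | <ᵇ-true (<-≤-trans p q) | <ᵇ-true p = refl
Knuth⇒knuth (swap₂⁻ p q) rewrite <ᵇ-true p | <ᵇ-false (≤-trans (<⇒≤ p) q) | <ᵇ-false q = refl

knuth-involutive : ∀ p u → knuth p (knuth p u) ≡ u
knuth-involutive zero u with knuth-or-flat u
... | inj₁ k = Knuth⇒knuth (Knuth-sym k)
... | inj₂ fl = trans (cong (knuth 0) (knuth-flat u fl)) (knuth-flat u fl)
knuth-involutive (suc p) [] = refl
knuth-involutive (suc p) (x ∷ u) = cong (x ∷_) (knuth-involutive p u)

knuth-φ : ∀ i p u → φ i (knuth p u) ≡ φ i u
knuth-φ i zero u with knuth-or-flat u
... | inj₁ k = sym (proj₁ (raise-Knuth i k))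
... | inj₂ fl = cong (φ i) (knuth-flat u fl)
knuth-φ i (suc p) [] = refl
knuth-φ i (suc p) (x ∷ u) = cong (φ-step (letter i x)) (knuth-φ i p u)

-- Where a relation applies, this is `raise-Knuth`. Where none applies, none applies after raising
-- either, since the descents are the same, and the move is the identity on both words.
knuth-raise : ∀ i p u → raise i (knuth p u) ≡ M.map (knuth p) (raise i u)
knuth-raise i zero u with knuth-or-flat u
... | inj₁ k with raise i u | raise i (knuth 0 u) | proj₂ (raise-Knuth i k)
...   | _ | _ | neither = refl
...   | _ | _ | both k' = cong just (sym (Knuth⇒knuth k'))
knuth-raise i zero u | inj₂ fl rewrite knuth-flat u fl with raise i u in eq
... | nothing = refl
... | just u' = cong just (sym (knuth-flat u' (subst Flat (sym (descents-raise i u u' eq)) fl)))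
knuth-raise i (suc p) [] = refl
knuth-raise i (suc p) (x ∷ u) rewrite knuth-φ i p u | knuth-raise i p u = cases (letter i x) (φ i u) (raise i u)
  where
  keep : ∀ m → M.map (x ∷_) (M.map (knuth p) m) ≡ M.map (knuth (suc p)) (M.map (x ∷_) m)
  keep (just _) = refl
  keep nothing = refl
  cases : ∀ l k m → raise-step i l k x (knuth p u) (M.map (knuth p) m) ≡ M.map (knuth (suc p)) (raise-step i l k x u m)
  cases low k m = keep m
  cases high zero m = refl
  cases high (suc k) m = keep m
  cases other k m = keep m

knuths : List ℕ → List ℕ → List ℕ
knuths [] u = u
knuths (p ∷ ps) u = knuths ps (knuth p u)

knuths-injective : ∀ ps {u v} → knuths ps u ≡ knuths ps v → u ≡ v
knuths-injective [] eq = eq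
knuths-injective (p ∷ ps) {u} {v} eq = trans (sym (knuth-involutive p u))
  (trans (cong (knuth p) (knuths-injective ps eq)) (knuth-involutive p v))

knuths-raise : ∀ i ps u → raise i (knuths ps u) ≡ M.map (knuths ps) (raise i u)
knuths-raise i [] u with raise i u
... | just _ = refl
... | nothing = refl
knuths-raise i (p ∷ ps) u = trans (knuths-raise i ps (knuth p u)) (trans (cong (M.map (knuths ps)) (knuth-raise i p u)) (fuse (raise i u)))
  where
  fuse : ∀ m → M.map (knuths ps) (M.map (knuth p) m) ≡ M.map (knuths (p ∷ ps)) m
  fuse (just _) = refl
  fuse nothing = refl

-- Invariants of Knuth moves

-- Raising lowers this sum by one: it is the measure for climbing to a highest weight word, and it
-- compares two such words.
total : List ℕ → ℕ
total = foldr _+_ 0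

total-raise : ∀ i w w' → raise i w ≡ just w' → total w ≡ suc (total w')
total-raise i (x ∷ w) w' eq with letter i x | letter? i x
... | low | _ with map-∷ x (raise i w) eq
...   | v , eqv , refl = trans (cong (x +_) (total-raise i w v eqv)) (+-suc x (total v))
total-raise i (x ∷ w) w' eq | other | _ with map-∷ x (raise i w) eq
...   | v , eqv , refl = trans (cong (x +_) (total-raise i w v eqv)) (+-suc x (total v))
total-raise i (x ∷ w) w' eq | high | isHi refl with φ i w
total-raise i (x ∷ w) .(i ∷ w) refl | high | isHi refl | zero = refl
... | suc k with map-∷ x (raise i w) eq
...   | v , eqv , refl = trans (cong (x +_) (total-raise i w v eqv)) (+-suc x (total v))

[_≟ᵇ_] : ℕ → ℕ → ℕ
[ x ≟ᵇ v ] = if x ≡ᵇ v then 1 else 0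

count-∷ : ∀ v x w → count v (x ∷ w) ≡ [ x ≟ᵇ v ] + count v w
count-∷ v x w with x ≟ v
... | yes refl rewrite ≡ᵇ-refl x = refl
... | no ne rewrite ≡ᵇ-false ne = refl

count-++ : ∀ v u w → count v (u ++ w) ≡ count v u + count v w
count-++ v [] w = refl
count-++ v (x ∷ u) w rewrite count-∷ v x (u ++ w) | count-∷ v x u | count-++ v u w = sym (+-assoc [ x ≟ᵇ v ] (count v u) (count v w))

module Additive (f : ℕ → ℕ) (F : List ℕ → ℕ) (F-∷ : ∀ x w → F (x ∷ w) ≡ f x + F w) where

  F-swap : ∀ a b w → F (a ∷ b ∷ w) ≡ F (b ∷ a ∷ w)
  F-swap a b w rewrite F-∷ a (b ∷ w) | F-∷ b w | F-∷ b (a ∷ w) | F-∷ a w =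
    trans (sym (+-assoc (f a) (f b) (F w))) (trans (cong (_+ F w) (+-comm (f a) (f b))) (+-assoc (f b) (f a) (F w)))

  F-cons : ∀ x {u v} → F u ≡ F v → F (x ∷ u) ≡ F (x ∷ v)
  F-cons x {u} {v} eq rewrite F-∷ x u | F-∷ x v = cong (f x +_) eq

  F-Knuth : ∀ {u v} → Knuth u v → F u ≡ F v
  F-Knuth (swap₁ _ _) = F-swap _ _ _
  F-Knuth (swap₁⁻ _ _) = F-swap _ _ _
  F-Knuth (swap₂ _ _) = F-cons _ (F-swap _ _ _)
  F-Knuth (swap₂⁻ _ _) = F-cons _ (F-swap _ _ _)

  F-knuth : ∀ p u → F (knuth p u) ≡ F u
  F-knuth zero u with knuth-or-flat u
  ... | inj₁ k = sym (F-Knuth k)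
  ... | inj₂ fl = cong F (knuth-flat u fl)
  F-knuth (suc p) [] = refl
  F-knuth (suc p) (x ∷ u) = F-cons x (F-knuth p u)

  F-knuths : ∀ ps u → F (knuths ps u) ≡ F u
  F-knuths [] u = refl
  F-knuths (p ∷ ps) u = trans (F-knuths ps (knuth p u)) (F-knuth p u)

count-knuths : ∀ v ps u → count v (knuths ps u) ≡ count v u
count-knuths v = Additive.F-knuths (λ x → [ x ≟ᵇ v ]) (count v) (count-∷ v)

total-knuths : ∀ ps u → total (knuths ps u) ≡ total u
total-knuths = Additive.F-knuths id total (λ _ _ → refl)

InRange : ℕ → List ℕ → Set
InRange n = All (λ x → 1 ≤ x × x ≤ n)

InRange-Knuth : ∀ {n u v} → Knuth u v → InRange n u → InRange n v
InRange-Knuth (swap₁ _ _) (a ∷ b ∷ w) = b ∷ a ∷ w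
InRange-Knuth (swap₁⁻ _ _) (a ∷ b ∷ w) = b ∷ a ∷ w
InRange-Knuth (swap₂ _ _) (a ∷ b ∷ c ∷ w) = a ∷ c ∷ b ∷ w
InRange-Knuth (swap₂⁻ _ _) (a ∷ b ∷ c ∷ w) = a ∷ c ∷ b ∷ w

InRange-knuth : ∀ {n} p u → InRange n u → InRange n (knuth p u)
InRange-knuth zero u r with knuth-or-flat u
... | inj₁ k = InRange-Knuth k r
... | inj₂ fl = subst (InRange _) (sym (knuth-flat u fl)) r
InRange-knuth (suc p) [] r = r
InRange-knuth (suc p) (x ∷ u) (rx ∷ r) = rx ∷ InRange-knuth p u r

InRange-knuths : ∀ {n} ps u → InRange n u → InRange n (knuths ps u)
InRange-knuths [] u r = r
InRange-knuths (p ∷ ps) u r = InRange-knuths ps (knuth p u) (InRange-knuth p u r)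

-- Reduction of a Yamanouchi word to its canonical word

infix 4 _≈ᴷ_
-- The witness is a list of positions rather than a chain of relations, because the same moves are
-- later applied to every word of the component.
_≈ᴷ_ : List ℕ → List ℕ → Set
u ≈ᴷ v = ∃ λ ps → knuths ps u ≡ v

knuths-++ : ∀ ps qs u → knuths (ps ++ qs) u ≡ knuths qs (knuths ps u)
knuths-++ [] qs u = refl
knuths-++ (p ∷ ps) qs u = knuths-++ ps qs (knuth p u)

≈ᴷ-refl : ∀ {u} → u ≈ᴷ u
≈ᴷ-refl = [] , refl

≈ᴷ-trans : ∀ {u v w} → u ≈ᴷ v → v ≈ᴷ w → u ≈ᴷ w
≈ᴷ-trans {u} (ps , refl) (qs , refl) = ps ++ qs , knuths-++ ps qs u

≈ᴷ-cons : ∀ x {u v} → u ≈ᴷ v → x ∷ u ≈ᴷ x ∷ v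
≈ᴷ-cons x {u} (ps , refl) = map suc ps , go ps u
  where
  go : ∀ ps u → knuths (map suc ps) (x ∷ u) ≡ x ∷ knuths ps u
  go [] u = refl
  go (p ∷ ps) u = go ps (knuth p u)

≈ᴷ-prefix : ∀ xs {u v} → u ≈ᴷ v → xs ++ u ≈ᴷ xs ++ v
≈ᴷ-prefix [] r = r
≈ᴷ-prefix (x ∷ xs) r = ≈ᴷ-cons x (≈ᴷ-prefix xs r)

Knuth⇒≈ᴷ : ∀ {u v} → Knuth u v → u ≈ᴷ v
Knuth⇒≈ᴷ k = 0 ∷ [] , Knuth⇒knuth k

slide : ∀ y z k w → y < z → replicate (suc k) z ++ y ∷ w ≈ᴷ z ∷ y ∷ replicate k z ++ w
slide y z zero w lt = ≈ᴷ-refl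
slide y z (suc k) w lt = ≈ᴷ-trans (≈ᴷ-cons z (slide y z k w lt)) (Knuth⇒≈ᴷ (swap₂ lt ≤-refl))

-- The `x` passes the `z` with the help of the `y` behind them: one `y` is pulled next to the first
-- `z`, `x` and `z` change places, and the `y` is returned. Each `z` that is passed needs a `y`,
-- whence `k ≤ m`.
bump : ∀ x y z k m w → x ≤ y → y < z → k ≤ m →
  x ∷ replicate k z ++ replicate m y ++ w ≈ᴷ replicate k z ++ x ∷ replicate m y ++ w
bump x y z zero m w p q _ = ≈ᴷ-refl
bump x y z (suc k) (suc m) w p q (s≤s le) =
  ≈ᴷ-trans (≈ᴷ-cons x (slide y z k (replicate m y ++ w) q))
  (≈ᴷ-trans (Knuth⇒≈ᴷ (swap₁ p q))
  (≈ᴷ-trans (≈ᴷ-cons z (≈ᴷ-cons x (bump y y z k m w ≤-refl q le)))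
  (≈ᴷ-cons z (≈ᴷ-trans (≈ᴷ-cons x (regroup k))
    (bump x y z k (suc m) w p q (m≤n⇒m≤1+n le))))))
  where
  regroup : ∀ k → replicate k z ++ y ∷ replicate m y ++ w ≈ᴷ replicate k z ++ replicate (suc m) y ++ w
  regroup k = ≈ᴷ-refl

canon : (ℕ → ℕ) → ℕ → List ℕ
canon μ zero = []
canon μ (suc m) = replicate (μ (suc m)) (suc m) ++ canon μ m

canon-cong : ∀ {μ ν} m → (∀ j → 1 ≤ j → j ≤ m → μ j ≡ ν j) → canon μ m ≡ canon ν m
canon-cong zero eq = refl
canon-cong (suc m) eq = cong₂ (λ k u → replicate k (suc m) ++ u) (eq (suc m) (s≤s z≤n) ≤-refl)
  (canon-cong m λ j p q → eq j p (m≤n⇒m≤1+n q))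

-- To pass the block of the largest letter, `x` uses the block of the next smaller letter as the
-- supply for `bump`; that block is long enough because `μ` is weakly decreasing.
canon-insert : ∀ μ ν x m → (∀ j → 1 ≤ j → μ (suc j) ≤ μ j) → 1 ≤ x → x ≤ m →
  ν x ≡ suc (μ x) → (∀ j → j ≢ x → ν j ≡ μ j) → x ∷ canon μ m ≈ᴷ canon ν m
canon-insert μ ν .0 zero anti () z≤n eqx eq
canon-insert μ ν x (suc m) anti 1≤x x≤m eqx eq with x ≟ suc m
... | yes refl rewrite eqx | canon-cong {ν} {μ} m (λ j _ q → eq j λ { refl → 1+n≰n q }) = ≈ᴷ-refl
... | no ne rewrite eq (suc m) (λ e → ne (sym e)) with m | ≤∧≢⇒≤pred x≤m ne
...   | zero | x≤0 = ⊥-elim (1+n≰n (≤-trans 1≤x x≤0))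
...   | suc m' | x≤m' =
  ≈ᴷ-trans (bump x (suc m') (suc (suc m')) (μ (suc (suc m'))) (μ (suc m')) (canon μ m') x≤m' ≤-refl (anti (suc m') (s≤s z≤n)))
    (≈ᴷ-prefix (replicate (μ (suc (suc m'))) (suc (suc m'))) (canon-insert μ ν x (suc m') anti 1≤x x≤m' eqx eq))

-- The inequality between the numbers of `i + 1` and `i` in all suffixes is required only where it
-- can break, when an `i + 1` is put in front; counting before that letter makes it strict.
data Yamanouchi (n : ℕ) : List ℕ → Set where
  [] : Yamanouchi n []
  yam : ∀ {x w} → 1 ≤ x → x ≤ n → (∀ i → 1 ≤ i → x ≡ suc i → count (suc i) w < count i w) →
    Yamanouchi n w → Yamanouchi n (x ∷ w)

count-self : ∀ x w → count x (x ∷ w) ≡ suc (count x w)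
count-self x w rewrite count-∷ x x w | ≡ᵇ-refl x = refl

count-other : ∀ {v x} w → x ≢ v → count v (x ∷ w) ≡ count v w
count-other {v} {x} w ne rewrite count-∷ v x w | ≡ᵇ-false ne = refl

yam-antitone : ∀ {n w} → Yamanouchi n w → ∀ j → 1 ≤ j → count (suc j) w ≤ count j w
yam-antitone [] j 1≤j = z≤n
yam-antitone (yam {x} {w} _ _ h y) j 1≤j with x ≟ suc j
... | yes refl rewrite count-self (suc j) w | count-other {j} {suc j} w 1+n≢n = h j 1≤j refl
... | no ne rewrite count-other {suc j} {x} w ne | count-∷ j x w = ≤-trans (yam-antitone y j 1≤j) (m≤n+m _ [ x ≟ᵇ j ])

yam-canon : ∀ {n w} → Yamanouchi n w → w ≈ᴷ canon (λ j → count j w) n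
yam-canon {n} [] = subst ([] ≈ᴷ_) (sym (empty n)) ≈ᴷ-refl
  where
  empty : ∀ n → canon (λ j → 0) n ≡ []
  empty zero = refl
  empty (suc n) = empty n
yam-canon {n} (yam {x} {w} 1≤x x≤n h y) = ≈ᴷ-trans (≈ᴷ-cons x (yam-canon y))
  (canon-insert (λ j → count j w) (λ j → count j (x ∷ w)) x n (yam-antitone y) 1≤x x≤n (count-self x w)
    λ j ne → count-other w λ e → ne (sym e))

record Highest (n : ℕ) (w : List ℕ) : Set where
  constructor highest
  field
    inRange : InRange n w
    noRaise : ∀ i → Valid n i → raise i w ≡ nothing

map-nothing : ∀ {A B : Set} (f : A → B) m → M.map f m ≡ nothing → m ≡ nothing
map-nothing f nothing eq = refl

raise-tail : ∀ i x w → raise i (x ∷ w) ≡ nothing → raise i w ≡ nothing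
raise-tail i x w eq with letter i x | φ i w
... | low | _ = map-nothing _ _ eq
... | other | _ = map-nothing _ _ eq
... | high | suc k = map-nothing _ _ eq

raise-here : ∀ i w → φ i w ≡ 0 → raise i (suc i ∷ w) ≡ just (i ∷ w)
raise-here i w ph rewrite letter-high i | ph = refl

φ-positive : ∀ i w → raise i (suc i ∷ w) ≡ nothing → φ i w ≢ 0
φ-positive i w eq ph = case trans (sym (raise-here i w ph)) eq of λ ()

-- If nothing can be raised, every `i + 1` is bracketed with an `i`, and the unpaired `i` are the
-- surplus.
φ-count : ∀ i w → raise i w ≡ nothing → φ i w + count (suc i) w ≡ count i w
φ-count i [] eq = refl
φ-count i (x ∷ w) eq with φ-count i w (raise-tail i x w eq) | letter i x | letter? i x
... | ih | low | isLo refl rewrite count-self i w | count-other {suc i} {i} w (1+n≢n ∘ sym) = cong suc ih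
... | ih | other | isOther ne ne' rewrite count-other w ne | count-other w ne' = ih
... | ih | high | isHi refl rewrite count-self (suc i) w | count-other {i} {suc i} w 1+n≢n =
  shift (φ i w) (φ-positive i w eq) ih
  where
  shift : ∀ k {c d} → k ≢ 0 → k + c ≡ d → k ∸ 1 + suc c ≡ d
  shift zero ne _ = ⊥-elim (ne refl)
  shift (suc k) {c} _ e = trans (+-suc k c) e

highest-yam : ∀ {n} w → Highest n w → Yamanouchi n w
highest-yam [] h = []
highest-yam {n} (x ∷ w) (highest ((1≤x , x≤n) ∷ r) nr) = yam 1≤x x≤n cond
  (highest-yam w (highest r λ i v → raise-tail i x w (nr i v)))
  where
  cond : ∀ i → 1 ≤ i → x ≡ suc i → count (suc i) w < count i w
  cond i 1≤i refl = positive (φ i w) (φ-positive i w (nr i (1≤i , x≤n)))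
    (φ-count i w (raise-tail i x w (nr i (1≤i , x≤n))))
    where
    positive : ∀ k {c d} → k ≢ 0 → k + c ≡ d → c < d
    positive zero ne _ = ⊥-elim (ne refl)
    positive (suc k) {c} _ refl = s≤s (m≤n+m c k)

knuths-highest : ∀ {n} ps w → Highest n w → Highest n (knuths ps w)
knuths-highest ps w (highest r nr) = highest (InRange-knuths ps w r)
  λ i v → trans (knuths-raise i ps w) (cong (M.map (knuths ps)) (nr i v))

-- Uniqueness of the highest weight word in a component

data Connected (n : ℕ) (u : List ℕ) : List ℕ → Set where
  here : Connected n u u
  up   : ∀ {v v'} i → Valid n i → Connected n u v → raise i v ≡ just v' → Connected n u v'
  dn   : ∀ {v v'} i → Valid n i → Connected n u v → raise i v' ≡ just v → Connected n u v'

connected-descents : ∀ {n u v} → Connected n u v → descents v ≡ descents u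
connected-descents here = refl
connected-descents (up i _ c eq) = trans (descents-raise i _ _ eq) (connected-descents c)
connected-descents (dn i _ c eq) = trans (sym (descents-raise i _ _ eq)) (connected-descents c)

connected-knuths : ∀ {n u v} ps → Connected n u v → Connected n (knuths ps u) (knuths ps v)
connected-knuths ps here = here
connected-knuths ps (up i va c eq) = up i va (connected-knuths ps c) (trans (knuths-raise i ps _) (cong (M.map (knuths ps)) eq))
connected-knuths ps (dn i va c eq) = dn i va (connected-knuths ps c) (trans (knuths-raise i ps _) (cong (M.map (knuths ps)) eq))

-- The form of canonical words suited to induction: the head either repeats the next letter or
-- exceeds all later ones, that is, it either starts a non-descent or starts a new block.
data Stair : List ℕ → Set where
  []   : Stair []
  same : ∀ {x u} → Stair (x ∷ u) → Stair (x ∷ x ∷ u)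
  next : ∀ {x u} → 1 ≤ x → All (_< x) u → Stair u → Stair (x ∷ u)

canon-bound : ∀ μ m → All (_< suc m) (canon μ m)
canon-bound μ zero = []
canon-bound μ (suc m) = go (μ (suc m))
  where
  go : ∀ k → All (_< suc (suc m)) (replicate k (suc m) ++ canon μ m)
  go zero = All.map m<n⇒m<1+n (canon-bound μ m)
  go (suc k) = ≤-refl ∷ go k

canon-stair : ∀ μ m → Stair (canon μ m)
canon-stair μ zero = []
canon-stair μ (suc m) = go (μ (suc m))
  where
  go : ∀ k → Stair (replicate k (suc m) ++ canon μ m)
  go zero = canon-stair μ m
  go (suc zero) = next (s≤s z≤n) (canon-bound μ m) (canon-stair μ m)
  go (suc (suc k)) = same (go (suc k))

pointwise-bound : ∀ {x w u} → Pointwise _≤_ w u → All (_< x) u → All (_< x) w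
pointwise-bound [] [] = []
pointwise-bound (p ∷ ps) (q ∷ qs) = ≤-<-trans p q ∷ pointwise-bound ps qs

count-bound : ∀ v x w → All (_< x) w → 0 < count v w → v < x
count-bound v x (y ∷ w) (p ∷ ps) lt = case y ≟ v of λ
  { (yes refl) → p
  ; (no ne) → count-bound v x w ps (subst (0 <_) (count-other w ne) lt) }

-- Rows of w are weakly increasing (no descents) and a Yamanouchi letter exceeds the later ones by at most one.
yam-below : ∀ {n u w} → Stair u → Yamanouchi n w → descents w ≡ descents u → Pointwise _≤_ w u
yam-below [] [] eq = []
yam-below (same {x} st) (yam {y} _ _ _ (yam {z} p q r ym)) eq with ∷-injective eq
... | d , ds with yam-below st (yam p q r ym) ds
...   | z≤x ∷ pw = ≤-trans (<ᵇ-false⁻¹ {z} (trans d (<ᵇ-false {x} ≤-refl))) z≤x ∷ z≤x ∷ pw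
yam-below (next {x} {u} 1≤x below st) (yam {y} {w} 1≤y y≤n h ym) eq = head y 1≤y h ∷ pw
  where
  pw : Pointwise _≤_ w u
  pw = yam-below st ym (proj₂ (∷-injective eq))
  head : ∀ y → 1 ≤ y → (∀ i → 1 ≤ i → y ≡ suc i → count (suc i) w < count i w) → y ≤ x
  head (suc zero) _ _ = 1≤x
  -- The Yamanouchi condition makes `suc j` occur in `w`, whose letters are bounded by those of `u`
  -- and hence lie below `x`.
  head (suc (suc j)) _ h = count-bound (suc j) x w (pointwise-bound pw below)
    (≤-<-trans z≤n (h (suc j) (s≤s z≤n) refl))

pointwise-total : ∀ {w u} → Pointwise _≤_ w u → total w ≤ total u
pointwise-total [] = z≤n
pointwise-total (p ∷ ps) = +-mono-≤ p (pointwise-total ps)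

pointwise-total-≡ : ∀ {w u} → Pointwise _≤_ w u → total u ≤ total w → w ≡ u
pointwise-total-≡ [] le = refl
pointwise-total-≡ {x ∷ w} {y ∷ u} (p ∷ ps) le with m≤n⇒m<n∨m≡n p
... | inj₁ lt = ⊥-elim (1+n≰n (≤-trans (+-mono-≤ lt (pointwise-total ps)) le))
... | inj₂ refl = cong (x ∷_) (pointwise-total-≡ ps (+-cancelˡ-≤ x _ _ le))

-- Descents are constant on the component, so `yam-below` bounds `v` by the canonical word letter by
-- letter. The moves that take `v` to its own canonical word carry the component along, and the same
-- bound there gives the opposite inequality of the sums; sums are invariant under moves, so
-- equality follows.
highest-unique : ∀ {n μ v} → Highest n (canon μ n) → Highest n v → Connected n (canon μ n) v → v ≡ canon μ n
highest-unique {n} {μ} {v} hu hv c with yam-canon (highest-yam v hv)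
... | ps , eq = pointwise-total-≡ (yam-below (canon-stair μ n) (highest-yam v hv) (connected-descents c)) le
  where
  ν : ℕ → ℕ
  ν j = count j v
  u : List ℕ
  u = knuths ps (canon μ n)
  pw : Pointwise _≤_ u (canon ν n)
  pw = yam-below (canon-stair ν n) (highest-yam u (knuths-highest ps _ hu))
    (sym (connected-descents (subst (Connected n u) eq (connected-knuths ps c))))
  le : total (canon μ n) ≤ total v
  le = subst₂ _≤_ (total-knuths ps (canon μ n)) (trans (cong total (sym eq)) (total-knuths ps v)) (pointwise-total pw)

-- The cells with entries i and i + 1

-- The cells of a filling with entry i (D₀) or i + 1 (D₁). All axioms are invariant under the half turn that
-- reverses rows and columns and exchanges i with i + 1, so each lemma also holds in the dual system.
record Dots : Set₁ where
  infix 4 _⊏_ _≺_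
  field
    _⊏_ _≺_ : ℕ → ℕ → Set
    Next D₀ D₁ : ℕ → ℕ → Set
    ⊏-irrefl : ∀ {p} → ¬ p ⊏ p
    ⊏-trans  : ∀ {p q r} → p ⊏ q → q ⊏ r → p ⊏ r
    ⊏-cmp    : ∀ p q → p ⊏ q ⊎ (p ≡ q ⊎ q ⊏ p)
    ≺-asym   : ∀ {p q} → p ≺ q → ¬ q ≺ p
    ≺-cmp    : ∀ {p q} → p ≢ q → p ≺ q ⊎ q ≺ p
    D₀?      : ∀ c → (∃ λ p → D₀ p c) ⊎ (∀ p → ¬ D₀ p c)
    D₁?      : ∀ c → (∃ λ p → D₁ p c) ⊎ (∀ p → ¬ D₁ p c)
    D₀-unique : ∀ {p q c} → D₀ p c → D₀ q c → p ≡ q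
    D₁-unique : ∀ {p q c} → D₁ p c → D₁ q c → p ≡ q
    D₀≢D₁    : ∀ {p q c} → D₀ p c → D₁ q c → p ≢ q
    clash₀   : ∀ {p q c d} → Next c d → D₀ p c → D₀ q d → ¬ q ⊏ p
    clash₁   : ∀ {p q c d} → Next c d → D₁ p c → D₁ q d → ¬ q ⊏ p
    cross    : ∀ {p q c d} → Next c d → D₁ p c → D₀ q d → q ⊏ p → (D₁ p d × q ≺ p) ⊎ (D₀ q c × p ≺ q)
    copyˡ    : ∀ {p q b c} → Next b c → D₁ p c → D₀ q c → p ⊏ q → p ≺ q → D₀ q b
    copyʳ    : ∀ {p q c d} → Next c d → D₁ p c → D₀ q c → p ⊏ q → q ≺ p → D₁ p d
    previous : ∀ {p q c} → D₁ p c → D₀ q c → p ⊏ q → ∃ λ b → Next b c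
    following : ∀ {p q c} → D₁ p c → D₀ q c → p ⊏ q → ∃ λ d → Next c d
    accˡ     : ∀ c → Acc Next c
    accʳ     : ∀ c → Acc (λ d c → Next c d) c

dual : Dots → Dots
dual D = record
  { _⊏_ = λ p q → q ⊏ p ; _≺_ = _≺_ ; Next = λ c d → Next d c ; D₀ = D₁ ; D₁ = D₀
  ; ⊏-irrefl = ⊏-irrefl ; ⊏-trans = λ x y → ⊏-trans y x
  ; ⊏-cmp = λ p q → [ inj₂ ∘ inj₂ , [ inj₂ ∘ inj₁ , inj₁ ]′ ]′ (⊏-cmp p q)
  ; ≺-asym = ≺-asym ; ≺-cmp = ≺-cmp ; D₀? = D₁? ; D₁? = D₀?
  ; D₀-unique = D₁-unique ; D₁-unique = D₀-unique ; D₀≢D₁ = λ x y e → D₀≢D₁ y x (sym e)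
  ; clash₀ = λ n x y → clash₁ n y x ; clash₁ = λ n x y → clash₀ n y x
  ; cross = λ n x y l → [ inj₂ , inj₁ ]′ (cross n y x l)
  ; copyˡ = λ n x y l k → copyʳ n y x l k ; copyʳ = λ n x y l k → copyˡ n y x l k
  ; previous = λ x y l → following y x l ; following = λ x y l → previous y x l
  ; accˡ = accʳ ; accʳ = accˡ }
  where open Dots D

-- Columns with both letters are paired in themselves, so then the pairing scan reaches column c with an open i.
data Left₀ (D : Dots) (c : ℕ) : Set where
  here  : ∀ {b p} → Dots.Next D b c → Dots.D₀ D p b → (∀ q → ¬ Dots.D₁ D q b) → Left₀ D c
  there : ∀ {b p q} → Dots.Next D b c → Dots.D₀ D p b → Dots.D₁ D q b → Left₀ D b → Left₀ D c

Right₁ : Dots → ℕ → Set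
Right₁ D = Left₀ (dual D)

left₀-dual² : ∀ D {c} → Left₀ (dual (dual D)) c → Left₀ D c
left₀-dual² D (here n d₀ none) = here n d₀ none
left₀-dual² D (there n d₀ d₁ l) = there n d₀ d₁ (left₀-dual² D l)

-- Follow the `i` to the left. By `copyˡ` it stays in row `q`, and by `clash₁` an `i + 1` in the
-- previous column is not above `p`; so that column either lacks `i + 1` or is inverted again, and
-- the other order of ranks would contradict `copyʳ`. As every inverted column has a predecessor,
-- well-foundedness ends the walk at a column with `i` alone.
inverted⇒left₀ : ∀ D {p q c} → Acc (Dots.Next D) c → Dots.D₁ D p c → Dots.D₀ D q c →
  Dots._⊏_ D p q → Dots._≺_ D p q → Left₀ D c
inverted⇒left₀ D {p} {q} {c} (acc rec) d₁ d₀ p⊏q p≺q with Dots.previous D d₁ d₀ p⊏q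
... | b , n with Dots.copyˡ D n d₁ d₀ p⊏q p≺q
...   | q∈b with Dots.D₁? D b
...     | inj₂ none = here n q∈b none
...     | inj₁ (o , o∈b) with o⊏q
  where
  open Dots D
  o⊏q : o ⊏ q
  o⊏q with ⊏-cmp p o
  ... | inj₁ p⊏o = ⊥-elim (clash₁ n o∈b d₁ p⊏o)
  ... | inj₂ (inj₁ refl) = p⊏q
  ... | inj₂ (inj₂ o⊏p) = ⊏-trans o⊏p p⊏q
...       | o⊏q with Dots.≺-cmp D (λ e → Dots.D₀≢D₁ D q∈b o∈b (sym e))
...         | inj₁ o≺q = there n q∈b o∈b (inverted⇒left₀ D (rec n) o∈b q∈b o⊏q o≺q)
...         | inj₂ q≺o with Dots.D₁-unique D (Dots.copyʳ D n o∈b q∈b o⊏q q≺o) d₁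
...           | refl = ⊥-elim (Dots.≺-asym D p≺q q≺o)

inverted⇒right₁ : ∀ D {p q c} → Acc (λ d c → Dots.Next D c d) c → Dots.D₁ D p c → Dots.D₀ D q c →
  Dots._⊏_ D p q → Dots._≺_ D q p → Right₁ D c
inverted⇒right₁ D a d₁ d₀ p⊏q q≺p = inverted⇒left₀ (dual D) a d₀ d₁ p⊏q q≺p

module Chains (D : Dots) (r c : ℕ) (start₁ : Dots.D₁ D r c) (single : ∀ p → ¬ Dots.D₀ D p c)
              (¬left : ¬ Left₀ D c) (¬right : ¬ Right₁ D c) where
  open Dots D

  -- `LeftLink` and `RightLink` are the conditions under which the raising operator continues its
  -- swaps from column `c` to the left and to the right.
  LeftLink : ℕ → Set
  LeftLink b = D₁ r b × ∃ λ p → D₀ p b × r ⊏ p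

  RightLink : ℕ → Set
  RightLink d = D₁ r d × ∃ λ p → D₀ p d × p ⊏ r

  data LeftChain : ℕ → Set where
    start  : LeftChain c
    extend : ∀ {b d} → LeftChain d → Next b d → LeftLink b → LeftChain b

  data RightChain : ℕ → Set where
    start  : RightChain c
    extend : ∀ {b d} → RightChain b → Next b d → RightLink d → RightChain d

  left-D₁ : ∀ {d} → LeftChain d → D₁ r d
  left-D₁ start = start₁
  left-D₁ (extend _ _ (d₁ , _)) = d₁

  left-¬left : ∀ {d} → LeftChain d → ¬ Left₀ D d
  left-¬left start = ¬left
  left-¬left (extend ch n (d₁ , p , d₀ , _)) l = left-¬left ch (there n d₀ d₁ l)

  -- If the row of the `i` outranked `r`, then `inverted⇒left₀` would produce an open `i` to the
  -- left, and the `i + 1` of column `c` would be paired.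
  left-other : ∀ {d p} → LeftChain d → D₀ p d → r ⊏ p × p ≺ r
  left-other start d₀ = ⊥-elim (single _ d₀)
  left-other ch@(extend _ _ (d₁ , p , d₀' , r⊏p)) d₀ with D₀-unique d₀ d₀'
  ... | refl with ≺-cmp (D₀≢D₁ d₀ d₁)
  ...   | inj₁ p≺r = r⊏p , p≺r
  ...   | inj₂ r≺p = ⊥-elim (left-¬left ch (inverted⇒left₀ D (accˡ _) d₁ d₀ r⊏p r≺p))

  -- An `i + 1` above row `r` just before the chain would attack. An `i` there would be open, either
  -- alone in its column or by `inverted⇒left₀`, or it would prolong the chain, or `copyʳ` would
  -- move the `i + 1` of its column into row `r`.
  left-stop : ∀ {b d} → LeftChain d → Next b d → ¬ LeftLink b → ∀ o → D₀ o b ⊎ D₁ o b → ¬ r ⊏ o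
  left-stop ch n ¬link o (inj₂ d₁) r⊏o = clash₁ n d₁ (left-D₁ ch) r⊏o
  left-stop {b} {d} ch n ¬link o (inj₁ d₀) r⊏o with D₁? b
  ... | inj₂ none = left-¬left ch (here n d₀ none)
  ... | inj₁ (o' , d₁) with ⊏-cmp r o'
  ...   | inj₁ r⊏o' = clash₁ n d₁ (left-D₁ ch) r⊏o'
  ...   | inj₂ (inj₁ refl) = ¬link (d₁ , o , d₀ , r⊏o)
  ...   | inj₂ (inj₂ o'⊏r) with ≺-cmp (D₀≢D₁ d₀ d₁)
  ...     | inj₂ o'≺o = left-¬left ch (there n d₀ d₁ (inverted⇒left₀ D (accˡ _) d₁ d₀ (⊏-trans o'⊏r r⊏o) o'≺o))
  ...     | inj₁ o≺o' with D₁-unique (copyʳ n d₁ d₀ (⊏-trans o'⊏r r⊏o) o≺o') (left-D₁ ch)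
  ...       | refl = ⊏-irrefl o'⊏r

  right-D₁ : ∀ {d} → RightChain d → D₁ r d
  right-D₁ start = start₁
  right-D₁ (extend _ _ (d₁ , _)) = d₁

  right-¬right : ∀ {d} → RightChain d → ¬ Right₁ D d
  right-¬right start = ¬right
  right-¬right (extend ch n (d₁ , p , d₀ , _)) l = right-¬right ch (there n d₁ d₀ l)

  right-other : ∀ {d p} → RightChain d → D₀ p d → p ⊏ r × p ≺ r
  right-other start d₀ = ⊥-elim (single _ d₀)
  right-other (extend ch n (d₁ , p , d₀' , p⊏r)) d₀ with D₀-unique d₀ d₀'
  ... | refl with cross n (right-D₁ ch) d₀ p⊏r
  ...   | inj₁ (_ , p≺r) = p⊏r , p≺r
  ...   | inj₂ (d₀'' , _) = p⊏r , proj₂ (right-other ch d₀'')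

  right-stop : ∀ {b d} → RightChain b → Next b d → ¬ RightLink d → ∀ q → D₀ q d ⊎ D₁ q d → ¬ q ⊏ r
  right-stop ch n ¬link q (inj₂ d₁) q⊏r = clash₁ n (right-D₁ ch) d₁ q⊏r
  right-stop ch n ¬link q (inj₁ d₀) q⊏r with cross n (right-D₁ ch) d₀ q⊏r
  ... | inj₁ (d₁ , _) = ¬link (d₁ , q , d₀ , q⊏r)
  ... | inj₂ (d₀' , r≺q) = ≺-asym r≺q (proj₂ (right-other ch d₀'))

  -- An `i + 1` of row `r` after the chain would be a further unpaired one if no `i` were in its
  -- column. With an `i` above `r`, one order of ranks again yields an unpaired `i + 1` to the
  -- right, and the other copies that `i` back into the chain, where it would have to be below `r`.
  right-end : ∀ {b d} → RightChain b → Next b d → ¬ RightLink d → ¬ D₁ r d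
  right-end {b} {d} ch n ¬link d₁ with D₀? d
  ... | inj₂ none = right-¬right ch (here n d₁ none)
  ... | inj₁ (q , d₀) with ⊏-cmp q r
  ...   | inj₁ q⊏r = ¬link (d₁ , q , d₀ , q⊏r)
  ...   | inj₂ (inj₁ q≡r) = D₀≢D₁ d₀ d₁ q≡r
  ...   | inj₂ (inj₂ r⊏q) with ≺-cmp (D₀≢D₁ d₀ d₁)
  ...     | inj₁ q≺r = right-¬right ch (there n d₁ d₀ (inverted⇒right₁ D (accʳ _) d₁ d₀ r⊏q q≺r))
  ...     | inj₂ r≺q = ⊏-irrefl (⊏-trans r⊏q (proj₁ (right-other ch (copyˡ n d₁ d₀ r⊏q r≺q))))

  ⊏? : ∀ p q → Dec (p ⊏ q)
  ⊏? p q with ⊏-cmp p q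
  ... | inj₁ lt = yes lt
  ... | inj₂ (inj₁ refl) = no ⊏-irrefl
  ... | inj₂ (inj₂ gt) = no λ lt → ⊏-irrefl (⊏-trans lt gt)

  leftLink? : ∀ b → Dec (LeftLink b)
  leftLink? b with D₁? b | D₀? b
  ... | inj₂ none | _ = no λ { (d₁ , _) → none r d₁ }
  ... | inj₁ _ | inj₂ none = no λ { (_ , p , d₀ , _) → none p d₀ }
  ... | inj₁ (o , d₁) | inj₁ (p , d₀) with o ≟ r | ⊏? r p
  ...   | yes refl | yes lt = yes (d₁ , p , d₀ , lt)
  ...   | no ne | _ = no λ { (d₁' , _) → ne (D₁-unique d₁ d₁') }
  ...   | _ | no nlt = no λ { (_ , q , d₀' , lt) → nlt (subst (r ⊏_) (D₀-unique d₀' d₀) lt) }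

  rightLink? : ∀ d → Dec (RightLink d)
  rightLink? d with D₁? d | D₀? d
  ... | inj₂ none | _ = no λ { (d₁ , _) → none r d₁ }
  ... | inj₁ _ | inj₂ none = no λ { (_ , p , d₀ , _) → none p d₀ }
  ... | inj₁ (o , d₁) | inj₁ (p , d₀) with o ≟ r | ⊏? p r
  ...   | yes refl | yes lt = yes (d₁ , p , d₀ , lt)
  ...   | no ne | _ = no λ { (d₁' , _) → ne (D₁-unique d₁ d₁') }
  ...   | _ | no nlt = no λ { (_ , q , d₀' , lt) → nlt (subst (_⊏ r) (D₀-unique d₀' d₀) lt) }

-- Arcs on the cycle of values and the exchange of i with i + 1

-- k lies on the cyclic interval travelled when descending from p to q: this is CoInv p q k with the equalities
-- k = p and k = q allowed, which absorbs the non-attacking condition.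
Arc : ℕ → ℕ → ℕ → Set
Arc p k q = (q ≤ k × k ≤ p) ⊎ ((k ≤ p × p < q) ⊎ (p < q × q ≤ k))

arc-start : ∀ p q → Arc p p q
arc-start p q with ≤-<-connex q p
... | inj₁ le = inj₁ (le , ≤-refl)
... | inj₂ lt = inj₂ (inj₁ (≤-refl , lt))

arc-end : ∀ p q → Arc p q q
arc-end p q with ≤-<-connex q p
... | inj₁ le = inj₁ (≤-refl , le)
... | inj₂ lt = inj₂ (inj₂ (lt , ≤-refl))

arc-trivial : ∀ {p k} → Arc p k p → k ≡ p
arc-trivial (inj₁ (a , b)) = ≤-antisym b a
arc-trivial (inj₂ (inj₁ (_ , lt))) = ⊥-elim (<-irrefl refl lt)
arc-trivial (inj₂ (inj₂ (lt , _))) = ⊥-elim (<-irrefl refl lt)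

swap-letter : ℕ → ℕ → Letter → ℕ
swap-letter i x low = suc i
swap-letter i x high = i
swap-letter i x other = x

act : ℕ → Bool → ℕ → ℕ
act i true x = swap-letter i x (letter i x)
act i false x = x

Dot : ℕ → ℕ → Set
Dot i x = x ≡ i ⊎ x ≡ suc i

dot? : ∀ i x → Dot i x ⊎ ¬ Dot i x
dot? i x with letter i x | letter? i x
... | low | isLo e = inj₁ (inj₁ e)
... | high | isHi e = inj₁ (inj₂ e)
... | other | isOther ne ne' = inj₂ [ ne , ne' ]′

act-low : ∀ i → act i true i ≡ suc i
act-low i rewrite letter-low i = refl

act-high : ∀ i → act i true (suc i) ≡ i
act-high i rewrite letter-high i = refl

act-other : ∀ {i x} b → ¬ Dot i x → act i b x ≡ x
act-other false _ = refl
act-other true nd rewrite letter-other (nd ∘ inj₁) (nd ∘ inj₂) = refl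

act-dot : ∀ {i x} b → Dot i x → Dot i (act i b x)
act-dot false d = d
act-dot {i} true (inj₁ refl) = inj₂ (act-low i)
act-dot {i} true (inj₂ refl) = inj₁ (act-high i)

act-involutive : ∀ i b x → act i b (act i b x) ≡ x
act-involutive i false x = refl
act-involutive i true x with letter i x | letter? i x
... | low | isLo refl rewrite letter-high i = refl
... | high | isHi refl rewrite letter-low i = refl
... | other | isOther ne ne' rewrite letter-other ne ne' = refl

act-injective : ∀ i b {x y} → act i b x ≡ act i b y → x ≡ y
act-injective i b {x} {y} e = trans (sym (act-involutive i b x)) (trans (cong (act i b) e) (act-involutive i b y))

dots-other : ∀ {i x y z} → Dot i x → Dot i y → Dot i z → x ≢ y → z ≢ x → z ≡ y
dots-other (inj₁ refl) (inj₁ refl) _ ne _ = ⊥-elim (ne refl)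
dots-other (inj₂ refl) (inj₂ refl) _ ne _ = ⊥-elim (ne refl)
dots-other (inj₁ refl) (inj₂ refl) (inj₁ refl) _ ne = ⊥-elim (ne refl)
dots-other (inj₁ refl) (inj₂ refl) (inj₂ refl) _ ne = refl
dots-other (inj₂ refl) (inj₁ refl) (inj₁ refl) _ ne = refl
dots-other (inj₂ refl) (inj₁ refl) (inj₂ refl) _ ne = ⊥-elim (ne refl)

-- Values that agree outside `i` and `i + 1`. These two being adjacent, exchanging them changes no
-- comparison with a third value, so an arc with at most one of its three points among them is
-- unaffected.
data Twin (i x x' : ℕ) : Set where
  same : x ≡ x' → Twin i x x'
  dots : Dot i x → Dot i x' → Twin i x x'

twin-act : ∀ i b x → Twin i x (act i b x)
twin-act i b x with dot? i x
... | inj₁ d = dots d (act-dot b d)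
... | inj₂ nd = same (sym (act-other b nd))

above-dots : ∀ {i x y y'} → ¬ Dot i x → Dot i y → Dot i y' → y' ≤ x → y ≤ x
above-dots nx (inj₁ refl) (inj₁ refl) le = le
above-dots nx (inj₁ refl) (inj₂ refl) le = <⇒≤ le
above-dots nx (inj₂ refl) (inj₁ refl) le = ≤∧≢⇒< le λ e → nx (inj₁ (sym e))
above-dots nx (inj₂ refl) (inj₂ refl) le = le

below-dots : ∀ {i x y y'} → ¬ Dot i x → Dot i y → Dot i y' → x ≤ y' → x ≤ y
below-dots nx (inj₁ refl) (inj₁ refl) le = le
below-dots nx (inj₁ refl) (inj₂ refl) le = ≤∧≢⇒≤pred le (nx ∘ inj₂)
below-dots nx (inj₂ refl) (inj₁ refl) le = m≤n⇒m≤1+n le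
below-dots nx (inj₂ refl) (inj₂ refl) le = le

twin-≤ : ∀ {i x x' y y'} → ¬ (Dot i x × Dot i y) → Twin i x x' → Twin i y y' → x' ≤ y' → x ≤ y
twin-≤ nd (same refl) (same refl) le = le
twin-≤ nd (same refl) (dots d d') le = below-dots (λ dx → nd (dx , d)) d d' le
twin-≤ nd (dots d d') (same refl) le = above-dots (λ dy → nd (d , dy)) d d' le
twin-≤ nd (dots d _) (dots e _) le = ⊥-elim (nd (d , e))

twin-sym : ∀ {i x x'} → Twin i x x' → Twin i x' x
twin-sym (same e) = same (sym e)
twin-sym (dots d d') = dots d' d

twin-dot : ∀ {i x x'} → Twin i x x' → Dot i x' → Dot i x
twin-dot (same refl) d = d
twin-dot (dots d _) _ = d

twin-< : ∀ {i x x' y y'} → ¬ (Dot i x × Dot i y) → Twin i x x' → Twin i y y' → x' < y' → x < y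
twin-< nd tx ty lt = ≰⇒> λ le → <⇒≱ lt
  (twin-≤ (λ { (dy , dx) → nd (twin-dot tx dx , twin-dot ty dy) }) (twin-sym ty) (twin-sym tx) le)

twin-arc : ∀ {i p p' k k' q q'} → ¬ (Dot i p × Dot i k) → ¬ (Dot i p × Dot i q) → ¬ (Dot i q × Dot i k) →
  Twin i p p' → Twin i k k' → Twin i q q' → Arc p' k' q' → Arc p k q
twin-arc pk pq qk tp tk tq (inj₁ (a , b)) = inj₁ (twin-≤ qk tq tk a , twin-≤ (λ { (x , y) → pk (y , x) }) tk tp b)
twin-arc pk pq qk tp tk tq (inj₂ (inj₁ (a , b))) = inj₂ (inj₁ (twin-≤ (λ { (x , y) → pk (y , x) }) tk tp a , twin-< pq tp tq b))
twin-arc pk pq qk tp tk tq (inj₂ (inj₂ (a , b))) = inj₂ (inj₂ (twin-< pq tp tq a , twin-≤ qk tq tk b))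

-- Nothing lies between two adjacent values; only the jump from `i` to `i + 1` goes all the way
-- round the cycle and meets every other value.
arc-dots : ∀ {i p k q} → Dot i p → Dot i q → ¬ Dot i k → ¬ (p ≡ i × q ≡ suc i) → ¬ Arc p k q
arc-dots (inj₁ refl) (inj₂ refl) nk ne _ = ne (refl , refl)
arc-dots (inj₁ refl) (inj₁ refl) nk ne a = nk (inj₁ (arc-trivial a))
arc-dots (inj₂ refl) (inj₂ refl) nk ne a = nk (inj₂ (arc-trivial a))
arc-dots (inj₂ refl) (inj₁ refl) nk ne (inj₁ (a , b)) = nk (inj₁ (≤-antisym (≤∧≢⇒≤pred b (nk ∘ inj₂)) a))
arc-dots (inj₂ refl) (inj₁ refl) nk ne (inj₂ (inj₁ (_ , lt))) = <-asym lt ≤-refl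
arc-dots (inj₂ refl) (inj₁ refl) nk ne (inj₂ (inj₂ (lt , _))) = <-asym lt ≤-refl

-- The exchange matters only if at least two of the three values are `i` or `i + 1`. The hypotheses
-- are named after those that are: P and Q for the ends of the jump, V for the value `k`.
module ArcAct (i : ℕ) {b b' bk : Bool} {p k q : ℕ} (¬arc : ¬ Arc p k q)
  (PQ : Dot i p → Dot i q → ¬ Dot i k → ¬ (act i b p ≡ i × act i b' q ≡ suc i))
  (QV : ¬ Dot i p → Dot i q → Dot i k → b' ≡ false × bk ≡ false)
  (PV : ¬ Dot i q → Dot i p → Dot i k → b ≡ false × bk ≡ false)
  (PQV : Dot i p → Dot i q → Dot i k → act i b p ≡ act i b' q × act i bk k ≢ act i b p) where

  arc-act : ¬ Arc (act i b p) (act i bk k) (act i b' q)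
  arc-act a with dot? i p | dot? i q | dot? i k
  ... | inj₁ dp | inj₁ dq | inj₁ dk with PQV dp dq dk
  ...   | e , ne = ne (arc-trivial (subst (Arc (act i b p) (act i bk k)) (sym e) a))
  arc-act a | inj₁ dp | inj₁ dq | inj₂ nk =
    arc-dots (act-dot b dp) (act-dot b' dq) nk (PQ dp dq nk) (subst (λ z → Arc (act i b p) z (act i b' q)) (act-other bk nk) a)
  arc-act a | inj₂ np | inj₁ dq | inj₁ dk with QV np dq dk
  ... | refl , refl = ¬arc (subst (λ z → Arc z k q) (act-other b np) a)
  arc-act a | inj₁ dp | inj₂ nq | inj₁ dk with PV nq dp dk
  ... | refl , refl = ¬arc (subst (Arc p k) (act-other b' nq) a)
  arc-act a | inj₁ dp | inj₂ nq | inj₂ nk = ¬arc (twin-arc (nk ∘ proj₂) (nq ∘ proj₂) (nq ∘ proj₁) (twin-act i b p) (twin-act i bk k) (twin-act i b' q) a)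
  arc-act a | inj₂ np | dq | inj₂ nk = ¬arc (twin-arc (nk ∘ proj₂) (np ∘ proj₁) (nk ∘ proj₂) (twin-act i b p) (twin-act i bk k) (twin-act i b' q) a)
  arc-act a | inj₂ np | inj₂ nq | inj₁ dk = ¬arc (twin-arc (np ∘ proj₁) (np ∘ proj₁) (nq ∘ proj₁) (twin-act i b p) (twin-act i bk k) (twin-act i b' q) a)

-- Exchanging i and i + 1 in a zone of columns

record Rank (_≺_ : ℕ → ℕ → Set) : Set where
  field
    asym : ∀ {p q} → p ≺ q → ¬ q ≺ p
    cmp  : ∀ {p q} → p ≢ q → p ≺ q ⊎ q ≺ p

Distinct : (ℕ → ℕ → Maybe ℕ) → Set
Distinct E = ∀ r s c k → E r c ≡ just k → E s c ≡ just k → r ≡ s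

-- In each step the rows move from bottom to top; a row never jumps over (or onto) the current position of a
-- row of lower rank.
NoPassing : (ℕ → ℕ → Set) → (ℕ → ℕ → Maybe ℕ) → Set
NoPassing _≺_ E = ∀ r c s p q k → s ≺ r → E r c ≡ just p → E r (suc c) ≡ just q →
  (r < s → E s c ≡ just k → ¬ Arc p k q) × (s < r → E s (suc c) ≡ just k → ¬ Arc p k q)

-- On both borders the letters lie at or below `r` in the left column and at or above `r` in the
-- right one, so only row `r` can carry a letter across. The fields `entering` and `leaving` prevent
-- its staying on one value from turning into the jump from `i` to `i + 1`, which passes everything.
record FlipZone (i : ℕ) (_≺_ : ℕ → ℕ → Set) (E : ℕ → ℕ → Maybe ℕ) (F : ℕ → Bool) (r : ℕ) : Set where
  field
    ℓ        : ℕ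
    ℓ-dot    : Dot i ℓ
    ℓ-row    : ∀ c → F c ≡ true → E r c ≡ just ℓ
    others   : ∀ c p x → F c ≡ true → E p c ≡ just x → Dot i x → p ≢ r → p ≺ r
    before-≤ : ∀ c p x → F c ≡ false → F (suc c) ≡ true → E p c ≡ just x → Dot i x → p ≤ r
    first-≥  : ∀ c p x → F c ≡ false → F (suc c) ≡ true → E p (suc c) ≡ just x → Dot i x → r ≤ p
    entering : ∀ c → F c ≡ false → F (suc c) ≡ true → E r c ≡ just i → E r (suc c) ≢ just i
    after-≥  : ∀ c p x → F c ≡ true → F (suc c) ≡ false → E p (suc c) ≡ just x → Dot i x → r ≤ p
    last-≤   : ∀ c p x → F c ≡ true → F (suc c) ≡ false → E p c ≡ just x → Dot i x → p ≤ r
    leaving  : ∀ c → F c ≡ true → F (suc c) ≡ false → E r c ≡ just (suc i) → E r (suc c) ≢ just (suc i)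

act-≡low : ∀ {i x} → act i true x ≡ i → x ≡ suc i
act-≡low {i} e = act-injective i true (trans e (sym (act-high i)))

act-≡high : ∀ {i x} → act i true x ≡ suc i → x ≡ i
act-≡high {i} e = act-injective i true (trans e (sym (act-low i)))

module Flip {i : ℕ} {_≺_ : ℕ → ℕ → Set} (rank : Rank _≺_) {E : ℕ → ℕ → Maybe ℕ} (distinct : Distinct E)
  (noPassing : NoPassing _≺_ E) {F : ℕ → Bool} {r : ℕ} (zone : FlipZone i _≺_ E F r) where
  open Rank rank
  open FlipZone zone

  two-dots : ∀ {c p q x y} → F c ≡ true → E p c ≡ just x → E q c ≡ just y → Dot i x → Dot i y → p ≢ q → p ≢ r → q ≡ r
  two-dots {c} {p} {q} {x} {y} f ep eq dx dy p≢q p≢r with q ≟ r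
  ... | yes e = e
  ... | no ne = ⊥-elim (p≢q (distinct p q c x ep (subst (λ z → E q c ≡ just z) (sym x≡y) eq)))
    where
    other-row : ∀ {p x} → E p c ≡ just x → p ≢ r → ℓ ≢ x
    other-row ep p≢r refl = p≢r (distinct _ _ c _ ep (ℓ-row c f))
    x≡y : x ≡ y
    x≡y = dots-other ℓ-dot dy dx (other-row eq ne) (other-row ep p≢r ∘ sym)

  same-row : ∀ {c ρ p q} → F c ≡ true → F (suc c) ≡ true → E ρ c ≡ just p → E ρ (suc c) ≡ just q → Dot i p → Dot i q → p ≡ q
  same-row {c} {ρ} {p} {q} f f' ep eq dp dq with ρ ≟ r
  ... | yes refl = just-injective (trans (sym ep) (trans (ℓ-row c f) (trans (sym (ℓ-row (suc c) f')) eq)))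
  ... | no ne = dots-other ℓ-dot dq dp (λ { refl → ne (distinct ρ r (suc c) _ eq (ℓ-row (suc c) f')) })
      (λ { refl → ne (distinct ρ r c _ ep (ℓ-row c f)) })

  jump : ∀ {c ρ s p q k} → E ρ c ≡ just p → E ρ (suc c) ≡ just q → ¬ Arc p k q →
    (bk : Bool) → s ≺ ρ → (ρ < s × E s c ≡ just k × bk ≡ F c) ⊎ (s < ρ × E s (suc c) ≡ just k × bk ≡ F (suc c)) →
    ¬ Arc (act i (F c) p) (act i bk k) (act i (F (suc c)) q)
  jump {c} {ρ} {s} {p} {q} {k} ep eq ¬arc bk s≺ρ where-k with F c in f | F (suc c) in f'
  jump ep eq ¬arc bk s≺ρ (inj₁ (_ , _ , refl)) | false | false = ¬arc
  jump ep eq ¬arc bk s≺ρ (inj₂ (_ , _ , refl)) | false | false = ¬arc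
  -- Inside the zone row `r` keeps the letter `ℓ`. If exactly one end of the jump and `k` are among
  -- the two letters, then `k` stands in row `r`, which outranks the moving row, against `s≺ρ`.
  jump {c} {ρ} {s} {p} {q} {k} ep eq ¬arc bk s≺ρ where-k | true | true =
    ArcAct.arc-act i {true} {true} {bk} ¬arc
      (λ dp dq _ → λ { (e , e') → 1+n≢n (trans (sym e') (trans (cong (act i true) (sym (same-row f f' ep eq dp dq))) e)) })
      (λ np dq dk → ⊥-elim (case-Q np dq dk where-k))
      (λ nq dp dk → ⊥-elim (case-P nq dp dk where-k))
      (λ dp dq _ → cong (act i true) (same-row f f' ep eq dp dq) , λ e → k≢p (flagged e where-k))
    where
    k≢p : k ≢ p
    k≢p refl = ¬arc (arc-start p q)
    k≢q : k ≢ q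
    k≢q refl = ¬arc (arc-end p q)
    flagged : act i bk k ≡ act i true p →
      (ρ < s × E s c ≡ just k × bk ≡ true) ⊎ (s < ρ × E s (suc c) ≡ just k × bk ≡ true) → k ≡ p
    flagged e (inj₁ (_ , _ , refl)) = act-injective i true e
    flagged e (inj₂ (_ , _ , refl)) = act-injective i true e
    to-r : ∀ {d x} → F d ≡ true → E s d ≡ just k → Dot i k → Dot i x → k ≢ x → ℓ ≢ x → s ≡ r
    to-r {d} fd es dk dx k≢x ℓ≢x = distinct s r d k es (trans (ℓ-row d fd) (cong just (dots-other dx dk ℓ-dot (k≢x ∘ sym) ℓ≢x)))
    finish : s ≡ r → ρ ≺ r → ⊥
    finish refl ρ≺r = asym s≺ρ ρ≺r
    case-Q : ¬ Dot i p → Dot i q → Dot i k → _ → ⊥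
    case-Q np dq dk w = finish (s≡r w) (others (suc c) ρ q f' eq dq ρ≢r)
      where
      ρ≢r : ρ ≢ r
      ρ≢r refl = np (subst (Dot i) (just-injective (trans (sym (ℓ-row c f)) ep)) ℓ-dot)
      ℓ≢q : ℓ ≢ q
      ℓ≢q refl = ρ≢r (distinct ρ r (suc c) _ eq (ℓ-row (suc c) f'))
      s≡r : (ρ < s × E s c ≡ just k × bk ≡ true) ⊎ (s < ρ × E s (suc c) ≡ just k × bk ≡ true) → s ≡ r
      s≡r (inj₁ (_ , es , _)) = to-r f es dk dq k≢q ℓ≢q
      s≡r (inj₂ (_ , es , _)) = to-r f' es dk dq k≢q ℓ≢q
    case-P : ¬ Dot i q → Dot i p → Dot i k → _ → ⊥
    case-P nq dp dk w = finish (s≡r w) (others c ρ p f ep dp ρ≢r)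
      where
      ρ≢r : ρ ≢ r
      ρ≢r refl = nq (subst (Dot i) (just-injective (trans (sym (ℓ-row (suc c) f')) eq)) ℓ-dot)
      ℓ≢p : ℓ ≢ p
      ℓ≢p refl = ρ≢r (distinct ρ r c _ ep (ℓ-row c f))
      s≡r : (ρ < s × E s c ≡ just k × bk ≡ true) ⊎ (s < ρ × E s (suc c) ≡ just k × bk ≡ true) → s ≡ r
      s≡r (inj₁ (_ , es , _)) = to-r f es dk dp k≢p ℓ≢p
      s≡r (inj₂ (_ , es , _)) = to-r f' es dk dp k≢p ℓ≢p
  jump {c} {ρ} {s} {p} {q} {k} ep eq ¬arc bk s≺ρ where-k | false | true =
    ArcAct.arc-act i {false} {true} {bk} ¬arc
      (λ dp dq _ → λ { (e , e') → no-entry dp dq (act-≡high e') e })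
      (λ np dq dk → ⊥-elim (case-Q dq dk where-k))
      (λ nq dp dk → refl , case-P dp dk where-k)
      (λ dp dq dk → ⊥-elim (case-PQ dp dq dk where-k))
    where
    W : Set
    W = (ρ < s × E s c ≡ just k × bk ≡ false) ⊎ (s < ρ × E s (suc c) ≡ just k × bk ≡ true)
    row : Dot i p → Dot i q → ρ ≡ r
    row dp dq = ≤-antisym (before-≤ c ρ p f f' ep dp) (first-≥ c ρ q f f' eq dq)
    no-entry : Dot i p → Dot i q → q ≡ i → p ≢ i
    no-entry dp dq refl refl with row dp dq
    ... | refl = entering c f f' ep eq
    case-Q : Dot i q → Dot i k → W → ⊥
    case-Q dq dk (inj₁ (ρ<s , es , _)) = <-irrefl refl (≤-<-trans (first-≥ c ρ q f f' eq dq) (<-≤-trans ρ<s (before-≤ c s k f f' es dk)))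
    case-Q dq dk (inj₂ (s<ρ , es , _)) with ρ ≟ r
    ... | yes refl = <⇒≱ s<ρ (first-≥ c s k f f' es dk)
    ... | no ne with two-dots f' eq es dq dk (λ e → <-irrefl (sym e) s<ρ) ne
    ...   | refl = asym s≺ρ (others (suc c) ρ q f' eq dq ne)
    case-P : Dot i p → Dot i k → W → bk ≡ false
    case-P dp dk (inj₁ (_ , _ , e)) = e
    case-P dp dk (inj₂ (s<ρ , es , _)) = ⊥-elim (<-irrefl refl (<-≤-trans s<ρ (≤-trans (before-≤ c ρ p f f' ep dp) (first-≥ c s k f f' es dk))))
    case-PQ : Dot i p → Dot i q → Dot i k → W → ⊥
    case-PQ dp dq dk (inj₁ (ρ<s , es , _)) with row dp dq
    ... | refl = <⇒≱ ρ<s (before-≤ c s k f f' es dk)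
    case-PQ dp dq dk (inj₂ (s<ρ , es , _)) with row dp dq
    ... | refl = <⇒≱ s<ρ (first-≥ c s k f f' es dk)
  jump {c} {ρ} {s} {p} {q} {k} ep eq ¬arc bk s≺ρ where-k | true | false =
    ArcAct.arc-act i {true} {false} {bk} ¬arc
      (λ dp dq _ → λ { (e , e') → no-exit dp dq e' (act-≡low e) })
      (λ np dq dk → refl , case-Q dq dk where-k)
      (λ nq dp dk → ⊥-elim (case-P dp dk where-k))
      (λ dp dq dk → ⊥-elim (case-PQ dp dq dk where-k))
    where
    W : Set
    W = (ρ < s × E s c ≡ just k × bk ≡ true) ⊎ (s < ρ × E s (suc c) ≡ just k × bk ≡ false)
    row : Dot i p → Dot i q → ρ ≡ r
    row dp dq = ≤-antisym (last-≤ c ρ p f f' ep dp) (after-≥ c ρ q f f' eq dq)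
    no-exit : Dot i p → Dot i q → q ≡ suc i → p ≢ suc i
    no-exit dp dq refl refl with row dp dq
    ... | refl = leaving c f f' ep eq
    case-Q : Dot i q → Dot i k → W → bk ≡ false
    case-Q dq dk (inj₂ (_ , _ , e)) = e
    case-Q dq dk (inj₁ (ρ<s , es , _)) = ⊥-elim (<-irrefl refl (<-≤-trans ρ<s (≤-trans (last-≤ c s k f f' es dk) (after-≥ c ρ q f f' eq dq))))
    case-P : Dot i p → Dot i k → W → ⊥
    case-P dp dk (inj₂ (s<ρ , es , _)) = <-irrefl refl (≤-<-trans (after-≥ c s k f f' es dk) (<-≤-trans s<ρ (last-≤ c ρ p f f' ep dp)))
    case-P dp dk (inj₁ (ρ<s , es , _)) with ρ ≟ r
    ... | yes refl = <⇒≱ ρ<s (last-≤ c s k f f' es dk)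
    ... | no ne with two-dots f ep es dp dk (λ e → <-irrefl e ρ<s) ne
    ...   | refl = asym s≺ρ (others c ρ p f ep dp ne)
    case-PQ : Dot i p → Dot i q → Dot i k → W → ⊥
    case-PQ dp dq dk (inj₁ (ρ<s , es , _)) with row dp dq
    ... | refl = <⇒≱ ρ<s (last-≤ c s k f f' es dk)
    case-PQ dp dq dk (inj₂ (s<ρ , es , _)) with row dp dq
    ... | refl = <⇒≱ s<ρ (after-≥ c s k f f' es dk)

  module _ (E' : ℕ → ℕ → Maybe ℕ) (E'-flip : ∀ ρ c → E' ρ c ≡ M.map (act i (F c)) (E ρ c)) where

    unflip : ∀ {ρ c x} → E' ρ c ≡ just x → ∃ λ y → E ρ c ≡ just y × x ≡ act i (F c) y
    unflip {ρ} {c} e with E ρ c | E'-flip ρ c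
    ... | just y | e' = y , refl , just-injective (trans (sym e) e')
    ... | nothing | e' = case trans (sym e) e' of λ ()

    distinct' : Distinct E'
    distinct' ρ s c k e₁ e₂ with unflip e₁ | unflip e₂
    ... | y , ey , refl | z , ez , e with act-injective i (F c) e
    ...   | refl = distinct ρ s c y ey ez

    noPassing' : NoPassing _≺_ E'
    noPassing' ρ c s p q k s≺ρ ep eq with unflip ep | unflip eq
    ... | p₀ , ep₀ , refl | q₀ , eq₀ , refl = upper , lower'
      where
      upper : ρ < s → E' s c ≡ just k → ¬ Arc _ k _
      upper ρ<s ek with unflip ek
      ... | k₀ , ek₀ , refl = jump ep₀ eq₀ (proj₁ (noPassing ρ c s p₀ q₀ k₀ s≺ρ ep₀ eq₀) ρ<s ek₀) (F c) s≺ρ (inj₁ (ρ<s , ek₀ , refl))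
      lower' : s < ρ → E' s (suc c) ≡ just k → ¬ Arc _ k _
      lower' s<ρ ek with unflip ek
      ... | k₀ , ek₀ , refl = jump ep₀ eq₀ (proj₂ (noPassing ρ c s p₀ q₀ k₀ s≺ρ ep₀ eq₀) s<ρ ek₀) (F (suc c)) s≺ρ (inj₂ (s<ρ , ek₀ , refl))

-- Exchanging consecutive rows

arc? : ∀ p k q → Dec (Arc p k q)
arc? p k q with q ≤? p
arc? p k q | yes q≤p with q ≤? k | k ≤? p
... | yes a | yes b = yes (inj₁ (a , b))
... | no na | _ = no λ { (inj₁ (a , _)) → na a ; (inj₂ (inj₁ (_ , lt))) → <⇒≱ lt q≤p ; (inj₂ (inj₂ (lt , _))) → <⇒≱ lt q≤p }
... | _ | no nb = no λ { (inj₁ (_ , b)) → nb b ; (inj₂ (inj₁ (_ , lt))) → <⇒≱ lt q≤p ; (inj₂ (inj₂ (lt , _))) → <⇒≱ lt q≤p }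
arc? p k q | no q≰p with k ≤? p | q ≤? k
... | yes a | _ = yes (inj₂ (inj₁ (a , ≰⇒> q≰p)))
... | no _ | yes b = yes (inj₂ (inj₂ (≰⇒> q≰p , b)))
... | no na | no nb = no λ { (inj₁ (_ , b)) → na b ; (inj₂ (inj₁ (a , _))) → na a ; (inj₂ (inj₂ (_ , b))) → nb b }

arc-total : ∀ p k q → Arc p k q ⊎ Arc p q k
arc-total p k q with ≤-<-connex k p | ≤-<-connex q p | ≤-total k q
... | inj₁ k≤p | inj₁ q≤p | inj₁ k≤q = inj₂ (inj₁ (k≤q , q≤p))
... | inj₁ k≤p | inj₁ q≤p | inj₂ q≤k = inj₁ (inj₁ (q≤k , k≤p))
... | inj₁ k≤p | inj₂ p<q | _ = inj₁ (inj₂ (inj₁ (k≤p , p<q)))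
... | inj₂ p<k | inj₁ q≤p | _ = inj₂ (inj₂ (inj₁ (q≤p , p<k)))
... | inj₂ p<k | inj₂ p<q | inj₁ k≤q = inj₂ (inj₂ (inj₂ (p<k , k≤q)))
... | inj₂ p<k | inj₂ p<q | inj₂ q≤k = inj₁ (inj₂ (inj₂ (p<q , q≤k)))

arc-antisym : ∀ {p k q} → Arc p k q → Arc p q k → k ≡ q
arc-antisym (inj₁ (a , b)) (inj₁ (c , d)) = ≤-antisym c a
arc-antisym (inj₁ (a , b)) (inj₂ (inj₁ (c , d))) = ⊥-elim (<⇒≱ d b)
arc-antisym (inj₁ (a , b)) (inj₂ (inj₂ (c , d))) = ⊥-elim (<⇒≱ c b)
arc-antisym (inj₂ (inj₁ (a , b))) (inj₁ (c , d)) = ⊥-elim (<⇒≱ b d)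
arc-antisym (inj₂ (inj₁ (a , b))) (inj₂ (inj₁ (c , d))) = ⊥-elim (<⇒≱ d a)
arc-antisym (inj₂ (inj₁ (a , b))) (inj₂ (inj₂ (c , d))) = ⊥-elim (<⇒≱ c a)
arc-antisym (inj₂ (inj₂ (a , b))) (inj₁ (c , d)) = ⊥-elim (<⇒≱ a d)
arc-antisym (inj₂ (inj₂ (a , b))) (inj₂ (inj₁ (c , d))) = ⊥-elim (<⇒≱ a c)
arc-antisym (inj₂ (inj₂ (a , b))) (inj₂ (inj₂ (c , d))) = ≤-antisym d b

arc-trans : ∀ {p k m q} → Arc p k m → Arc p m q → Arc p k q
arc-trans (inj₁ (a , b)) (inj₁ (c , d)) = inj₁ (≤-trans c a , b)
arc-trans (inj₁ (a , b)) (inj₂ (inj₁ (c , d))) = inj₂ (inj₁ (b , d))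
arc-trans (inj₁ (a , b)) (inj₂ (inj₂ (c , d))) = inj₂ (inj₁ (b , c))
arc-trans (inj₂ (inj₁ (a , b))) (inj₁ (c , d)) = ⊥-elim (<⇒≱ b d)
arc-trans (inj₂ (inj₁ (a , b))) (inj₂ (inj₁ (c , d))) = inj₂ (inj₁ (a , d))
arc-trans (inj₂ (inj₁ (a , b))) (inj₂ (inj₂ (c , d))) = inj₂ (inj₁ (a , c))
arc-trans (inj₂ (inj₂ (a , b))) (inj₁ (c , d)) = ⊥-elim (<⇒≱ a d)
arc-trans (inj₂ (inj₂ (a , b))) (inj₂ (inj₁ (c , d))) = ⊥-elim (<⇒≱ a c)
arc-trans (inj₂ (inj₂ (a , b))) (inj₂ (inj₂ (c , d))) = inj₂ (inj₂ (c , ≤-trans d b))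

arc-rotate : ∀ {p k q} → p ≢ k → Arc p k q → Arc k q p
arc-rotate ne (inj₁ (a , b)) = inj₂ (inj₁ (a , ≤∧≢⇒< b (ne ∘ sym)))
arc-rotate ne (inj₂ (inj₁ (a , b))) = inj₂ (inj₂ (≤∧≢⇒< a (ne ∘ sym) , <⇒≤ b))
arc-rotate ne (inj₂ (inj₂ (a , b))) = inj₁ (<⇒≤ a , b)

arc-flip : ∀ {p k q} → ¬ Arc p k q → Arc p q k
arc-flip {p} {k} {q} n with arc-total p k q
... | inj₁ a = ⊥-elim (n a)
... | inj₂ a = a

arc-tail : ∀ {p m k q} → Arc p m q → Arc m k q → Arc p k q
arc-tail (inj₁ (a , b)) (inj₁ (c , d)) = inj₁ (c , ≤-trans d b)
arc-tail (inj₁ (a , b)) (inj₂ (inj₁ (c , d))) = ⊥-elim (<⇒≱ d a)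
arc-tail (inj₁ (a , b)) (inj₂ (inj₂ (c , d))) = ⊥-elim (<⇒≱ c a)
arc-tail (inj₂ (inj₁ (a , b))) (inj₁ (c , d)) = ⊥-elim (<⇒≱ b (≤-trans c (≤-trans d a)))
arc-tail (inj₂ (inj₁ (a , b))) (inj₂ (inj₁ (c , d))) = inj₂ (inj₁ (≤-trans c a , b))
arc-tail (inj₂ (inj₁ (a , b))) (inj₂ (inj₂ (c , d))) = inj₂ (inj₂ (b , d))
arc-tail (inj₂ (inj₂ (a , b))) (inj₁ (c , d)) = inj₂ (inj₂ (a , c))
arc-tail (inj₂ (inj₂ (a , b))) (inj₂ (inj₁ (c , d))) = ⊥-elim (<⇒≱ d b)
arc-tail (inj₂ (inj₂ (a , b))) (inj₂ (inj₂ (c , d))) = ⊥-elim (<⇒≱ c b)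

arc-split : ∀ {p k q} m → Arc p k q → Arc p k m ⊎ Arc m k q
arc-split {p} {k} {q} m (inj₁ (a , b)) with ≤-<-connex m k
... | inj₁ m≤k = inj₁ (inj₁ (m≤k , b))
... | inj₂ k<m = inj₂ (inj₁ (a , <⇒≤ k<m))
arc-split {p} {k} {q} m (inj₂ (inj₁ (a , b))) with ≤-<-connex m k | ≤-<-connex q m
... | inj₁ m≤k | _ = inj₁ (inj₁ (m≤k , a))
... | inj₂ k<m | inj₁ q≤m = inj₁ (inj₂ (inj₁ (a , <-≤-trans b q≤m)))
... | inj₂ k<m | inj₂ m<q = inj₂ (inj₂ (inj₁ (<⇒≤ k<m , m<q)))
arc-split {p} {k} {q} m (inj₂ (inj₂ (a , b))) with ≤-<-connex q m | ≤-<-connex m k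
... | inj₂ m<q | _ = inj₂ (inj₂ (inj₂ (m<q , b)))
... | inj₁ q≤m | inj₁ m≤k = inj₁ (inj₂ (inj₂ (<-≤-trans a q≤m , m≤k)))
... | inj₁ q≤m | inj₂ k<m = inj₂ (inj₁ (b , <⇒≤ k<m))

arc-complement : ∀ {p k q} → ¬ Arc p k q → Arc k p q
arc-complement {p} {k} {q} n with p ≟ q
... | yes refl = arc-end k p
... | no p≢q = arc-rotate (λ { refl → n (arc-end p q) }) (arc-rotate p≢q (arc-flip n))

-- Descending from `p` one meets `q` before `k`, and descending from `k` one meets `m` before `p`.
-- So the cyclic order is `p`, `q`, `k`, `m`, and `m` is off the first jump.
arc-outside : ∀ {p k m q} → ¬ Arc p k q → ¬ Arc k p m → ¬ Arc p m q
arc-outside {p} {k} {m} {q} n n' a with arc-antisym a (arc-trans q<k k<m)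
  where
  k≢p : k ≢ p
  k≢p refl = n' (arc-start k m)
  q<k : Arc p q k
  q<k = arc-rotate k≢p (arc-complement n)
  k≢m : k ≢ m
  k≢m refl = n a
  k<m : Arc p k m
  k<m = arc-rotate (λ { refl → n' (arc-end k p) }) (arc-rotate k≢m (arc-flip n'))
... | refl = n' (arc-complement n)

-- `NoPassing` with an arbitrary order of moves `B`, so that this order can be sorted, and with
-- entries given by a total function that is meaningful only up to `len`.
record Valid* (R : ℕ → Set) (len : ℕ → ℕ) (_≺_ B : ℕ → ℕ → Set) (e : ℕ → ℕ → ℕ) : Set where
  field
    dist : ∀ {p q c} → R p → R q → c ≤ len p → c ≤ len q → e p c ≡ e q c → p ≡ q
    pass : ∀ {p q c} → R p → R q → p ≺ q → suc c ≤ len q →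
      (B q p → c ≤ len p → ¬ Arc (e q c) (e p c) (e q (suc c))) ×
      (B p q → suc c ≤ len p → ¬ Arc (e q c) (e p (suc c)) (e q (suc c)))

record Exchange (R : ℕ → Set) (B B' : ℕ → ℕ → Set) (r s : ℕ) : Set where
  field
    r∈ : R r
    s∈ : R s
    r-s   : B r s
    ¬r-s  : ¬ B' r s
    conv  : ∀ {p q} → R p → R q → B' p q → B p q ⊎ (p ≡ s × q ≡ r)
    r-s-> : ∀ {t} → R t → t ≢ r → t ≢ s → B r t → B s t
    s-r-> : ∀ {t} → R t → t ≢ r → t ≢ s → B s t → B r t
    >-r-s : ∀ {t} → R t → t ≢ r → t ≢ s → B t r → B t s
    >-s-r : ∀ {t} → R t → t ≢ r → t ≢ s → B t s → B t r
    order : ∀ {t} → R t → t ≢ r → B t r ⊎ B r t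

-- Let the rows r and s move consecutively, r first, where r outranks s. Exchanging their moves gives another
-- process on the same columns: r now moves after s, to the first of their two new positions.  The rows r and s
-- trade places exactly in the columns where σ holds.
module ExchangeRows {R : ℕ → Set} {len : ℕ → ℕ} {_≺_ B B' : ℕ → ℕ → Set} (rank : Rank _≺_)
  (≺-trans : ∀ {p q r} → p ≺ q → q ≺ r → p ≺ r) (≺-len : ∀ {p q} → p ≺ q → len p ≤ len q)
  {r s : ℕ} (s≺r : s ≺ r) (s<r : len s < len r) (ex : Exchange R B B' r s)
  (short : ∀ {t} → R t → t ≺ s → B s t → len t < len s)
  {e : ℕ → ℕ → ℕ} (valid : Valid* R len _≺_ B e) where
  open Rank rank
  open Exchange ex
  open Valid* valid

  r≢s : r ≢ s
  r≢s refl = asym s≺r s≺r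

  long : Bool → ℕ → ℕ
  long true c = e s c
  long false c = e r c

  -- The new row `r` starts at `long (σ c) c`, which depends on the trades so far; hence the
  -- recursion. It takes the new place of `s` if it meets that place before its own. Past the end of
  -- row `s` nothing is traded.
  σ : ℕ → Bool
  σ-next : Bool → ℕ → Bool
  σ-next b c with suc c ≤? len s | arc? (long b c) (e s (suc c)) (e r (suc c))
  ... | yes _ | yes _ = true
  ... | _ | _ = false
  σ zero = false
  σ (suc c) = σ-next (σ c) c

  data Next? (b : Bool) (c : ℕ) : Bool → Set where
    traded : suc c ≤ len s → Arc (long b c) (e s (suc c)) (e r (suc c)) → Next? b c true
    kept   : suc c ≤ len s → ¬ Arc (long b c) (e s (suc c)) (e r (suc c)) → Next? b c false
    gone   : len s ≤ c → Next? b c false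

  next? : ∀ c → Next? (σ c) c (σ (suc c))
  next? c with suc c ≤? len s | arc? (long (σ c) c) (e s (suc c)) (e r (suc c))
  ... | yes le | yes a = traded le a
  ... | yes le | no na = kept le na
  ... | no gt | _ = gone (≮⇒≥ gt)

  σ-len : ∀ c → σ c ≡ true → c ≤ len s
  σ-len (suc c) eq with σ (suc c) | next? c
  ... | true | traded le _ = le

  trade : ℕ → ℕ
  trade p with p ≟ r | p ≟ s
  ... | yes _ | _ = s
  ... | no _ | yes _ = r
  ... | no _ | no _ = p

  trade-r : trade r ≡ s
  trade-r with r ≟ r
  ... | yes _ = refl
  ... | no ne = ⊥-elim (ne refl)

  trade-s : trade s ≡ r
  trade-s with s ≟ r | s ≟ s
  ... | yes e | _ = ⊥-elim (r≢s (sym e))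
  ... | no _ | yes _ = refl
  ... | no _ | no ne = ⊥-elim (ne refl)

  trade-other : ∀ {p} → p ≢ r → p ≢ s → trade p ≡ p
  trade-other {p} nr ns with p ≟ r | p ≟ s
  ... | yes e | _ = ⊥-elim (nr e)
  ... | no _ | yes e = ⊥-elim (ns e)
  ... | no _ | no _ = refl

  data Row : ℕ → Set where
    isR : Row r
    isS : Row s
    isT : ∀ {t} → t ≢ r → t ≢ s → Row t

  row? : ∀ p → Row p
  row? p with p ≟ r | p ≟ s
  ... | yes refl | _ = isR
  ... | no _ | yes refl = isS
  ... | no nr | no ns = isT nr ns

  owner : Bool → ℕ → ℕ
  owner true p = trade p
  owner false p = p

  owner-involutive : ∀ b p → owner b (owner b p) ≡ p
  owner-involutive false p = refl
  owner-involutive true p with row? p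
  ... | isR = trans (cong trade trade-r) trade-s
  ... | isS = trans (cong trade trade-s) trade-r
  ... | isT nr ns = trans (cong trade (trade-other nr ns)) (trade-other nr ns)

  owner-∈ : ∀ b {p} → R p → R (owner b p)
  owner-∈ false p∈ = p∈
  owner-∈ true {p} p∈ with row? p
  ... | isR = subst R (sym trade-r) s∈
  ... | isS = subst R (sym trade-s) r∈
  ... | isT nr ns = subst R (sym (trade-other nr ns)) p∈

  owner-len : ∀ {c} b {p} → (b ≡ true → c ≤ len s) → c ≤ len p → c ≤ len (owner b p)
  owner-len false _ le = le
  owner-len {c} true {p} h le with row? p
  ... | isR = subst (λ z → c ≤ len z) (sym trade-r) (h refl)
  ... | isS = subst (λ z → c ≤ len z) (sym trade-s) (≤-trans (h refl) (<⇒≤ s<r))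
  ... | isT nr ns = subst (λ z → c ≤ len z) (sym (trade-other nr ns)) le

  e' : ℕ → ℕ → ℕ
  e' p c = e (owner (σ c) p) c

  owner-r : ∀ b c → e (owner b r) c ≡ long b c
  owner-r true c rewrite trade-r = refl
  owner-r false c = refl

  shortly : Bool → ℕ → ℕ
  shortly true c = e r c
  shortly false c = e s c

  owner-s : ∀ b c → e (owner b s) c ≡ shortly b c
  owner-s true c rewrite trade-s = refl
  owner-s false c = refl

  owner-t : ∀ b {t} c → t ≢ r → t ≢ s → e (owner b t) c ≡ e t c
  owner-t true c nr ns rewrite trade-other nr ns = refl
  owner-t false c nr ns = refl

  s-not-passed : ∀ {c} → c ≤ len s → ¬ Arc (e r c) (e s c) (e r (suc c))
  s-not-passed le = proj₁ (pass s∈ r∈ s≺r (≤-trans (s≤s le) s<r)) r-s le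

  -- If the new row `r` starts where `s` stood, its jump is prolonged at most by the stretch from
  -- there to the old position of `r`; that stretch has to be checked separately.
  no-entry : ∀ {k c b} → ¬ Arc (e r c) k (e r (suc c)) → (b ≡ true → ¬ Arc (e s c) k (e r c)) → ¬ Arc (long b c) k (e r (suc c))
  no-entry {b = false} n h a = n a
  no-entry {c = c} {b = true} n h a with arc-split (e r c) a
  ... | inj₁ a' = h refl a'
  ... | inj₂ a' = n a'

  -- A row ranked between the two is the delicate case: `r` must respect it and `s` need not, yet
  -- the new row `r` may start where `s` stood. The invariant keeps such a row off the stretch from
  -- `s` to `r` in every traded column.
  module Between {t : ℕ} (t∈ : R t) (s≺t : s ≺ t) (t≺r : t ≺ r) where
    t≢r : t ≢ r
    t≢r refl = asym t≺r t≺r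
    t≢s : t ≢ s
    t≢s refl = asym s≺t s≺t
    len-t : ∀ {c} → c ≤ len s → c ≤ len t
    len-t le = ≤-trans le (≺-len s≺t)

    mutual
      invariant : ∀ c → σ c ≡ true → ¬ Arc (e s c) (e t c) (e r c)
      invariant (suc c) eq with σ (suc c) | next? c
      ... | true | traded le a with order t∈ t≢r
      ...   | inj₁ t-r = λ a' → after-move t-r le (arc-tail a a')
      ...   | inj₂ r-t = arc-outside (λ a' → before-move r-t (<⇒≤ le) (arc-tail a a'))
                (proj₂ (pass s∈ t∈ s≺t (len-t le)) (r-s-> t∈ t≢r t≢s r-t) le)

      before-move : ∀ {c} → B r t → c ≤ len s → ¬ Arc (long (σ c) c) (e t c) (e r (suc c))
      before-move {c} r-t le = no-entry {b = σ c} (proj₁ (pass t∈ r∈ t≺r (≤-trans (s≤s le) s<r)) r-t (len-t le)) (invariant c)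

      after-move : ∀ {c} → B t r → suc c ≤ len s → ¬ Arc (long (σ c) c) (e t (suc c)) (e r (suc c))
      after-move {c} t-r le = no-entry {b = σ c} (proj₂ (pass t∈ r∈ t≺r (≤-trans le (<⇒≤ s<r))) t-r (len-t le))
        λ eq → arc-outside (invariant c eq) (proj₁ (pass s∈ t∈ s≺t (len-t le)) (>-r-s t∈ t≢r t≢s t-r) (<⇒≤ le))

    entered : ∀ {c} → σ c ≡ true → c ≤ len s → B t r → suc c ≤ len t → ¬ Arc (e s c) (e t (suc c)) (e r c)
    entered {c} eq le t-r le' = arc-outside (invariant c eq) (proj₁ (pass s∈ t∈ s≺t le') (>-r-s t∈ t≢r t≢s t-r) le)

  -- The new target of `r` lies on the way to either old target, so the new jump is contained in a
  -- jump towards each of them.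
  long-first : ∀ c → suc c ≤ len r → Arc (long (σ c) c) (long (σ (suc c)) (suc c)) (e r (suc c))
  long-first c le with σ (suc c) | next? c
  ... | true | traded _ a = a
  ... | false | _ = arc-end _ _

  long-first' : ∀ c → suc c ≤ len s → Arc (long (σ c) c) (long (σ (suc c)) (suc c)) (e s (suc c))
  long-first' c le with σ (suc c) | next? c
  ... | true | traded _ a = arc-end _ _
  ... | false | kept _ na = arc-flip na
  ... | false | gone ge = ⊥-elim (<⇒≱ le ge)

  long-short : ∀ {c} → suc c ≤ len s → ¬ Arc (long (σ c) c) (shortly (σ (suc c)) (suc c)) (long (σ (suc c)) (suc c))
  long-short {c} le a with σ (suc c) | next? c
  ... | true | traded _ a' = r≢s (dist r∈ s∈ (≤-trans le (<⇒≤ s<r)) le (arc-antisym a a'))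
  ... | false | kept _ na = na a
  ... | false | gone ge = <⇒≱ le ge

  -- k is the position of a row ranked below s.
  long-low : ∀ {c k} → suc c ≤ len s → ¬ Arc (e r c) k (e r (suc c)) → ¬ Arc (e s c) k (e s (suc c)) →
    ¬ Arc (long (σ c) c) k (long (σ (suc c)) (suc c))
  long-low {c} le n n' a with σ c | long-first c (≤-trans le (<⇒≤ s<r)) | long-first' c le
  ... | false | f | _ = n (arc-trans a f)
  ... | true | _ | f = n' (arc-trans a f)

  short-low : ∀ {c k} → suc c ≤ len s → ¬ Arc (e r c) k (e r (suc c)) → ¬ Arc (e s c) k (e s (suc c)) →
    ¬ Arc (shortly (σ c) c) k (shortly (σ (suc c)) (suc c))
  short-low {c} {k} le n n' a with σ c | σ (suc c) | next? c
  ... | false | false | _ = n' a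
  ... | true | true | _ = n a
  -- The jump of `s` is prolonged from its old target to that of `r`, and the added piece is the end
  -- of the old jump of `r`.
  ... | false | true | traded _ f with arc-split (e s (suc c)) a
  ...   | inj₁ a' = n' a'
  ...   | inj₂ a' = n (arc-tail f a')
  short-low {c} {k} le n n' a | true | false | gone ge = <⇒≱ le ge
  -- The new row `s` starts at the old position of `r`. Since `r` does not jump over `s`, while the
  -- old jump of `s` reaches beyond the new place of `r`, this start lies on the old jump of `s`.
  short-low {c} {k} le n n' a | true | false | kept _ na =
    n' (arc-tail (arc-trans (arc-complement (s-not-passed (<⇒≤ le))) (arc-flip na)) a)

  unpassed : ∀ {c k k'} b → ¬ Arc k (e r c) k' → ¬ Arc k (e s c) k' → ¬ Arc k (shortly b c) k'
  unpassed true n n' = n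
  unpassed false n n' = n'

  -- If `k` is not between `s` and `r`, a jump from `k` that passes the position of `r` has passed
  -- that of `s` before.
  hidden : ∀ {c k k'} b → (b ≡ true → ¬ Arc (e s c) k (e r c)) → ¬ Arc k (e s c) k' → ¬ Arc k (shortly b c) k'
  hidden false h n = n
  hidden true h n a = n (arc-trans (arc-complement (h refl)) a)

  pass-rt : ∀ {t c} → R t → t ≢ s → t ≺ r → suc c ≤ len r →
    (B' r t → c ≤ len t → ¬ Arc (long (σ c) c) (e t c) (long (σ (suc c)) (suc c))) ×
    (B' t r → suc c ≤ len t → ¬ Arc (long (σ c) c) (e t (suc c)) (long (σ (suc c)) (suc c)))
  pass-rt {t} {c} t∈ t≢s t≺r le = late , early
    where
    t≢r : t ≢ r
    t≢r refl = asym t≺r t≺r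
    B-rt : B' r t → B r t
    B-rt b = [ id , (λ { (e , _) → ⊥-elim (r≢s e) }) ]′ (conv r∈ t∈ b)
    B-tr : B' t r → B t r
    B-tr b = [ id , (λ { (e , _) → ⊥-elim (t≢s e) }) ]′ (conv t∈ r∈ b)
    late : B' r t → c ≤ len t → ¬ Arc (long (σ c) c) (e t c) (long (σ (suc c)) (suc c))
    late b le' = cases (cmp t≢s) (c ≤? len s) (suc c ≤? len s)
      where
      off : ¬ (c ≤ len s) → σ c ≡ false
      off c> with σ c in eq
      ... | false = refl
      ... | true = ⊥-elim (c> (σ-len c eq))
      cases : t ≺ s ⊎ s ≺ t → Dec (c ≤ len s) → Dec (suc c ≤ len s) → ¬ Arc (long (σ c) c) (e t c) (long (σ (suc c)) (suc c))
      cases (inj₂ s≺t) (yes c≤) _ = λ a → Between.before-move t∈ s≺t t≺r (B-rt b) c≤ (arc-trans a (long-first c le))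
      cases (inj₁ t≺s) _ (yes c<) = long-low c< (proj₁ (pass t∈ r∈ t≺r le) (B-rt b) le')
            (proj₁ (pass t∈ s∈ t≺s c<) (r-s-> t∈ t≢r t≢s (B-rt b)) le')
      -- A row ranked below `s` and moving after it is shorter than `s`, so it has no cell in the
      -- last column of `s` or later.
      cases (inj₁ t≺s) _ (no c≥) = ⊥-elim (c≥ (≤-<-trans le' (short t∈ t≺s (r-s-> t∈ t≢r t≢s (B-rt b)))))
      cases (inj₂ s≺t) (no c>) _ = λ a → subst (λ z → ¬ Arc z (e t c) (e r (suc c))) (cong (λ z → long z c) (sym (off c>)))
            (proj₁ (pass t∈ r∈ t≺r le) (B-rt b) le') (arc-trans a (long-first c le))
    early : B' t r → suc c ≤ len t → ¬ Arc (long (σ c) c) (e t (suc c)) (long (σ (suc c)) (suc c))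
    early b le' with cmp t≢s
    ... | inj₂ s≺t = λ a → no-entry {b = σ c} (proj₂ (pass t∈ r∈ t≺r le) (B-tr b) le')
            (λ eq → Between.entered t∈ s≺t t≺r eq (σ-len c eq) (B-tr b) le') (arc-trans a (long-first c le))
    ... | inj₁ t≺s = long-low c< (proj₂ (pass t∈ r∈ t≺r le) (B-tr b) le')
            (proj₂ (pass t∈ s∈ t≺s c<) (>-r-s t∈ t≢r t≢s (B-tr b)) le')
      where
      c< : suc c ≤ len s
      c< = ≤-trans le' (≺-len t≺s)

  pass' : ∀ {p q c} → R p → R q → p ≺ q → suc c ≤ len q →
      (B' q p → c ≤ len p → ¬ Arc (e' q c) (e' p c) (e' q (suc c))) ×
      (B' p q → suc c ≤ len p → ¬ Arc (e' q c) (e' p (suc c)) (e' q (suc c)))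
  pass' {p} {q} {c} p∈ q∈ p≺q le with row? p | row? q
  ... | isR | isR = ⊥-elim (asym p≺q p≺q)
  ... | isS | isS = ⊥-elim (asym p≺q p≺q)
  ... | isR | isS = ⊥-elim (asym p≺q s≺r)
  ... | isS | isR rewrite owner-r (σ c) c | owner-r (σ (suc c)) (suc c) | owner-s (σ (suc c)) (suc c) =
    (λ b → ⊥-elim (¬r-s b)) , λ _ le' → long-short le'
  ... | isT nr ns | isR rewrite owner-r (σ c) c | owner-r (σ (suc c)) (suc c) | owner-t (σ c) c nr ns | owner-t (σ (suc c)) (suc c) nr ns =
    pass-rt p∈ ns p≺q le
  ... | isT nr ns | isS rewrite owner-s (σ c) c | owner-s (σ (suc c)) (suc c) | owner-t (σ c) c nr ns | owner-t (σ (suc c)) (suc c) nr ns =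
    late , early
    where
    p≺r : p ≺ r
    p≺r = ≺-trans p≺q s≺r
    le-r : suc c ≤ len r
    le-r = ≤-trans le (<⇒≤ s<r)
    late : B' s p → c ≤ len p → ¬ Arc (shortly (σ c) c) (e p c) (shortly (σ (suc c)) (suc c))
    late b le' = short-low le (proj₁ (pass p∈ r∈ p≺r le-r) (s-r-> p∈ nr ns b') le') (proj₁ (pass p∈ s∈ p≺q le) b' le')
      where
      b' : B s p
      b' = [ id , (λ { (_ , e) → ⊥-elim (nr e) }) ]′ (conv s∈ p∈ b)
    early : B' p s → suc c ≤ len p → ¬ Arc (shortly (σ c) c) (e p (suc c)) (shortly (σ (suc c)) (suc c))
    early b le' = short-low le (proj₂ (pass p∈ r∈ p≺r le-r) (>-s-r p∈ nr ns b') le') (proj₂ (pass p∈ s∈ p≺q le) b' le')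
      where
      b' : B p s
      b' = [ id , (λ { (e , _) → ⊥-elim (ns e) }) ]′ (conv p∈ s∈ b)
  ... | isR | isT nr ns rewrite owner-r (σ c) c | owner-r (σ (suc c)) (suc c) | owner-t (σ c) c nr ns | owner-t (σ (suc c)) (suc c) nr ns =
    late , early
    where
    s≺q : s ≺ q
    s≺q = ≺-trans s≺r p≺q
    late : B' q r → c ≤ len r → ¬ Arc (e q c) (long (σ c) c) (e q (suc c))
    late b le' with σ c in eq
    ... | false = proj₁ (pass r∈ q∈ p≺q le) ([ id , (λ { (e , _) → ⊥-elim (ns e) }) ]′ (conv q∈ r∈ b)) le'
    ... | true = proj₁ (pass s∈ q∈ s≺q le) (>-r-s q∈ nr ns ([ id , (λ { (e , _) → ⊥-elim (ns e) }) ]′ (conv q∈ r∈ b))) (σ-len c eq)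
    early : B' r q → suc c ≤ len r → ¬ Arc (e q c) (long (σ (suc c)) (suc c)) (e q (suc c))
    early b le' with σ (suc c) in eq
    ... | false = proj₂ (pass r∈ q∈ p≺q le) ([ id , (λ { (e , _) → ⊥-elim (r≢s e) }) ]′ (conv r∈ q∈ b)) le'
    ... | true = proj₂ (pass s∈ q∈ s≺q le) (r-s-> q∈ nr ns ([ id , (λ { (e , _) → ⊥-elim (r≢s e) }) ]′ (conv r∈ q∈ b))) (σ-len (suc c) eq)
  ... | isS | isT nr ns rewrite owner-s (σ c) c | owner-s (σ (suc c)) (suc c) | owner-t (σ c) c nr ns | owner-t (σ (suc c)) (suc c) nr ns =
    late , early
    where
    b-qs : B' q s → B q s
    b-qs b = [ id , (λ { (e , _) → ⊥-elim (ns e) }) ]′ (conv q∈ s∈ b)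
    b-sq : B' s q → B s q
    b-sq b = [ id , (λ { (_ , e) → ⊥-elim (nr e) }) ]′ (conv s∈ q∈ b)
    late : B' q s → c ≤ len s → ¬ Arc (e q c) (shortly (σ c) c) (e q (suc c))
    late b le' with cmp nr
    ... | inj₁ q≺r = hidden (σ c) (Between.invariant q∈ p≺q q≺r c) (proj₁ (pass s∈ q∈ p≺q le) (b-qs b) le')
    ... | inj₂ r≺q = unpassed (σ c) (proj₁ (pass r∈ q∈ r≺q le) (>-s-r q∈ nr ns (b-qs b)) (≤-trans le' (<⇒≤ s<r)))
            (proj₁ (pass s∈ q∈ p≺q le) (b-qs b) le')
    early : B' s q → suc c ≤ len s → ¬ Arc (e q c) (shortly (σ (suc c)) (suc c)) (e q (suc c))
    early b le' with cmp nr
    ... | inj₁ q≺r = hidden (σ (suc c)) waiting (proj₂ (pass s∈ q∈ p≺q le) (b-sq b) le')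
      where
      waiting : σ (suc c) ≡ true → ¬ Arc (e s (suc c)) (e q c) (e r (suc c))
      waiting eq a with σ (suc c) | next? c
      ... | true | traded _ f = Between.before-move q∈ p≺q q≺r (s-r-> q∈ nr ns (b-sq b)) (<⇒≤ le') (arc-tail f a)
    ... | inj₂ r≺q = unpassed (σ (suc c)) (proj₂ (pass r∈ q∈ r≺q le) (s-r-> q∈ nr ns (b-sq b)) (≤-trans le' (<⇒≤ s<r)))
            (proj₂ (pass s∈ q∈ p≺q le) (b-sq b) le')
  ... | isT nr ns | isT nr' ns' rewrite owner-t (σ c) c nr ns | owner-t (σ (suc c)) (suc c) nr ns | owner-t (σ c) c nr' ns' | owner-t (σ (suc c)) (suc c) nr' ns' =
    (λ b → proj₁ (pass p∈ q∈ p≺q le) ([ id , (λ { (_ , e) → ⊥-elim (nr e) }) ]′ (conv q∈ p∈ b))) ,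
    (λ b → proj₂ (pass p∈ q∈ p≺q le) ([ id , (λ { (_ , e) → ⊥-elim (nr' e) }) ]′ (conv p∈ q∈ b)))

  dist' : ∀ {p q c} → R p → R q → c ≤ len p → c ≤ len q → e' p c ≡ e' q c → p ≡ q
  dist' {p} {q} {c} p∈ q∈ lp lq eq = trans (sym (owner-involutive (σ c) p))
    (trans (cong (owner (σ c)) (dist (owner-∈ (σ c) p∈) (owner-∈ (σ c) q∈) (owner-len (σ c) (σ-len c) lp) (owner-len (σ c) (σ-len c) lq) eq))
      (owner-involutive (σ c) q))

  valid' : Valid* R len _≺_ B' e'
  valid' = record { dist = dist' ; pass = pass' }

-- Orders of moves as lists

data Before : List ℕ → ℕ → ℕ → Set where
  head : ∀ {r s xs} → s ∈ xs → Before (r ∷ xs) r s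
  tail : ∀ {x r s xs} → Before xs r s → Before (x ∷ xs) r s

Unique : List ℕ → Set
Unique = AllPairs _≢_

before-∈ : ∀ {L p q} → Before L p q → p ∈ L
before-∈ (head _) = here refl
before-∈ (tail b) = there (before-∈ b)

before-∈' : ∀ {L p q} → Before L p q → q ∈ L
before-∈' (head m) = there m
before-∈' (tail b) = there (before-∈' b)

before-total : ∀ {L p q} → p ∈ L → q ∈ L → p ≢ q → Before L p q ⊎ Before L q p
before-total (here refl) (here refl) ne = ⊥-elim (ne refl)
before-total (here refl) (there q) ne = inj₁ (head q)
before-total (there p) (here refl) ne = inj₂ (head p)
before-total (there p) (there q) ne = [ inj₁ ∘ tail , inj₂ ∘ tail ]′ (before-total p q ne)

∈-exchange : ∀ (xs : List ℕ) {r s ys p} → p ∈ xs ++ r ∷ s ∷ ys → p ∈ xs ++ s ∷ r ∷ ys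
∈-exchange [] (here refl) = there (here refl)
∈-exchange [] (there (here refl)) = here refl
∈-exchange [] (there (there m)) = there (there m)
∈-exchange (x ∷ xs) (here refl) = here refl
∈-exchange (x ∷ xs) (there m) = there (∈-exchange xs m)

All-exchange : ∀ {P : ℕ → Set} xs {r s ys} → All P (xs ++ r ∷ s ∷ ys) → All P (xs ++ s ∷ r ∷ ys)
All-exchange [] (a ∷ b ∷ c) = b ∷ a ∷ c
All-exchange (x ∷ xs) (a ∷ as) = a ∷ All-exchange xs as

unique-exchange : ∀ xs {r s ys} → Unique (xs ++ r ∷ s ∷ ys) → Unique (xs ++ s ∷ r ∷ ys)
unique-exchange [] ((r≢s ∷ a) ∷ b ∷ u) = ((r≢s ∘ sym) ∷ b) ∷ a ∷ u
unique-exchange (x ∷ xs) (a ∷ u) = All-exchange xs a ∷ unique-exchange xs u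

module _ {r s : ℕ} {ys : List ℕ} where

  L-rs L-sr : List ℕ → List ℕ
  L-rs xs = xs ++ r ∷ s ∷ ys
  L-sr xs = xs ++ s ∷ r ∷ ys

  r∈L : ∀ xs → r ∈ L-rs xs
  r∈L xs = ∈-++⁺ʳ xs (here refl)

  s∈L : ∀ xs → s ∈ L-rs xs
  s∈L xs = ∈-++⁺ʳ xs (there (here refl))

  before-conv : ∀ xs {p q} → Before (L-sr xs) p q → Before (L-rs xs) p q ⊎ (p ≡ s × q ≡ r)
  before-conv [] (head (here refl)) = inj₂ (refl , refl)
  before-conv [] (head (there m)) = inj₁ (tail (head m))
  before-conv [] (tail (head m)) = inj₁ (head (there m))
  before-conv [] (tail (tail b)) = inj₁ (tail (tail b))
  before-conv (x ∷ xs) (head m) = inj₁ (head (∈-exchange xs m))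
  before-conv (x ∷ xs) (tail b) = [ inj₁ ∘ tail , inj₂ ]′ (before-conv xs b)

  before-r-s : ∀ xs → Before (L-rs xs) r s
  before-r-s [] = head (here refl)
  before-r-s (x ∷ xs) = tail (before-r-s xs)

  ¬before-r-s : ∀ xs → Unique (L-rs xs) → ¬ Before (L-sr xs) r s
  ¬before-r-s [] ((r≢s ∷ _) ∷ _) (head _) = r≢s refl
  ¬before-r-s [] (_ ∷ s∉ ∷ _) (tail (head m)) = All.lookup s∉ m refl
  ¬before-r-s [] ((_ ∷ r∉) ∷ _) (tail (tail b)) = All.lookup r∉ (before-∈ b) refl
  ¬before-r-s (x ∷ xs) (x∉ ∷ _) (head _) = All.lookup x∉ (r∈L xs) refl
  ¬before-r-s (x ∷ xs) (_ ∷ u) (tail b) = ¬before-r-s xs u b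

  before-r⇒s : ∀ xs {t} → Unique (L-rs xs) → t ≢ s → Before (L-rs xs) r t → Before (L-rs xs) s t
  before-r⇒s [] u ne (head (here e)) = ⊥-elim (ne e)
  before-r⇒s [] u ne (head (there m)) = tail (head m)
  before-r⇒s [] ((r≢s ∷ r∉) ∷ _) ne (tail b) with before-∈ b
  ... | here e = ⊥-elim (r≢s e)
  ... | there m = ⊥-elim (All.lookup r∉ m refl)
  before-r⇒s (x ∷ xs) (x∉ ∷ _) ne (head _) = ⊥-elim (All.lookup x∉ (r∈L xs) refl)
  before-r⇒s (x ∷ xs) (_ ∷ u) ne (tail b) = tail (before-r⇒s xs u ne b)

  before-s⇒r : ∀ xs {t} → Unique (L-rs xs) → Before (L-rs xs) s t → Before (L-rs xs) r t
  before-s⇒r [] u (head m) = head m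
  before-s⇒r [] u (tail b) = head (before-∈' b)
  before-s⇒r (x ∷ xs) (x∉ ∷ _) (head _) = ⊥-elim (All.lookup x∉ (s∈L xs) refl)
  before-s⇒r (x ∷ xs) (_ ∷ u) (tail b) = tail (before-s⇒r xs u b)

  before⇒s : ∀ xs {t} → Unique (L-rs xs) → t ≢ r → t ≢ s → Before (L-rs xs) t r → Before (L-rs xs) t s
  before⇒s [] u nr ns (head _) = ⊥-elim (nr refl)
  before⇒s [] ((r≢s ∷ r∉) ∷ _) nr ns (tail b) with before-∈' b
  ... | here e = ⊥-elim (r≢s e)
  ... | there m = ⊥-elim (All.lookup r∉ m refl)
  before⇒s (x ∷ xs) u nr ns (head _) = head (s∈L xs)
  before⇒s (x ∷ xs) (_ ∷ u) nr ns (tail b) = tail (before⇒s xs u nr ns b)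

  before⇒r : ∀ xs {t} → Unique (L-rs xs) → t ≢ r → t ≢ s → Before (L-rs xs) t s → Before (L-rs xs) t r
  before⇒r [] u nr ns (head _) = ⊥-elim (nr refl)
  before⇒r [] u nr ns (tail (head _)) = ⊥-elim (ns refl)
  before⇒r [] (_ ∷ s∉ ∷ _) nr ns (tail (tail b)) = ⊥-elim (All.lookup s∉ (before-∈' b) refl)
  before⇒r (x ∷ xs) u nr ns (head _) = head (r∈L xs)
  before⇒r (x ∷ xs) (_ ∷ u) nr ns (tail b) = tail (before⇒r xs u nr ns b)

-- Determinacy by sorting the order of moves

module Determinacy {R : ℕ → Set} {len : ℕ → ℕ} {_≺_ : ℕ → ℕ → Set} (rank : Rank _≺_)
  (≺-trans : ∀ {p q r} → p ≺ q → q ≺ r → p ≺ r) (≺-len : ∀ {p q} → p ≺ q → len p ≤ len q) where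
  open Rank rank

  SameColumns : (e e₂ : ℕ → ℕ → ℕ) → Set
  SameColumns e e₂ = ∀ {p c} → R p → c ≤ len p → ∃ λ u → R u × c ≤ len u × e₂ u c ≡ e p c

  Determined : List ℕ → Set
  Determined L = ∀ e e₂ → Valid* R len _≺_ (Before L) e → Valid* R len _≺_ (Before L) e₂ →
    (∀ p → R p → e p 0 ≡ e₂ p 0) → SameColumns e e₂ → SameColumns e₂ e → ∀ p c → R p → c ≤ len p → e p c ≡ e₂ p c

  -- Ensures that of two exchanged rows the outranking one is strictly longer. It then has a cell
  -- just beyond the other row, where the induction in `exchange-determined` starts.
  Ties : List ℕ → Set
  Ties L = ∀ {p q} → Before L p q → q ≺ p → len q < len p

  -- Rows are compared from the highest rank down. If `x` has two different targets, one of them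
  -- lies on the jump to the other in that process. The row standing there differs between the
  -- processes, so it is not later than `x`; it has moved before `x`, has lower rank, and is passed.
  sorted-determined : ∀ L → (∀ {p} → R p → p ∈ L) → AllPairs _≺_ L → Determined L
  sorted-determined L ∈L sorted e e₂ v v₂ base₀ same₁ same₂ p zero p∈ le = base₀ p p∈
  sorted-determined L ∈L sorted e e₂ v v₂ base₀ same₁ same₂ p (suc c) p∈ le = go [] L refl p (∈L p∈) p∈ le
    where
    prev : ∀ p → R p → c ≤ len p → e p c ≡ e₂ p c
    prev p = sorted-determined L ∈L sorted e e₂ v v₂ base₀ same₁ same₂ p c
    before-≺ : ∀ {L p q} → AllPairs _≺_ L → Before L p q → p ≺ q
    before-≺ (a ∷ _) (head m) = All.lookup a m
    before-≺ (_ ∷ s) (tail b) = before-≺ s b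
    before-pre : ∀ pre {x suf u} → u ∈ pre → Before (pre ++ x ∷ suf) u x
    before-pre (y ∷ pre) (here refl) = head (∈-++⁺ʳ pre (here refl))
    before-pre (y ∷ pre) (there m) = tail (before-pre pre m)
    go : ∀ pre suf → pre ++ suf ≡ L → ∀ p → p ∈ suf → R p → suc c ≤ len p → e p (suc c) ≡ e₂ p (suc c)
    go pre (x ∷ suf) eq p (there m) p∈ le = go (pre ++ x ∷ []) suf (trans (++-assoc pre (x ∷ []) suf) eq) p m p∈ le
    go pre (x ∷ suf) eq .x (here refl) p∈ le with e x (suc c) ≟ e₂ x (suc c)
    ... | yes q = q
    ... | no ne = ⊥-elim (one-of (arc-total (e x c) (e x (suc c)) (e₂ x (suc c))))
      where
      rest : ∀ u → u ∈ suf → R u → suc c ≤ len u → e u (suc c) ≡ e₂ u (suc c)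
      rest = go (pre ++ x ∷ []) suf (trans (++-assoc pre (x ∷ []) suf) eq)
      lower-row : ∀ {u} → R u → suc c ≤ len u → e u (suc c) ≢ e₂ u (suc c) → u ≢ x → Before L u x
      lower-row {u} u∈ le' ne' u≢x with ∈-++⁻ pre (subst (u ∈_) (sym eq) (∈L u∈))
      ... | inj₁ m = subst (λ l → Before l u x) eq (before-pre pre m)
      ... | inj₂ (here e) = ⊥-elim (u≢x e)
      ... | inj₂ (there m) = ⊥-elim (ne' (rest u m u∈ le'))
      one-of : Arc (e x c) (e x (suc c)) (e₂ x (suc c)) ⊎ Arc (e x c) (e₂ x (suc c)) (e x (suc c)) → ⊥
      one-of (inj₂ a) with same₂ {x} {suc c} p∈ le
      ... | u , u∈ , le' , h = proj₂ (Valid*.pass v u∈ p∈ (before-≺ sorted b) le) b le' (subst (λ z → Arc (e x c) z (e x (suc c))) (sym h) a)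
        where
        u≢x : u ≢ x
        u≢x refl = ne h
        b : Before L u x
        b = lower-row u∈ le' (λ q → u≢x (Valid*.dist v₂ u∈ p∈ le' le (trans (sym q) h))) u≢x
      one-of (inj₁ a) with same₁ {x} {suc c} p∈ le
      ... | u , u∈ , le' , h = proj₂ (Valid*.pass v₂ u∈ p∈ (before-≺ sorted b) le) b le'
              (subst₂ (λ y z → Arc y z (e₂ x (suc c))) (prev x p∈ (<⇒≤ le)) (sym h) a)
        where
        u≢x : u ≢ x
        u≢x refl = ne (sym h)
        b : Before L u x
        b = lower-row u∈ le' (λ q → u≢x (Valid*.dist v u∈ p∈ le' le (trans q h))) u≢x

  -- After the exchange the processes agree, so in each column the rows `r` and `s` agree or are
  -- interchanged. Descending induction on columns excludes the latter: if `r` has the same place in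
  -- column `c + 1` and the rows are interchanged in column `c`, then in one of the two processes
  -- `r` jumps over `s`.
  exchange-determined : ∀ xs {r s ys} → s ≺ r → Unique (xs ++ r ∷ s ∷ ys) → Ties (xs ++ r ∷ s ∷ ys) →
    (∀ {p} → R p → p ∈ xs ++ r ∷ s ∷ ys) → R r → R s →
    Determined (xs ++ s ∷ r ∷ ys) → Determined (xs ++ r ∷ s ∷ ys)
  exchange-determined xs {r} {s} {ys} s≺r uniq ties ∈L r∈ s∈ det e e₂ v v₂ base₀ same₁ same₂ p c p∈ le = conclude p∈ (X.row? p) le
    where
    ex : Exchange R (Before (xs ++ r ∷ s ∷ ys)) (Before (xs ++ s ∷ r ∷ ys)) r s
    ex = record
      { r∈ = r∈ ; s∈ = s∈ ; r-s = before-r-s xs ; ¬r-s = ¬before-r-s xs uniq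
      ; conv = λ _ _ → before-conv xs
      ; r-s-> = λ _ _ ns → before-r⇒s xs uniq ns ; s-r-> = λ _ _ _ → before-s⇒r xs uniq
      ; >-r-s = λ _ nr ns → before⇒s xs uniq nr ns ; >-s-r = λ _ nr ns → before⇒r xs uniq nr ns
      ; order = λ t∈ ne → before-total (∈L t∈) (∈L r∈) ne }
    s<r : len s < len r
    s<r = ties (before-r-s xs) s≺r
    module X = ExchangeRows rank ≺-trans ≺-len s≺r s<r ex (λ _ t≺s b → ties b t≺s) v
    module Y = ExchangeRows rank ≺-trans ≺-len s≺r s<r ex (λ _ t≺s b → ties b t≺s) v₂
    same' : ∀ {e e₂ : ℕ → ℕ → ℕ} (b b₂ : ℕ → Bool) → (∀ c → b c ≡ true → c ≤ len s) → (∀ c → b₂ c ≡ true → c ≤ len s) →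
      SameColumns e e₂ → SameColumns (λ p c → e (X.owner (b c) p) c) (λ p c → e₂ (X.owner (b₂ c) p) c)
    same' {e} {e₂} b b₂ h h₂ sc {p} {c} p∈ le with sc (X.owner-∈ (b c) p∈) (X.owner-len (b c) (h c) le)
    ... | u , u∈ , le' , eq = X.owner (b₂ c) u , X.owner-∈ (b₂ c) u∈ , X.owner-len (b₂ c) (h₂ c) le' ,
          trans (cong (λ z → e₂ z c) (X.owner-involutive (b₂ c) u)) eq
    agree' : ∀ p c → R p → c ≤ len p → X.e' p c ≡ Y.e' p c
    agree' = det X.e' Y.e' X.valid' Y.valid' base₀ (same' X.σ Y.σ X.σ-len Y.σ-len same₁) (same' Y.σ X.σ Y.σ-len X.σ-len same₂)
    pair : ∀ {c} → c ≤ len s → (e r c ≡ e₂ r c × e s c ≡ e₂ s c) ⊎ (e r c ≡ e₂ s c × e s c ≡ e₂ r c)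
    pair {c} le with agree' r c r∈ (≤-trans le (<⇒≤ s<r)) | agree' s c s∈ le
    ... | a | b rewrite X.owner-r (X.σ c) c | Y.owner-r (Y.σ c) c | X.owner-s (X.σ c) c | Y.owner-s (Y.σ c) c with X.σ c | Y.σ c
    ...   | true | true = inj₁ (b , a)
    ...   | false | false = inj₁ (a , b)
    ...   | true | false = inj₂ (b , a)
    ...   | false | true = inj₂ (a , b)
    beyond : ∀ {c} → len s < c → c ≤ len r → e r c ≡ e₂ r c
    beyond {c} lt le with agree' r c r∈ le
    ... | a rewrite X.owner-r (X.σ c) c | Y.owner-r (Y.σ c) c with X.σ c in h | Y.σ c in h₂
    ...   | false | false = a
    ...   | true | _ = ⊥-elim (<⇒≱ lt (X.σ-len c h))
    ...   | false | true = ⊥-elim (<⇒≱ lt (Y.σ-len c h₂))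
    both-rows : ∀ d c → c + d ≡ len s → e r c ≡ e₂ r c × e s c ≡ e₂ s c
    both-rows d c eq with pair (subst (c ≤_) eq (m≤m+n c d))
    ... | inj₁ agree = agree
    ... | inj₂ (rs , sr) = ⊥-elim (Y.s-not-passed c≤ (subst₂ (λ y z → Arc y z (e₂ r (suc c))) sr rs
            (subst (Arc (e s c) (e r c)) (next-r d eq) (arc-complement (X.s-not-passed c≤)))))
      where
      c≤ : c ≤ len s
      c≤ = subst (c ≤_) eq (m≤m+n c d)
      next-r : ∀ d → c + d ≡ len s → e r (suc c) ≡ e₂ r (suc c)
      next-r zero eq = beyond (≤-reflexive (cong suc (trans (sym eq) (+-identityʳ c)))) (≤-trans (s≤s c≤) s<r)
      next-r (suc d) eq = proj₁ (both-rows d (suc c) (trans (sym (+-suc c d)) eq))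
    conclude : ∀ {p c} → R p → X.Row p → c ≤ len p → e p c ≡ e₂ p c
    conclude {c = c} _ X.isR le with c ≤? len s
    ... | yes c≤ = proj₁ (both-rows (len s ∸ c) c (m+[n∸m]≡n c≤))
    ... | no c> = beyond (≰⇒> c>) le
    conclude {c = c} _ X.isS le = proj₂ (both-rows (len s ∸ c) c (m+[n∸m]≡n le))
    conclude {p} {c} p∈ (X.isT nr ns) le = trans (sym (X.owner-t (X.σ c) c nr ns)) (trans (agree' p c p∈ le) (Y.owner-t (Y.σ c) c nr ns))

  infix 4 _⇝_
  -- Only neighbours in the wrong order of rank are exchanged, which is the case that `ExchangeRows`
  -- covers; insertion sort consists of such moves.
  data _⇝_ : List ℕ → List ℕ → Set where
    done : ∀ {L} → L ⇝ L
    move : ∀ xs {r s ys L} → s ≺ r → xs ++ s ∷ r ∷ ys ⇝ L → xs ++ r ∷ s ∷ ys ⇝ L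

  ⇝-trans : ∀ {L L' L''} → L ⇝ L' → L' ⇝ L'' → L ⇝ L''
  ⇝-trans done t = t
  ⇝-trans (move xs k s) t = move xs k (⇝-trans s t)

  ⇝-cons : ∀ x {L L'} → L ⇝ L' → x ∷ L ⇝ x ∷ L'
  ⇝-cons x done = done
  ⇝-cons x (move xs k s) = move (x ∷ xs) k (⇝-cons x s)

  ⇝-All : ∀ {P : ℕ → Set} {L L'} → L ⇝ L' → All P L → All P L'
  ⇝-All done a = a
  ⇝-All (move xs k s) a = ⇝-All s (All-exchange xs a)

  insert : ∀ x L → All (x ≢_) L → AllPairs _≺_ L → ∃ λ L' → x ∷ L ⇝ L' × AllPairs _≺_ L'
  insert x [] _ _ = x ∷ [] , done , [] ∷ []
  insert x (y ∷ L) (x≢y ∷ ne) (y≺ ∷ sorted) with cmp x≢y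
  ... | inj₁ x≺y = x ∷ y ∷ L , done , (x≺y ∷ All.map (≺-trans x≺y) y≺) ∷ y≺ ∷ sorted
  ... | inj₂ y≺x with insert x L ne sorted
  ...   | L' , s , sorted' = y ∷ L' , move [] y≺x (⇝-cons y s) , ⇝-All s (y≺x ∷ y≺) ∷ sorted'

  sort : ∀ L → Unique L → ∃ λ L' → L ⇝ L' × AllPairs _≺_ L'
  sort [] _ = [] , done , []
  sort (x ∷ L) (ne ∷ u) with sort L u
  ... | L' , s , sorted with insert x L' (⇝-All s ne) sorted
  ...   | L'' , s' , sorted' = L'' , ⇝-trans (⇝-cons x s) s' , sorted'

  ⇝-determined : ∀ {L L'} → L ⇝ L' → Unique L → Ties L → (∀ {p} → R p → p ∈ L) → (∀ {p} → p ∈ L → R p) →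
    AllPairs _≺_ L' → Determined L
  ⇝-determined done u ties ∈L L∈ sorted = sorted-determined _ ∈L sorted
  ⇝-determined (move xs {r} {s} {ys} k t) u ties ∈L L∈ sorted =
    exchange-determined xs k u ties ∈L (L∈ (r∈L {r} {s} {ys} xs)) (L∈ (s∈L {r} {s} {ys} xs))
      (⇝-determined t (unique-exchange xs u) ties' (∈-exchange xs ∘ ∈L) (L∈ ∘ ∈-exchange xs) sorted)
    where
    ties' : Ties (xs ++ s ∷ r ∷ ys)
    ties' b h with before-conv xs b
    ... | inj₁ b' = ties b' h
    ... | inj₂ (refl , refl) = ⊥-elim (asym k h)

  determined : ∀ L → Unique L → Ties L → (∀ {p} → R p → p ∈ L) → (∀ {p} → p ∈ L → R p) → Determined L
  determined L u ties ∈L L∈ with sort L u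
  ... | L' , s , sorted = ⇝-determined s u ties ∈L L∈ sorted

-- Fillings

nth-ext : ∀ {A : Set} (xs ys : List A) → (∀ k → nth xs k ≡ nth ys k) → xs ≡ ys
nth-ext [] [] h = refl
nth-ext [] (y ∷ ys) h = case h 0 of λ ()
nth-ext (x ∷ xs) [] h = case h 0 of λ ()
nth-ext (x ∷ xs) (y ∷ ys) h = cong₂ _∷_ (just-injective (h 0)) (nth-ext xs ys (h ∘ suc))

nth-< : ∀ {A : Set} (xs : List A) k {x} → nth xs k ≡ just x → k < length xs
nth-< (x ∷ xs) zero eq = s≤s z≤n
nth-< (x ∷ xs) (suc k) eq = s≤s (nth-< xs k eq)

nth-just : ∀ {A : Set} (xs : List A) k → k < length xs → ∃ λ x → nth xs k ≡ just x
nth-just (x ∷ xs) zero lt = x , refl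
nth-just (x ∷ xs) (suc k) (s≤s lt) = nth-just xs k lt

nth-updL : ∀ {A : Set} k (v : A) xs {x} → nth xs k ≡ just x → nth (updL k v xs) k ≡ just v
nth-updL zero v (x ∷ xs) eq = refl
nth-updL (suc k) v (x ∷ xs) eq = nth-updL k v xs eq

nth-updL-other : ∀ {A : Set} k j (v : A) xs → j ≢ k → nth (updL k v xs) j ≡ nth xs j
nth-updL-other k j v [] ne = refl
nth-updL-other zero zero v (x ∷ xs) ne = ⊥-elim (ne refl)
nth-updL-other zero (suc j) v (x ∷ xs) ne = refl
nth-updL-other (suc k) zero v (x ∷ xs) ne = refl
nth-updL-other (suc k) (suc j) v (x ∷ xs) ne = nth-updL-other k j v xs (ne ∘ cong suc)

nth-updV : ∀ {A : Set} {n} k (g : A → A) (xs : Vec A n) → nth (toList (updV k g xs)) k ≡ M.map g (nth (toList xs) k)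
nth-updV k g V.[] = refl
nth-updV zero g (x V.∷ xs) = refl
nth-updV (suc k) g (x V.∷ xs) = nth-updV k g xs

nth-updV-other : ∀ {A : Set} {n} k j (g : A → A) (xs : Vec A n) → j ≢ k → nth (toList (updV k g xs)) j ≡ nth (toList xs) j
nth-updV-other k j g V.[] ne = refl
nth-updV-other zero zero g (x V.∷ xs) ne = ⊥-elim (ne refl)
nth-updV-other zero (suc j) g (x V.∷ xs) ne = refl
nth-updV-other (suc k) zero g (x V.∷ xs) ne = refl
nth-updV-other (suc k) (suc j) g (x V.∷ xs) ne = nth-updV-other k j g xs (ne ∘ cong suc)

nth-toList-map : ∀ {A B : Set} {n} (f : A → B) (xs : Vec A n) k → nth (toList (V.map f xs)) k ≡ M.map f (nth (toList xs) k)
nth-toList-map f V.[] k = refl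
nth-toList-map f (x V.∷ xs) zero = refl
nth-toList-map f (x V.∷ xs) (suc k) = nth-toList-map f xs k

nth-toList-< : ∀ {A : Set} {n} (xs : Vec A n) k {x} → nth (toList xs) k ≡ just x → k < n
nth-toList-< (x V.∷ xs) zero eq = s≤s z≤n
nth-toList-< (x V.∷ xs) (suc k) eq = s≤s (nth-toList-< xs k eq)

nth-toList-just : ∀ {A : Set} {n} (xs : Vec A n) k → k < n → ∃ λ x → nth (toList xs) k ≡ just x
nth-toList-just (x V.∷ xs) zero lt = x , refl
nth-toList-just (x V.∷ xs) (suc k) (s≤s lt) = nth-toList-just xs k lt

entryRow-suc : ∀ r r' c m → entryRow r (suc c) m ≡ entryRow r' (suc c) m
entryRow-suc r r' c (just row) = refl
entryRow-suc r r' c nothing = refl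

filling-ext : ∀ {n} (T T' : Filling n) → (∀ r c → entry T r (suc c) ≡ entry T' r (suc c)) → T ≡ T'
filling-ext V.[] V.[] h = refl
filling-ext (x V.∷ T) (y V.∷ T') h = cong₂ V._∷_ (nth-ext x y (h 1)) (filling-ext T T' tails)
  where
  tails : ∀ r c → entry T r (suc c) ≡ entry T' r (suc c)
  tails zero c = refl
  tails (suc r) c = trans (entryRow-suc r (suc r) c (nth (toList T) r))
    (trans (h (suc (suc r)) c) (entryRow-suc (suc r) r c (nth (toList T') r)))

shape-nth : ∀ {n} (a : Vec ℕ n) (T : Filling n) → Shape a T → ∀ k → nth (toList a) k ≡ M.map length (nth (toList T) k)
shape-nth V.[] V.[] sh k = refl
shape-nth (x V.∷ a) (row V.∷ T) sh zero = cong just (sym (sh F.zero))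
shape-nth (x V.∷ a) (row V.∷ T) sh (suc k) = shape-nth a T (sh ∘ F.suc) k

module Cells {n : ℕ} (a : Vec ℕ n) (T : Filling n) (sh : Shape a T) where

  row-length : ∀ r {row} → nth (toList T) r ≡ just row → rowLen a (suc r) ≡ length row
  row-length r eq rewrite shape-nth a T sh r | eq = refl

  entry-len : ∀ {r c k} → entry T r c ≡ just k → c ≤ rowLen a r
  entry-len {r} {zero} eq = z≤n
  entry-len {suc r} {suc c} eq with nth (toList T) r in e
  ... | just row = subst (suc c ≤_) (sym (row-length r e)) (nth-< row c eq)

  entry-row : ∀ {r c k} → entry T r c ≡ just k → 1 ≤ r × r ≤ n
  entry-row {suc r} {c} eq with nth (toList T) r in e
  ... | just row = s≤s z≤n , nth-toList-< T r e
  entry-row {suc r} {zero} () | nothing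
  entry-row {suc r} {suc c} () | nothing

  cell : ∀ {r c} → 1 ≤ r → r ≤ n → c ≤ rowLen a r → ∃ λ k → entry T r c ≡ just k
  cell {suc r} {zero} _ r≤n _ with nth-toList-just T r r≤n
  ... | row , eq rewrite eq = suc r , refl
  cell {suc r} {suc c} _ r≤n le with nth-toList-just T r r≤n
  ... | row , eq with nth-just row c (subst (suc c ≤_) (row-length r eq) le)
  ...   | k , eq' rewrite eq = k , eq'

  basement : ∀ {r} → 1 ≤ r → r ≤ n → entry T r 0 ≡ just r
  basement {suc r} _ r≤n with nth-toList-just T r r≤n
  ... | row , eq rewrite eq = refl

  basement⁻¹ : ∀ {r k} → entry T r 0 ≡ just k → k ≡ r
  basement⁻¹ {suc r} eq with nth (toList T) r
  basement⁻¹ {suc r} refl | just row = refl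

RankOf : ∀ {n} → Vec ℕ n → ℕ → ℕ → Set
RankOf a s r = (r < s × rowLen a s < rowLen a r) ⊎ (s < r × rowLen a s ≤ rowLen a r)

rankOf : ∀ {n} (a : Vec ℕ n) → Rank (RankOf a)
rankOf a = record { asym = asym ; cmp = cmp }
  where
  asym : ∀ {p q} → RankOf a p q → ¬ RankOf a q p
  asym (inj₁ (_ , l)) (inj₁ (_ , l')) = <-asym l l'
  asym (inj₁ (_ , l)) (inj₂ (_ , l')) = <⇒≱ l l'
  asym (inj₂ (_ , l)) (inj₁ (_ , l')) = <⇒≱ l' l
  asym (inj₂ (l , _)) (inj₂ (l' , _)) = <-asym l l'
  cmp : ∀ {p q} → p ≢ q → RankOf a p q ⊎ RankOf a q p
  cmp {p} {q} ne with <-cmp p q | ≤-<-connex (rowLen a p) (rowLen a q) | ≤-<-connex (rowLen a q) (rowLen a p)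
  ... | tri< lt _ _ | inj₁ le | _ = inj₁ (inj₂ (lt , le))
  ... | tri< lt _ _ | inj₂ gt | _ = inj₂ (inj₁ (lt , gt))
  ... | tri≈ _ e _ | _ | _ = ⊥-elim (ne e)
  ... | tri> _ _ gt | _ | inj₁ le = inj₂ (inj₂ (gt , le))
  ... | tri> _ _ gt | _ | inj₂ lt = inj₁ (inj₁ (gt , lt))

rank-len : ∀ {n} (a : Vec ℕ n) {p q} → RankOf a p q → rowLen a p ≤ rowLen a q
rank-len a (inj₁ (_ , lt)) = <⇒≤ lt
rank-len a (inj₂ (_ , le)) = le

rank-tie : ∀ {n} (a : Vec ℕ n) {p q} → RankOf a p q → rowLen a q ≤ rowLen a p → p < q
rank-tie a (inj₁ (_ , lt)) le = ⊥-elim (<⇒≱ lt le)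
rank-tie a (inj₂ (lt , _)) le = lt

rank-trans : ∀ {n} (a : Vec ℕ n) {p q r} → RankOf a p q → RankOf a q r → RankOf a p r
rank-trans a {p} {q} {r} pq qr with ≤-<-connex (rowLen a r) (rowLen a p)
... | inj₁ le = inj₂ (<-trans (rank-tie a pq (≤-trans (rank-len a qr) le)) (rank-tie a qr (≤-trans le (rank-len a pq))) , ≤-trans (rank-len a pq) (rank-len a qr))
... | inj₂ lt with <-cmp p r
...   | tri< p<r _ _ = inj₂ (p<r , <⇒≤ lt)
...   | tri≈ _ refl _ = ⊥-elim (<-irrefl refl lt)
...   | tri> _ _ r<p = inj₁ (r<p , lt)

arc⇒coInv : ∀ {p k q} → k ≢ p → k ≢ q → Arc p k q → CoInv p q k
arc⇒coInv np nq (inj₁ (a , b)) = inj₂ (inj₁ (≤∧≢⇒< a (nq ∘ sym) , ≤∧≢⇒< b np))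
arc⇒coInv np nq (inj₂ (inj₁ (a , b))) = inj₂ (inj₂ (≤∧≢⇒< a np , b))
arc⇒coInv np nq (inj₂ (inj₂ (a , b))) = inj₁ (a , ≤∧≢⇒< b (nq ∘ sym))

coInv⇒arc : ∀ {p k q} → CoInv p q k → Arc p k q
coInv⇒arc (inj₁ (a , b)) = inj₂ (inj₂ (a , <⇒≤ b))
coInv⇒arc (inj₂ (inj₁ (a , b))) = inj₁ (<⇒≤ a , <⇒≤ b)
coInv⇒arc (inj₂ (inj₂ (a , b))) = inj₂ (inj₁ (<⇒≤ a , b))

sskd-distinct : ∀ {n} {a : Vec ℕ n} {T : Filling n} → SSKD a T → Distinct (entry T)
sskd-distinct (_ , _ , na , _) r s c k er es with r ≟ s
... | yes e = e
... | no ne = ⊥-elim (na r c s c k k er es (inj₁ (refl , ne)) refl)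

sskd-noPassing : ∀ {n} {a : Vec ℕ n} {T : Filling n} → SSKD a T → NoPassing (RankOf a) (entry T)
sskd-noPassing {a = a} {T} (_ , _ , na , nc) r c s p q k s≺r ep eq = upper s≺r , lower' s≺r
  where
  upper : RankOf a s r → r < s → entry T s c ≡ just k → ¬ Arc p k q
  upper (inj₂ (s<r , _)) r<s _ _ = <-asym r<s s<r
  upper (inj₁ (_ , lt)) r<s ek arc = proj₁ (nc r c p q ep eq) s k r<s lt ek (arc⇒coInv
    (na s c r c k p ek ep (inj₁ (refl , λ e → <-irrefl (sym e) r<s)))
    (na s c r (suc c) k q ek eq (inj₂ (inj₁ (refl , r<s)))) arc)
  lower' : RankOf a s r → s < r → entry T s (suc c) ≡ just k → ¬ Arc p k q
  lower' (inj₁ (r<s , _)) s<r _ _ = <-asym r<s s<r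
  lower' (inj₂ (_ , le)) s<r ek arc = proj₂ (nc r c p q ep eq) s k s<r le ek (arc⇒coInv
    (λ e → na r c s (suc c) p k ep ek (inj₂ (inj₁ (refl , s<r))) (sym e))
    (na s (suc c) r (suc c) k q ek eq (inj₁ (refl , λ e → <-irrefl e s<r))) arc)

-- Equal entries in attacking cells of adjacent columns, the left one higher, are endpoints of a
-- jump. If the upper row is at least as long, its jump starts at the value which the lower row has
-- just taken; otherwise the jump of the lower row ends where the upper row still stands. Both are
-- forbidden, as arcs contain their ends.
sskd-intro : ∀ {n} {a : Vec ℕ n} {T : Filling n} → Shape a T → EntriesIn T → Distinct (entry T) →
  NoPassing (RankOf a) (entry T) → SSKD a T
sskd-intro {n} {a} {T} sh ei dist np = sh , ei , na , nc
  where
  open Cells a T sh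
  clash : ∀ r c s k → entry T r c ≡ just k → entry T s (suc c) ≡ just k → s < r → ⊥
  clash r c s k er es s<r with ≤-<-connex (rowLen a s) (rowLen a r)
  ... | inj₁ le with cell {r} {suc c} (proj₁ (entry-row {r} er)) (proj₂ (entry-row {r} er)) (≤-trans (entry-len {s} es) le)
  ...   | q , eq = proj₂ (np r c s k q k (inj₂ (s<r , le)) er eq) s<r es (arc-start k q)
  clash r c s k er es s<r | inj₂ lt with cell {s} {c} (proj₁ (entry-row {s} es)) (proj₂ (entry-row {s} es)) (<⇒≤ (entry-len {s} es))
  ...   | p , ep = proj₁ (np s c r p k k (inj₁ (s<r , lt)) ep es) s<r er (arc-end p k)
  na : NonAttacking T
  na r c s .c k .k er es (inj₁ (refl , ne)) refl = ne (dist r s c k er es)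
  na r c s .(suc c) k .k er es (inj₂ (inj₁ (refl , s<r))) refl = clash r c s k er es s<r
  na r .(suc d) s d k .k er es (inj₂ (inj₂ (refl , r<s))) refl = clash s d r k es er r<s
  nc : NoCoInv a T
  nc r c i j ei ej = (λ s k r<s lt ek co → proj₁ (np r c s i j k (inj₁ (r<s , lt)) ei ej) r<s ek (coInv⇒arc co)) ,
    (λ s k s<r le ek co → proj₂ (np r c s i j k (inj₂ (s<r , le)) ei ej) s<r ek (coInv⇒arc co))

-- Flipped fillings

flipRow : ℕ → (ℕ → Bool) → ℕ → List ℕ → List ℕ
flipRow i G k [] = []
flipRow i G k (x ∷ xs) = act i (G k) x ∷ flipRow i G (suc k) xs

flipFilling : ∀ {n} → ℕ → (ℕ → Bool) → Filling n → Filling n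
flipFilling i G T = V.map (flipRow i G 1) T

-- Stated through the entries rather than as an equation with `flipFilling`, because the raising
-- operator reaches its result by updates of single cells.
record Flipped {n} (i : ℕ) (G : ℕ → Bool) (T U : Filling n) : Set where
  constructor flipped
  field
    flips : ∀ r c → entry U r c ≡ M.map (act i (G c)) (entry T r c)
open Flipped

nth-flipRow : ∀ i G k xs c → nth (flipRow i G k xs) c ≡ M.map (act i (G (k + c))) (nth xs c)
nth-flipRow i G k [] c = refl
nth-flipRow i G k (x ∷ xs) zero rewrite +-identityʳ k = refl
nth-flipRow i G k (x ∷ xs) (suc c) rewrite +-suc k c = nth-flipRow i G (suc k) xs c

flipFilling-flipped : ∀ {n} i G (T : Filling n) → G 0 ≡ false → Flipped i G T (flipFilling i G T)
flipFilling-flipped i G T g0 = flipped go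
  where
  go : ∀ r c → entry (flipFilling i G T) r c ≡ M.map (act i (G c)) (entry T r c)
  go zero c = refl
  go (suc r) zero rewrite nth-toList-map (flipRow i G 1) T r | g0 with nth (toList T) r
  ... | just row = refl
  ... | nothing = refl
  go (suc r) (suc c) rewrite nth-toList-map (flipRow i G 1) T r with nth (toList T) r
  ... | just row = nth-flipRow i G 1 row c
  ... | nothing = refl

flipped-sym : ∀ {n i G} {T U : Filling n} → Flipped i G T U → Flipped i G U T
flipped-sym {i = i} {G} {T} {U} h = flipped go
  where
  go : ∀ r c → entry T r c ≡ M.map (act i (G c)) (entry U r c)
  go r c rewrite flips h r c with entry T r c
  ... | just x = cong just (sym (act-involutive i (G c) x))
  ... | nothing = refl

flipped-unique : ∀ {n i G} {T U U' : Filling n} → Flipped i G T U → Flipped i G T U' → U ≡ U'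
flipped-unique h h' = filling-ext _ _ λ r c → trans (flips h r (suc c)) (sym (flips h' r (suc c)))

length-flipRow : ∀ i G k xs → length (flipRow i G k xs) ≡ length xs
length-flipRow i G k [] = refl
length-flipRow i G k (x ∷ xs) = cong suc (length-flipRow i G (suc k) xs)

flipFilling-shape : ∀ {n} i G (a : Vec ℕ n) (T : Filling n) → Shape a T → Shape a (flipFilling i G T)
flipFilling-shape i G (x V.∷ a) (row V.∷ T) sh F.zero = trans (length-flipRow i G 1 row) (sh F.zero)
flipFilling-shape i G (x V.∷ a) (row V.∷ T) sh (F.suc r) = flipFilling-shape i G a T (sh ∘ F.suc) r

flipped-shape : ∀ {n i G} {a : Vec ℕ n} {T U : Filling n} → G 0 ≡ false → Flipped i G T U → Shape a T → Shape a U
flipped-shape {i = i} {G} {a} {T} g0 h sh =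
  subst (Shape a) (flipped-unique {i = i} {G} (flipFilling-flipped i G T g0) h) (flipFilling-shape i G a T sh)

flipped-entriesIn : ∀ {n i G} {T U : Filling n} → Valid n i → Flipped i G T U → EntriesIn T → EntriesIn U
flipped-entriesIn {n} {i} {G} {T} (1≤i , i<n) h ei r c k eq with entry T r (suc c) in e | trans (sym (flips h r (suc c))) eq
... | just x | refl = range (G (suc c))
  where
  range : ∀ b → 1 ≤ act i b x × act i b x ≤ n
  range false = ei r c x e
  range true with letter i x
  ... | low = s≤s z≤n , i<n
  ... | high = 1≤i , <⇒≤ i<n
  ... | other = ei r c x e

flipped-sskd : ∀ {n i G r} {a : Vec ℕ n} {T U : Filling n} → Valid n i → G 0 ≡ false → Flipped i G T U → SSKD a T →
  FlipZone i (RankOf a) (entry T) G r → SSKD a U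
flipped-sskd {i = i} {G} {a = a} {T} {U} va g0 h sk@(sh , ei , _) zone =
  sskd-intro {a = a} {U} (flipped-shape {i = i} {G} {a} {T} g0 h sh) (flipped-entriesIn {i = i} {G} {T} va h ei)
  (Flip.distinct' (rankOf a) (sskd-distinct sk) (sskd-noPassing sk) zone (entry U) (flips h))
  (Flip.noPassing' (rankOf a) (sskd-distinct sk) (sskd-noPassing sk) zone (entry U) (flips h))

eqM-true : ∀ m {v} → eqM m v ≡ true → m ≡ just v
eqM-true (just x) eq = cong just (≡ᵇ-true eq)

eqM-refl : ∀ {m v} → m ≡ just v → eqM m v ≡ true
eqM-refl {v = v} refl = ≡ᵇ-refl v

data FoundRow (c v k : ℕ) (rs : List (List ℕ)) : Maybe ℕ → Set where
  found  : ∀ j {row} → nth rs j ≡ just row → nth row c ≡ just v → FoundRow c v k rs (just (suc (k + j)))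
  absent : (∀ j row → nth rs j ≡ just row → nth row c ≢ just v) → FoundRow c v k rs nothing

findRow? : ∀ c v k rs → FoundRow c v k rs (findRow c v k rs)
findRow? c v k [] = absent λ j row ()
findRow? c v k (row ∷ rs) with eqM (nth row c) v in eq
... | true = subst (λ z → FoundRow c v k (row ∷ rs) (just (suc z))) (+-identityʳ k) (found 0 refl (eqM-true (nth row c) eq))
... | false with findRow c v (suc k) rs | findRow? c v (suc k) rs
...   | _ | found j e e' = subst (λ z → FoundRow c v k (row ∷ rs) (just (suc z))) (+-suc k j) (found (suc j) e e')
...   | _ | absent none = absent λ { zero _ refl e → case trans (sym (eqM-refl e)) eq of λ () ; (suc j) → none j }

data Located {n} (T : Filling n) (v c : ℕ) : Maybe ℕ → Set where
  found  : ∀ r → entry T r c ≡ just v → Located T v c (just r)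
  absent : (∀ r → entry T r c ≢ just v) → Located T v c nothing

rowWith? : ∀ {n} (T : Filling n) v c → Located T v (suc c) (rowWith T v (suc c))
rowWith? T v c with findRow c v 0 (toList T) | findRow? c v 0 (toList T)
... | _ | found j e e' = found (suc j) (trans (cong (entryRow j (suc c)) e) e')
... | _ | absent none = absent missing
  where
  missing : ∀ r → entry T r (suc c) ≢ just v
  missing (suc r) eq with nth (toList T) r in e
  ... | just row = none r row e eq

rowWith-just : ∀ {n} {T : Filling n} {r} v c → Distinct (entry T) → entry T r (suc c) ≡ just v → rowWith T v (suc c) ≡ just r
rowWith-just {T = T} {r} v c dist eq with rowWith T v (suc c) | rowWith? T v c
... | _ | found r' e = cong just (dist r' r (suc c) v e eq)
... | _ | absent none = ⊥-elim (none r eq)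

rowWith-nothing : ∀ {n} {T : Filling n} v c → (∀ r → entry T r (suc c) ≢ just v) → rowWith T v (suc c) ≡ nothing
rowWith-nothing {T = T} v c none with rowWith T v (suc c) | rowWith? T v c
... | _ | found r' e = ⊥-elim (none r' e)
... | _ | absent _ = refl

between : ℕ → ℕ → ℕ → Bool
between lo hi d = if lo <ᵇ d then d <ᵇ hi else false

data Between? (lo hi d : ℕ) : Bool → Set where
  inside  : lo < d → d < hi → Between? lo hi d true
  outside : ¬ (lo < d × d < hi) → Between? lo hi d false

between? : ∀ lo hi d → Between? lo hi d (between lo hi d)
between? lo hi d with lo <ᵇ d in e
... | false = outside λ { (l , _) → <⇒≱ l (<ᵇ-false⁻¹ e) }
... | true with d <ᵇ hi in e'
...   | true = inside (<ᵇ-true⁻¹ e) (<ᵇ-true⁻¹ e')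
...   | false = outside λ { (_ , l) → <⇒≱ l (<ᵇ-false⁻¹ e') }

between-in : ∀ {lo hi d} → lo < d → d < hi → between lo hi d ≡ true
between-in l h rewrite <ᵇ-true l | <ᵇ-true h = refl

between-out : ∀ {lo hi d} → ¬ (lo < d × d < hi) → between lo hi d ≡ false
between-out {lo} {hi} {d} n with between lo hi d | between? lo hi d
... | _ | inside l h = ⊥-elim (n (l , h))
... | _ | outside _ = refl

between-≤ : ∀ lo hi {d} → d ≤ lo → between lo hi d ≡ false
between-≤ lo hi le = between-out {lo} {hi} λ { (l , _) → <⇒≱ l le }

between-≥ : ∀ lo hi {d} → hi ≤ d → between lo hi d ≡ false
between-≥ lo hi le = between-out {lo} {hi} λ { (_ , l) → <⇒≱ l le }

between-empty : ∀ {lo d} → between lo (suc lo) d ≡ false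
between-empty {lo} {d} = between-out {lo} {suc lo} {d} λ { (l , h) → <⇒≱ l (≤-pred h) }

-- The open intervals from `lo` to `m + 1` and from `m` to `hi` contain no common integer and
-- together fill the one from `lo` to `hi`.
between-join : ∀ i {lo m hi} d x → lo ≤ m → suc m ≤ hi →
  act i (between m hi d) (act i (between lo (suc m) d) x) ≡ act i (between lo hi d) x
between-join i {lo} {m} {hi} d x lo≤m m<hi with ≤-<-connex d m
... | inj₁ d≤m rewrite between-≤ m hi d≤m = cong (λ b → act i (if lo <ᵇ d then b else false) x)
        (trans (<ᵇ-true (s≤s d≤m)) (sym (<ᵇ-true (<-≤-trans (s≤s d≤m) m<hi))))
... | inj₂ m<d rewrite between-≥ lo (suc m) m<d | <ᵇ-true m<d | <ᵇ-true (≤-<-trans lo≤m m<d) = refl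

act-comm : ∀ i b b' x → act i b (act i b' x) ≡ act i b' (act i b x)
act-comm i false b' x = refl
act-comm i true false x = refl
act-comm i true true x = refl

module _ {n : ℕ} (i : ℕ) {lo m hi : ℕ} (lo≤m : lo ≤ m) (m<hi : suc m ≤ hi) {T U V : Filling n} where

  flipped-join : Flipped i (between lo (suc m)) T U → Flipped i (between m hi) U V → Flipped i (between lo hi) T V
  flipped-join h h' = flipped go
    where
    go : ∀ r d → entry V r d ≡ M.map (act i (between lo hi d)) (entry T r d)
    go r d rewrite flips h' r d | flips h r d with entry T r d
    ... | just x = cong just (between-join i d x lo≤m m<hi)
    ... | nothing = refl

  flipped-join' : Flipped i (between m hi) T U → Flipped i (between lo (suc m)) U V → Flipped i (between lo hi) T V
  flipped-join' h h' = flipped go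
    where
    go : ∀ r d → entry V r d ≡ M.map (act i (between lo hi d)) (entry T r d)
    go r d rewrite flips h' r d | flips h r d with entry T r d
    ... | just x = cong just (trans (act-comm i (between lo (suc m) d) (between m hi d) x) (between-join i d x lo≤m m<hi))
    ... | nothing = refl

flipped-none : ∀ {n i} {G : ℕ → Bool} {T : Filling n} → (∀ d → G d ≡ false) → Flipped i G T T
flipped-none {i = i} {G} {T} none = flipped go
  where
  go : ∀ r d → entry T r d ≡ M.map (act i (G d)) (entry T r d)
  go r d rewrite none d with entry T r d
  ... | just x = refl
  ... | nothing = refl

flipped-at : ∀ {n i} {G : ℕ → Bool} {T U : Filling n} → Flipped i G T U → ∀ r d → G d ≡ false → entry U r d ≡ entry T r d
flipped-at {T = T} h r d g rewrite flips h r d | g with entry T r d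
... | just x = refl
... | nothing = refl

setCell-same : ∀ {n} (U : Filling n) r c v {x} → entry U r (suc c) ≡ just x → entry (setCell U r (suc c) v) r (suc c) ≡ just v
setCell-same U (suc r) c v eq rewrite nth-updV r (updL c v) U with nth (toList U) r
... | just row = nth-updL c v row eq

setCell-other : ∀ {n} (U : Filling n) r c v p d → p ≢ r ⊎ d ≢ suc c → entry (setCell U r (suc c) v) p d ≡ entry U p d
setCell-other U zero c v p d ne = refl
setCell-other U (suc r) c v zero d ne = refl
setCell-other U (suc r) c v (suc p) d ne with p ≟ r
... | no p≢r rewrite nth-updV-other r p (updL c v) U p≢r = refl
setCell-other U (suc r) c v (suc p) zero ne | yes refl rewrite nth-updV p (updL c v) U with nth (toList U) p
... | just row = refl
... | nothing = refl
setCell-other U (suc r) c v (suc p) (suc d) ne | yes refl rewrite nth-updV p (updL c v) U with nth (toList U) p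
... | just row = nth-updL-other c d v row λ e → [ (λ x → x refl) , (λ x → x (cong suc e)) ]′ ne
... | nothing = refl

map-act-other : ∀ {i b m} → (∀ x → m ≡ just x → ¬ Dot i x) → M.map (act i b) m ≡ m
map-act-other {b = b} {just x} h = cong just (act-other b (h x refl))
map-act-other {m = nothing} h = refl

column-in : ∀ c → between c (suc (suc c)) (suc c) ≡ true
column-in c = between-in {c} {suc (suc c)} {suc c} ≤-refl ≤-refl

column-out : ∀ {c d} → d ≢ suc c → between c (suc (suc c)) d ≡ false
column-out {c} {d} ne = between-out {c} {suc (suc c)} {d} λ { (l , h) → ne (≤-antisym (≤-pred h) l) }

set-flipped : ∀ {n} i (U : Filling n) r c → entry U r (suc c) ≡ just (suc i) →
  (∀ p x → entry U p (suc c) ≡ just x → Dot i x → p ≡ r) → Flipped i (between c (suc (suc c))) U (setCell U r (suc c) i)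
set-flipped i U r c eq only = flipped go
  where
  go : ∀ p d → entry (setCell U r (suc c) i) p d ≡ M.map (act i (between c (suc (suc c)) d)) (entry U p d)
  go p d with d ≟ suc c
  ... | no ne rewrite column-out ne = trans (setCell-other U r c i p d (inj₂ ne)) (flips (flipped-none {i = i} {λ _ → false} {U} (λ _ → refl)) p d)
  ... | yes refl with p ≟ r
  ...   | yes refl rewrite setCell-same U p c i eq | eq | column-in c = cong just (sym (act-high i))
  ...   | no ne = trans (setCell-other U r c i p (suc c) (inj₁ ne)) (sym (map-act-other {i} {between c (suc (suc c)) (suc c)} λ x e dx → ne (only p x e dx)))

swap-flipped : ∀ {n} i (U : Filling n) r r' c → r ≢ r' → entry U r (suc c) ≡ just (suc i) → entry U r' (suc c) ≡ just i →
  (∀ p x → entry U p (suc c) ≡ just x → Dot i x → p ≡ r ⊎ p ≡ r') →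
  Flipped i (between c (suc (suc c))) U (swapAt U i r r' (suc c))
swap-flipped i U r r' c r≢r' eq eq' only = flipped go
  where
  go : ∀ p d → entry (swapAt U i r r' (suc c)) p d ≡ M.map (act i (between c (suc (suc c)) d)) (entry U p d)
  go p d with d ≟ suc c
  ... | no ne rewrite column-out ne = trans (setCell-other (setCell U r (suc c) i) r' c (suc i) p d (inj₂ ne))
        (trans (setCell-other U r c i p d (inj₂ ne)) (flips (flipped-none {i = i} {λ _ → false} {U} (λ _ → refl)) p d))
  ... | yes refl with p ≟ r | p ≟ r'
  ...   | yes refl | yes refl = ⊥-elim (r≢r' refl)
  ...   | yes refl | no ne rewrite setCell-other (setCell U p (suc c) i) r' c (suc i) p (suc c) (inj₁ ne) | setCell-same U p c i eq | eq | column-in c = cong just (sym (act-high i))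
  ...   | no ne | yes refl rewrite setCell-same (setCell U r (suc c) i) p c (suc i) (trans (setCell-other U r c i p (suc c) (inj₁ ne)) eq') | eq' | column-in c = cong just (sym (act-low i))
  ...   | no ne | no ne' = trans (setCell-other (setCell U r (suc c) i) r' c (suc i) p (suc c) (inj₁ ne')) (trans (setCell-other U r c i p (suc c) (inj₁ ne))
        (sym (map-act-other {i} {between c (suc (suc c)) (suc c)} λ x e dx → [ ne , ne' ]′ (only p x e dx))))

-- The raising operator as a flip of an interval of columns

module Loops {n : ℕ} (i : ℕ) (T : Filling n) (dist : Distinct (entry T)) (r : ℕ) where

  LinkL LinkR : ℕ → Set
  LinkL d = entry T r d ≡ just (suc i) × ∃ λ p → entry T p d ≡ just i × r < p
  LinkR d = entry T r d ≡ just (suc i) × ∃ λ p → entry T p d ≡ just i × p < r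

  swap-link : ∀ (U : Filling n) c {r'} → r ≢ r' → (∀ p → entry U p (suc c) ≡ entry T p (suc c)) → entry T r (suc c) ≡ just (suc i) →
    entry T r' (suc c) ≡ just i → Flipped i (between c (suc (suc c))) U (swapAt U i r r' (suc c))
  swap-link U c {r'} ne agree e e' = swap-flipped i U r r' c ne (trans (agree r) e) (trans (agree r') e')
    λ { p x ex (inj₁ refl) → inj₂ (dist p r' (suc c) x (trans (sym (agree p)) ex) e')
      ; p x ex (inj₂ refl) → inj₁ (dist p r (suc c) x (trans (sym (agree p)) ex) e) }

  -- The loop tests `T` and writes into `U`. The last hypothesis says that the columns still to be
  -- visited are untouched, so each swap acts on the letters that were tested. At column 0 the loop
  -- ends without a test, whence `lo ≡ 0`.
  goL-flips : ∀ lo c U → lo ≤ c → (∀ d → lo < d → d ≤ c → LinkL d) → lo ≡ 0 ⊎ ¬ LinkL lo →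
    (∀ p d → d ≤ c → entry U p d ≡ entry T p d) → Flipped i (between lo (suc c)) U (goL i T r c U)
  goL-flips .0 zero U z≤n links stop agree = flipped-none λ d → between-empty {0} {d}
  goL-flips lo (suc c) U lo≤ links stop agree with lo ≟ suc c
  ... | no ne with links (suc c) (≤∧≢⇒< lo≤ ne) ≤-refl
  ...   | e , r' , e' , r<r' rewrite eqM-refl {entry T r (suc c)} e | rowWith-just {T = T} {r'} i c dist e' | <ᵇ-true r<r' =
    flipped-join' i lo≤c (n≤1+n (suc c)) {U} {swapAt U i r r' (suc c)} flip₁
      (goL-flips lo c (swapAt U i r r' (suc c)) lo≤c (λ d l h → links d l (m≤n⇒m≤1+n h)) stop
        λ p d h → trans (flipped-at flip₁ p d (between-≤ c (suc (suc c)) h)) (agree p d (m≤n⇒m≤1+n h)))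
    where
    lo≤c : lo ≤ c
    lo≤c = ≤∧≢⇒≤pred lo≤ ne
    flip₁ : Flipped i (between c (suc (suc c))) U (swapAt U i r r' (suc c))
    flip₁ = swap-link U c (λ z → <-irrefl z r<r') (λ p → agree p (suc c) ≤-refl) e e'
  goL-flips lo (suc c) U lo≤ links (inj₂ stop) agree | yes refl
    with eqM (entry T r (suc c)) (suc i) in e | rowWith T i (suc c) | rowWith? T i c
  ... | false | _ | _ = flipped-none λ d → between-empty {suc c} {d}
  ... | true | _ | absent _ = flipped-none λ d → between-empty {suc c} {d}
  ... | true | _ | found r' e' with r <ᵇ r' in lt
  ...   | true = ⊥-elim (stop (eqM-true (entry T r (suc c)) e , r' , e' , <ᵇ-true⁻¹ lt))
  ...   | false = flipped-none λ d → between-empty {suc c} {d}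

  -- The bound `hi ≤ suc c + f` says that the fuel lasts until the end of the interval; if it is
  -- used up exactly there, the final test is skipped with the same result.
  goR-flips : ∀ f c hi U → suc c ≤ hi → hi ≤ suc c + f → (∀ d → c < d → d < hi → LinkR d) → ¬ LinkR hi →
    (∀ p d → c < d → entry U p d ≡ entry T p d) → Flipped i (between c hi) U (goR f i T r (suc c) U)
  goR-flips zero c hi U lo≤ hi≤ links stop agree with ≤-antisym lo≤ (subst (hi ≤_) (+-identityʳ (suc c)) hi≤)
  ... | refl = flipped-none λ d → between-empty {c} {d}
  goR-flips (suc f) c hi U lo≤ hi≤ links stop agree with suc c ≟ hi
  ... | no ne with links (suc c) ≤-refl (≤∧≢⇒< lo≤ ne)
  ...   | e , r' , e' , r'<r rewrite eqM-refl {entry T r (suc c)} e | rowWith-just {T = T} {r'} i c dist e' | <ᵇ-true r'<r =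
    flipped-join i (n≤1+n c) (≤∧≢⇒< lo≤ ne) {U} {swapAt U i r r' (suc c)} flip₁
      (goR-flips f (suc c) hi (swapAt U i r r' (suc c)) (≤∧≢⇒< lo≤ ne) (subst (hi ≤_) (+-suc (suc c) f) hi≤)
        (λ d l h → links d (<-trans ≤-refl l) h) stop
        λ p d l → trans (flipped-at flip₁ p d (between-≥ c (suc (suc c)) l)) (agree p d (<-trans ≤-refl l)))
    where
    flip₁ : Flipped i (between c (suc (suc c))) U (swapAt U i r r' (suc c))
    flip₁ = swap-link U c (λ z → <-irrefl (sym z) r'<r) (λ p → agree p (suc c) ≤-refl) e e'
  goR-flips (suc f) c hi U lo≤ hi≤ links stop agree | yes refl
    with eqM (entry T r (suc c)) (suc i) in e | rowWith T i (suc c) | rowWith? T i c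
  ... | false | _ | _ = flipped-none λ d → between-empty {c} {d}
  ... | true | _ | absent _ = flipped-none λ d → between-empty {c} {d}
  ... | true | _ | found r' e' with r' <ᵇ r in lt
  ...   | true = ⊥-elim (stop (eqM-true (entry T r (suc c)) e , r' , e' , <ᵇ-true⁻¹ lt))
  ...   | false = flipped-none λ d → between-empty {c} {d}

  raiseAt-flips : ∀ lo c hi → lo ≤ c → suc (suc c) ≤ hi → hi ≤ suc (suc c) + width T →
    entry T r (suc c) ≡ just (suc i) → (∀ p → entry T p (suc c) ≢ just i) →
    (∀ d → lo < d → d ≤ c → LinkL d) → lo ≡ 0 ⊎ ¬ LinkL lo → (∀ d → suc c < d → d < hi → LinkR d) → ¬ LinkR hi →
    Flipped i (between lo hi) T (raiseAt i T (suc c , r))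
  raiseAt-flips lo c hi lo≤ ≤hi hi≤ e none linksL stopL linksR stopR =
    flipped-join i (m≤n⇒m≤1+n lo≤) ≤hi {T} {U₂} flip₂
      (goR-flips (width T) (suc c) hi U₂ ≤hi hi≤ linksR stopR λ p d l → flipped-at flip₂ p d (between-≥ lo (suc (suc c)) l))
    where
    U₁ U₂ : Filling n
    U₁ = setCell T r (suc c) i
    U₂ = goL i T r c U₁
    flip₁ : Flipped i (between c (suc (suc c))) T U₁
    flip₁ = set-flipped i T r c e λ { p x ex (inj₁ refl) → ⊥-elim (none p ex) ; p x ex (inj₂ refl) → dist p r (suc c) x ex e }
    flip₂ : Flipped i (between lo (suc (suc c))) T U₂
    flip₂ = flipped-join' i lo≤ (n≤1+n (suc c)) {T} {U₁} flip₁
      (goL-flips lo c U₁ lo≤ linksL stopL λ p d h → flipped-at flip₁ p d (between-≤ c (suc (suc c)) h))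

width-bound : ∀ {n} (a : Vec ℕ n) (T : Filling n) → Shape a T → ∀ r → rowLen a r ≤ width T
width-bound a T sh zero = z≤n
width-bound a T sh (suc r) rewrite shape-nth a T sh r = go (toList T) r
  where
  go : ∀ rs r → M.fromMaybe 0 (M.map length (nth rs r)) ≤ foldr _+_ 0 (map length rs)
  go [] r = z≤n
  go (row ∷ rs) zero = m≤m+n (length row) _
  go (row ∷ rs) (suc r) = ≤-trans (go rs r) (m≤n+m _ (length row))

-- The cells of a filling as a dot system

-- The first value below `i + 1` is `i`, so a row at `i + 1` that must not jump over `i` can only
-- stay. `arc-gap-high` is the same at the end of a jump.
arc-gap-low : ∀ {i x} → ¬ Arc (suc i) i x → x ≡ suc i
arc-gap-low {i} {x} n with <-cmp x (suc i)
... | tri< lt _ _ = ⊥-elim (n (inj₁ (≤-pred lt , n≤1+n i)))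
... | tri≈ _ e _ = e
... | tri> _ _ gt = ⊥-elim (n (inj₂ (inj₁ (n≤1+n i , gt))))

arc-gap-high : ∀ {i y} → ¬ Arc y (suc i) i → y ≡ i
arc-gap-high {i} {y} n with <-cmp y i
... | tri< lt _ _ = ⊥-elim (n (inj₂ (inj₂ (lt , n≤1+n i))))
... | tri≈ _ e _ = e
... | tri> _ _ gt = ⊥-elim (n (inj₁ (n≤1+n i , gt)))

record Leftmost (P C : ℕ → Set) (c : ℕ) : Set where
  field
    lo      : ℕ
    lo≤c₀   : lo ≤ c
    chain-l : ∀ d → lo < d → d ≤ suc c → C d
    links-l : ∀ d → lo < d → d ≤ c → P d
    stop-l  : lo ≡ 0 ⊎ ¬ P lo

leftmost : ∀ {P C} → (∀ d → Dec (P d)) → ∀ c → C (suc c) → (∀ d → d ≤ c → C (suc d) → P d → C d) → Leftmost P C c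
leftmost {C = C} P? zero c∈ grow = record
  { lo = 0 ; lo≤c₀ = z≤n ; chain-l = λ d l h → subst C (≤-antisym l h) c∈
  ; links-l = λ d l h → ⊥-elim (<⇒≱ l h) ; stop-l = inj₁ refl }
leftmost {P} {C} P? (suc c) c∈ grow with P? (suc c)
... | no np = record
  { lo = suc c ; lo≤c₀ = ≤-refl ; chain-l = λ d l h → subst C (≤-antisym l h) c∈
  ; links-l = λ d l h → ⊥-elim (<⇒≱ l h) ; stop-l = inj₂ np }
... | yes p = record
  { lo = lo ; lo≤c₀ = m≤n⇒m≤1+n lo≤c₀ ; chain-l = last C chain-l c∈ ; links-l = last P links-l p ; stop-l = stop-l }
  where
  open Leftmost (leftmost {P} {C} P? c (grow (suc c) ≤-refl c∈ p) (λ d le → grow d (m≤n⇒m≤1+n le)))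
  last : ∀ (Q : ℕ → Set) {m} → (∀ d → lo < d → d ≤ m → Q d) → Q (suc m) → ∀ d → lo < d → d ≤ suc m → Q d
  last Q {m} h q d l u with d ≟ suc m
  ... | yes refl = q
  ... | no ne = h d l (≤∧≢⇒≤pred u ne)

record Rightmost (P C : ℕ → Set) (c b : ℕ) : Set where
  field
    hi      : ℕ
    c<hi    : suc c ≤ hi
    hi≤     : hi ≤ suc b
    chain-r : ∀ d → c ≤ d → d < hi → C d
    links-r : ∀ d → c < d → d < hi → P d
    stop-r  : ¬ P hi

rightmost : ∀ {P C} → (∀ d → Dec (P d)) → ∀ j c → C c → (∀ d → d < c + j → C d → P (suc d) → C (suc d)) → ¬ P (suc (c + j)) →
  Rightmost P C c (c + j)
rightmost {P} {C} P? j c c∈ grow stop with P? (suc c)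
... | no np = record
  { hi = suc c ; c<hi = ≤-refl ; hi≤ = s≤s (m≤m+n c j) ; chain-r = λ d l h → subst C (≤-antisym l (≤-pred h)) c∈
  ; links-r = λ d l h → ⊥-elim (<⇒≱ h l) ; stop-r = np }
rightmost {P} P? zero c c∈ grow stop | yes p = ⊥-elim (stop (subst (P ∘ suc) (sym (+-identityʳ c)) p))
rightmost {P} {C} P? (suc j) c c∈ grow stop | yes p rewrite +-suc c j = record
  { hi = hi ; c<hi = <⇒≤ c<hi ; hi≤ = hi≤ ; chain-r = first C chain-r c∈ ; links-r = first P links-r p ; stop-r = stop-r }
  where
  open Rightmost (rightmost {P} {C} P? j (suc c) (grow c (s≤s (m≤m+n c j)) c∈ p) grow stop)
  first : ∀ (Q : ℕ → Set) {m} → (∀ d → suc m ≤ d → d < hi → Q d) → Q m → ∀ d → m ≤ d → d < hi → Q d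
  first Q {m} h q d l u with m ≟ d
  ... | yes refl = q
  ... | no ne = h d (≤∧≢⇒< l ne) u

module Strings {n : ℕ} (a : Vec ℕ n) (T : Filling n) (sk : SSKD a T) (i : ℕ) (va : Valid n i) where
  private
    E = entry T
    dist = sskd-distinct sk
    noPassing = sskd-noPassing sk
    nonAttacking = proj₁ (proj₂ (proj₂ sk))
  open Cells a T (proj₁ sk)
  N : ℕ
  N = width T

  col-bound : ∀ {r c k} → E r c ≡ just k → c ≤ N
  col-bound {r} e = ≤-trans (entry-len {r} e) (width-bound a T (proj₁ sk) r)

  -- Columns run from the basement to `N + 1`, where column `N + 1` is empty; so every column with a
  -- cell has a successor, and a chain has a column in which to stop.
  Next : ℕ → ℕ → Set
  Next c d = d ≡ suc c × c ≤ N

  letter-in : ∀ v c → 1 ≤ v → v ≤ n → (∃ λ p → E p c ≡ just v) ⊎ (∀ p → E p c ≢ just v)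
  letter-in v zero 1≤v v≤n = inj₁ (v , basement 1≤v v≤n)
  letter-in v (suc c) _ _ with rowWith T v (suc c) | rowWith? T v c
  ... | _ | found r e = inj₁ (r , e)
  ... | _ | absent none = inj₂ none

  rank : Rank (RankOf a)
  rank = rankOf a

  longer : ∀ {p q} → RankOf a p q → q < p → rowLen a p < rowLen a q
  longer (inj₁ (_ , lt)) _ = lt
  longer (inj₂ (p<q , _)) q<p = ⊥-elim (<-asym p<q q<p)

  next-cell : ∀ {p c k} → E p c ≡ just k → suc c ≤ rowLen a p → ∃ λ x → E p (suc c) ≡ just x
  next-cell {p} e le = cell {p} (proj₁ (entry-row {p} e)) (proj₂ (entry-row {p} e)) le

  -- The lower row `q` moves first. If `p` outranks it, then `p` must not jump over the new `i` and
  -- stays at `i + 1`. If `q` outranks `p`, it must not jump over the waiting `i + 1`, so it was at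
  -- `i` already.
  cross : ∀ {p q c d} → Next c d → E p c ≡ just (suc i) → E q d ≡ just i → q < p →
    (E p d ≡ just (suc i) × RankOf a q p) ⊎ (E q c ≡ just i × RankOf a p q)
  cross {p} {q} {c} (refl , _) d₁ d₀ q<p with Rank.cmp rank (λ e → <-irrefl e q<p)
  ... | inj₁ q≺p with next-cell {p} d₁ (≤-trans (entry-len {q} d₀) (rank-len a q≺p))
  ...   | x , ex with arc-gap-low (proj₂ (noPassing p c q (suc i) x i q≺p d₁ ex) q<p d₀)
  ...     | refl = inj₁ (ex , q≺p)
  cross {p} {q} {c} (refl , _) d₁ d₀ q<p | inj₂ p≺q with cell {q} {c} (proj₁ (entry-row {q} d₀)) (proj₂ (entry-row {q} d₀)) (<⇒≤ (entry-len {q} d₀))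
  ...   | y , ey with arc-gap-high (proj₁ (noPassing q c p y i (suc i) p≺q ey d₀) q<p d₁)
  ...     | refl = inj₂ (ey , p≺q)

  copyˡ : ∀ {p q b c} → Next b c → E p c ≡ just (suc i) → E q c ≡ just i → p < q → RankOf a p q → E q b ≡ just i
  copyˡ {p} {q} {b} (refl , _) d₁ d₀ p<q p≺q with cell {q} {b} (proj₁ (entry-row {q} d₀)) (proj₂ (entry-row {q} d₀)) (<⇒≤ (entry-len {q} d₀))
  ... | y , ey with arc-gap-high (proj₂ (noPassing q b p y i (suc i) p≺q ey d₀) p<q d₁)
  ...   | refl = ey

  copyʳ : ∀ {p q c d} → Next c d → E p c ≡ just (suc i) → E q c ≡ just i → p < q → RankOf a q p → E p d ≡ just (suc i)
  copyʳ {p} {q} {c} (refl , _) d₁ d₀ p<q q≺p with next-cell {p} d₁ (≤-<-trans (entry-len {q} d₀) (longer q≺p p<q))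
  ... | x , ex with arc-gap-low (proj₁ (noPassing p c q (suc i) x i q≺p d₁ ex) p<q d₀)
  ...   | refl = ex

  -- The basement is not inverted: row `i` holds `i`, and `i + 1` is in the row above.
  previous : ∀ {p q c} → E p c ≡ just (suc i) → E q c ≡ just i → p < q → ∃ λ b → Next b c
  previous {p} {q} {zero} d₁ d₀ p<q with basement⁻¹ {p} d₁ | basement⁻¹ {q} d₀
  ... | refl | refl = ⊥-elim (<-asym p<q ≤-refl)
  previous {p} {c = suc b} d₁ _ _ = b , refl , <⇒≤ (col-bound {p} d₁)

  accˡ : ∀ c → Acc Next c
  accˡ zero = acc λ { (() , _) }
  accˡ (suc c) = acc λ { (refl , _) → accˡ c }

  accʳ : ∀ j c → N < c + j → Acc (λ d c → Next c d) c
  accʳ zero c lt = acc λ { (refl , le) → ⊥-elim (<⇒≱ lt (subst (_≤ N) (sym (+-identityʳ c)) le)) }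
  accʳ (suc j) c lt = acc λ { (refl , _) → accʳ j (suc c) (subst (N <_) (+-suc c j) lt) }

  dotSystem : Dots
  dotSystem = record
    { _⊏_ = _<_ ; _≺_ = RankOf a ; Next = Next
    ; D₀ = λ p c → E p c ≡ just i ; D₁ = λ p c → E p c ≡ just (suc i)
    ; ⊏-irrefl = <-irrefl refl ; ⊏-trans = <-trans ; ⊏-cmp = compare
    ; ≺-asym = Rank.asym rank ; ≺-cmp = Rank.cmp rank
    ; D₀? = λ c → letter-in i c (proj₁ va) (<⇒≤ (proj₂ va)) ; D₁? = λ c → letter-in (suc i) c (s≤s z≤n) (proj₂ va)
    ; D₀-unique = λ x y → dist _ _ _ _ x y ; D₁-unique = λ x y → dist _ _ _ _ x y
    ; D₀≢D₁ = λ { x y refl → 1+n≢n (just-injective (trans (sym y) x)) }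
    ; clash₀ = λ { (refl , _) x y q<p → nonAttacking _ _ _ _ _ _ x y (inj₂ (inj₁ (refl , q<p))) refl }
    ; clash₁ = λ { (refl , _) x y q<p → nonAttacking _ _ _ _ _ _ x y (inj₂ (inj₁ (refl , q<p))) refl }
    ; cross = cross ; copyˡ = copyˡ ; copyʳ = copyʳ
    ; previous = previous ; following = λ {p} x _ _ → _ , refl , col-bound {p} x
    ; accˡ = accˡ ; accʳ = λ c → accʳ (suc N) c (m≤n+m (suc N) c) }
    where
    compare : ∀ p q → p < q ⊎ (p ≡ q ⊎ q < p)
    compare p q with <-cmp p q
    ... | tri< lt _ _ = inj₁ lt
    ... | tri≈ _ e _ = inj₂ (inj₁ e)
    ... | tri> _ _ gt = inj₂ (inj₂ gt)

  -- The columns strictly between lo and hi, in which the letters i and i + 1 may be exchanged: all but the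
  -- column c contain both letters, and all contain ℓ in row r.
  record Segment (r c ℓ ℓ̄ : ℕ) : Set where
    field
      lo hi   : ℕ
      lo<c    : lo < c
      c<hi    : c < hi
      ℓ-dot   : Dot i ℓ
      ℓ̄-dot   : Dot i ℓ̄
      ℓ≢ℓ̄     : ℓ ≢ ℓ̄
      ℓ-in    : ∀ d → lo < d → d < hi → E r d ≡ just ℓ
      ℓ̄-out   : ∀ p → E p c ≢ just ℓ̄
      ℓ̄-left  : ∀ d → lo < d → d < c → ∃ λ p → E p d ≡ just ℓ̄ × r < p × RankOf a p r
      ℓ̄-right : ∀ d → c < d → d < hi → ∃ λ p → E p d ≡ just ℓ̄ × p < r × RankOf a p r
      lo-stop : ∀ p x → E p lo ≡ just x → Dot i x → p ≤ r
      hi-stop : ∀ p x → E p hi ≡ just x → Dot i x → r ≤ p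
      lo-link : E r lo ≡ just i → ℓ ≢ i
      hi-link : E r hi ≡ just (suc i) → ℓ ≢ suc i

  module Zone {r c ℓ ℓ̄ : ℕ} (seg : Segment r c ℓ ℓ̄) where
    open Segment seg

    G : ℕ → Bool
    G = between lo hi

    in-zone : ∀ {d} → G d ≡ true → lo < d × d < hi
    in-zone {d} eq with between lo hi d | between? lo hi d
    ... | _ | inside l h = l , h

    other-dot : ∀ {d p x} → lo < d → d < hi → E p d ≡ just x → Dot i x → p ≢ r →
      (d < c × r < p × RankOf a p r) ⊎ (c < d × p < r × RankOf a p r)
    other-dot {d} {p} {x} l h e dx p≢r with dots-other ℓ-dot ℓ̄-dot dx ℓ≢ℓ̄ (λ { refl → p≢r (dist p r d _ e (ℓ-in d l h)) })
    ... | refl with <-cmp d c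
    ...   | tri≈ _ refl _ = ⊥-elim (ℓ̄-out p e)
    ...   | tri< d<c _ _ with ℓ̄-left d l d<c
    ...     | p' , e' , lt , rk with dist p p' d _ e e'
    ...       | refl = inj₁ (d<c , lt , rk)
    other-dot {d} {p} l h e dx p≢r | refl | tri> _ _ c<d with ℓ̄-right d c<d h
    ...     | p' , e' , lt , rk with dist p p' d _ e e'
    ...       | refl = inj₂ (c<d , lt , rk)

    start-of : ∀ {d} → G d ≡ false → G (suc d) ≡ true → d ≡ lo
    start-of {d} out inn with in-zone inn | between lo hi d | between? lo hi d
    ... | l , h | _ | outside n with d ≟ lo
    ...   | yes e = e
    ...   | no ne = ⊥-elim (n (≤∧≢⇒< (≤-pred l) (ne ∘ sym) , <-trans ≤-refl h))

    end-of : ∀ {d} → G d ≡ true → G (suc d) ≡ false → suc d ≡ hi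
    end-of {d} inn out with in-zone inn | between lo hi (suc d) | between? lo hi (suc d)
    ... | l , h | _ | outside n with suc d ≟ hi
    ...   | yes e = e
    ...   | no ne = ⊥-elim (n (<-trans l ≤-refl , ≤∧≢⇒< h ne))

    zone : FlipZone i (RankOf a) E G r
    zone = record
      { ℓ = ℓ ; ℓ-dot = ℓ-dot
      ; ℓ-row = λ d g → ℓ-in d (proj₁ (in-zone g)) (proj₂ (in-zone g))
      ; others = λ d p x g e dx ne → [ proj₂ ∘ proj₂ , proj₂ ∘ proj₂ ]′ (other-dot (proj₁ (in-zone g)) (proj₂ (in-zone g)) e dx ne)
      ; before-≤ = before ; first-≥ = first ; entering = entering
      ; after-≥ = after ; last-≤ = final ; leaving = leaving }
      where
      before : ∀ d p x → G d ≡ false → G (suc d) ≡ true → E p d ≡ just x → Dot i x → p ≤ r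
      before d p x out inn e dx with start-of out inn
      ... | refl = lo-stop p x e dx
      first : ∀ d p x → G d ≡ false → G (suc d) ≡ true → E p (suc d) ≡ just x → Dot i x → r ≤ p
      first d p x out inn e dx with start-of out inn | p ≟ r
      ... | refl | yes refl = ≤-refl
      ... | refl | no ne with other-dot ≤-refl (≤-<-trans lo<c c<hi) e dx ne
      ...   | inj₁ (_ , lt , _) = <⇒≤ lt
      ...   | inj₂ (c<d , _) = ⊥-elim (<⇒≱ c<d lo<c)
      entering : ∀ d → G d ≡ false → G (suc d) ≡ true → E r d ≡ just i → E r (suc d) ≢ just i
      entering d out inn e e' with start-of out inn
      ... | refl = lo-link e (just-injective (trans (sym (ℓ-in _ (proj₁ (in-zone inn)) (proj₂ (in-zone inn)))) e'))
      after : ∀ d p x → G d ≡ true → G (suc d) ≡ false → E p (suc d) ≡ just x → Dot i x → r ≤ p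
      after d p x inn out e dx with end-of inn out
      ... | refl = hi-stop p x e dx
      final : ∀ d p x → G d ≡ true → G (suc d) ≡ false → E p d ≡ just x → Dot i x → p ≤ r
      final d p x inn out e dx with end-of inn out | p ≟ r
      ... | refl | yes refl = ≤-refl
      ... | refl | no ne with other-dot (≤-trans lo<c (≤-pred c<hi)) ≤-refl e dx ne
      ...   | inj₁ (d<c , _) = ⊥-elim (<⇒≱ d<c (≤-pred c<hi))
      ...   | inj₂ (_ , lt , _) = <⇒≤ lt
      leaving : ∀ d → G d ≡ true → G (suc d) ≡ false → E r d ≡ just (suc i) → E r (suc d) ≢ just (suc i)
      leaving d inn out e e' with end-of inn out
      ... | refl = hi-link e' (just-injective (trans (sym (ℓ-in _ (proj₁ (in-zone inn)) (proj₂ (in-zone inn)))) e))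

    zone-sskd : ∀ {U} → Flipped i G T U → SSKD a U
    zone-sskd h = flipped-sskd {i = i} {G} {r} va (between-≤ lo hi z≤n) h sk zone

  no-cell-beyond : ∀ {r k} → E r (suc N) ≢ just k
  no-cell-beyond {r} e = 1+n≰n (col-bound {r} e)

  module Raising {r c₀ : ℕ} (dot : E r (suc c₀) ≡ just (suc i)) (single : ∀ p → E p (suc c₀) ≢ just i)
    (¬left : ¬ Left₀ dotSystem (suc c₀)) (¬right : ¬ Right₁ dotSystem (suc c₀)) where
    c : ℕ
    c = suc c₀
    open Chains dotSystem r c dot single ¬left ¬right
    open Loops i T dist r using (raiseAt-flips)

    c≤N : c ≤ N
    c≤N = col-bound {r} dot

    abstract
      found-lo : Leftmost LeftLink LeftChain c₀
      found-lo = leftmost leftLink? c₀ start λ d le ch → extend ch (refl , ≤-trans le (≤-trans (n≤1+n c₀) c≤N))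

      found-hi : Rightmost RightLink RightChain c N
      found-hi = subst (Rightmost RightLink RightChain c) c+[N∸c]≡N (rightmost rightLink? (N ∸ c) c start
        (λ d lt ch → extend ch (refl , <⇒≤ (subst (d <_) c+[N∸c]≡N lt)))
        λ { (e , _) → no-cell-beyond {r} (subst (λ z → E r (suc z) ≡ just (suc i)) c+[N∸c]≡N e) })
        where
        c+[N∸c]≡N : c + (N ∸ c) ≡ N
        c+[N∸c]≡N = m+[n∸m]≡n c≤N

    open Leftmost found-lo public
    open Rightmost found-hi public

    -- When the search ends at column 0, it is the order of the basement that rules out a link
    -- there.
    ¬link-lo : ¬ LeftLink lo
    ¬link-lo (d₁ , p , d₀ , r<p) with stop-l
    ... | inj₂ stop = stop (d₁ , p , d₀ , r<p)
    ... | inj₁ lo≡0 with basement⁻¹ {r} (subst (λ z → E r z ≡ just (suc i)) lo≡0 d₁) | basement⁻¹ {p} (subst (λ z → E p z ≡ just i) lo≡0 d₀)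
    ...   | refl | refl = <-asym r<p ≤-refl

    hi-pred : ∃ λ h → hi ≡ suc h × c ≤ h
    hi-pred with hi | c<hi
    ... | suc h | s≤s le = h , refl , le

    segment : Segment r c (suc i) i
    segment = record
      { lo = lo ; hi = hi ; lo<c = s≤s lo≤c₀ ; c<hi = c<hi
      ; ℓ-dot = inj₂ refl ; ℓ̄-dot = inj₁ refl ; ℓ≢ℓ̄ = 1+n≢n
      ; ℓ-in = ℓ-in ; ℓ̄-out = single
      ; ℓ̄-left = left ; ℓ̄-right = right
      ; lo-stop = λ p x e dx → ≮⇒≥ (left-stop (chain-l (suc lo) ≤-refl (s≤s lo≤c₀)) (refl , ≤-trans lo≤c₀ (≤-trans (n≤1+n c₀) c≤N)) ¬link-lo p (letter-of p lo e dx))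
      ; hi-stop = λ p x e dx → ≮⇒≥ (stop-hi p (letter-of p hi e dx))
      ; lo-link = λ _ → 1+n≢n
      ; hi-link = λ e _ → end-hi e }
      where
      letter-of : ∀ p d {x} → E p d ≡ just x → Dot i x → E p d ≡ just i ⊎ E p d ≡ just (suc i)
      letter-of p d e (inj₁ refl) = inj₁ e
      letter-of p d e (inj₂ refl) = inj₂ e
      ℓ-in : ∀ d → lo < d → d < hi → E r d ≡ just (suc i)
      ℓ-in d l u with ≤-total d c
      ... | inj₁ le = left-D₁ (chain-l d l le)
      ... | inj₂ ge = right-D₁ (chain-r d ge u)
      left : ∀ d → lo < d → d < c → ∃ λ p → E p d ≡ just i × r < p × RankOf a p r
      left d l u with links-l d l (≤-pred u)
      ... | _ , p , d₀ , r<p = p , d₀ , left-other (chain-l d l (<⇒≤ u)) d₀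
      right : ∀ d → c < d → d < hi → ∃ λ p → E p d ≡ just i × p < r × RankOf a p r
      right d l u with links-r d l u
      ... | _ , p , d₀ , p<r = p , d₀ , right-other (chain-r d (<⇒≤ l) u) d₀
      last-chain : ∃ λ h → RightChain h × Next h hi
      last-chain with hi-pred
      ... | h , e , le = h , chain-r h le (≤-reflexive (sym e)) , e , ≤-pred (subst (_≤ suc N) e hi≤)
      stop-hi : ∀ p → E p hi ≡ just i ⊎ E p hi ≡ just (suc i) → ¬ p < r
      stop-hi p with last-chain
      ... | h , ch , nx = right-stop ch nx stop-r p
      end-hi : ¬ E r hi ≡ just (suc i)
      end-hi with last-chain
      ... | h , ch , nx = right-end ch nx stop-r

    raised-flips : Flipped i (between lo hi) T (raiseAt i T (c , r))
    raised-flips = raiseAt-flips lo c₀ hi lo≤c₀ c<hi (≤-trans hi≤ (s≤s (m≤n+m N (suc c₀)))) dot single links-l stop-l links-r stop-r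

  -- Each link to the left has `i` in row `r`. The column given by `gap` has no `i` at all and so
  -- stops the run before it reaches the basement.
  module Lowering {r c₀ : ℕ} (dot : E r (suc c₀) ≡ just i) (single : ∀ p → E p (suc c₀) ≢ just (suc i))
    (¬left : ¬ Left₀ dotSystem (suc c₀)) (¬right : ¬ Right₁ dotSystem (suc c₀))
    (gap : ∃ λ d → 0 < d × d ≤ c₀ × ∀ p → E p d ≢ just i) where
    c : ℕ
    c = suc c₀
    -- The half turn interchanges left and right: here the run to the left consists of `RightLink`
    -- columns and the run to the right of `LeftLink` columns.
    open Chains (dual dotSystem) r c dot single ¬right (¬left ∘ left₀-dual² dotSystem)

    c≤N : c ≤ N
    c≤N = col-bound {r} dot

    abstract
      found-lo : Leftmost RightLink RightChain c₀
      found-lo = leftmost rightLink? c₀ start λ d le ch → extend ch (refl , ≤-trans le (≤-trans (n≤1+n c₀) c≤N))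

      found-hi : Rightmost LeftLink LeftChain c N
      found-hi = subst (Rightmost LeftLink LeftChain c) c+[N∸c]≡N (rightmost leftLink? (N ∸ c) c start
        (λ d lt ch → extend ch (refl , <⇒≤ (subst (d <_) c+[N∸c]≡N lt)))
        λ { (e , _) → no-cell-beyond {r} (subst (λ z → E r (suc z) ≡ just i) c+[N∸c]≡N e) })
        where
        c+[N∸c]≡N : c + (N ∸ c) ≡ N
        c+[N∸c]≡N = m+[n∸m]≡n c≤N

    open Leftmost found-lo public
    open Rightmost found-hi public

    ¬link-lo : ¬ RightLink lo
    ¬link-lo link = [ (λ lo≡0 → proj₂ (proj₂ (proj₂ gap)) r (proj₁ (links-l (proj₁ gap)
      (subst (_< proj₁ gap) (sym lo≡0) (proj₁ (proj₂ gap))) (proj₁ (proj₂ (proj₂ gap)))))) , (λ stop → stop link) ]′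
      stop-l

    hi-pred : ∃ λ h → hi ≡ suc h × c ≤ h
    hi-pred with hi | c<hi
    ... | suc h | s≤s le = h , refl , le

    segment : Segment r c i (suc i)
    segment = record
      { lo = lo ; hi = hi ; lo<c = s≤s lo≤c₀ ; c<hi = c<hi
      ; ℓ-dot = inj₁ refl ; ℓ̄-dot = inj₂ refl ; ℓ≢ℓ̄ = 1+n≢n ∘ sym
      ; ℓ-in = ℓ-in ; ℓ̄-out = single
      ; ℓ̄-left = left ; ℓ̄-right = right
      ; lo-stop = λ p x e dx → ≮⇒≥ (right-stop first-chain first-next ¬link-lo p (letter-of p lo e dx))
      ; hi-stop = λ p x e dx → ≮⇒≥ (stop-hi p (letter-of p hi e dx))
      ; lo-link = λ e _ → right-end first-chain first-next ¬link-lo e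
      ; hi-link = λ _ → 1+n≢n ∘ sym }
      where
      letter-of : ∀ p d {x} → E p d ≡ just x → Dot i x → E p d ≡ just (suc i) ⊎ E p d ≡ just i
      letter-of p d e (inj₁ refl) = inj₂ e
      letter-of p d e (inj₂ refl) = inj₁ e
      first-chain : RightChain (suc lo)
      first-chain = chain-l (suc lo) ≤-refl (s≤s lo≤c₀)
      first-next : Next lo (suc lo)
      first-next = refl , ≤-trans lo≤c₀ (≤-trans (n≤1+n c₀) c≤N)
      ℓ-in : ∀ d → lo < d → d < hi → E r d ≡ just i
      ℓ-in d l u with ≤-total d c
      ... | inj₁ le = right-D₁ (chain-l d l le)
      ... | inj₂ ge = left-D₁ (chain-r d ge u)
      left : ∀ d → lo < d → d < c → ∃ λ p → E p d ≡ just (suc i) × r < p × RankOf a p r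
      left d l u with links-l d l (≤-pred u)
      ... | _ , p , d₀ , r<p = p , d₀ , right-other (chain-l d l (<⇒≤ u)) d₀
      right : ∀ d → c < d → d < hi → ∃ λ p → E p d ≡ just (suc i) × p < r × RankOf a p r
      right d l u with links-r d l u
      ... | _ , p , d₀ , p<r = p , d₀ , left-other (chain-r d (<⇒≤ l) u) d₀
      last-chain : ∃ λ h → LeftChain h × Next h hi
      last-chain with hi-pred
      ... | h , e , le = h , chain-r h le (≤-reflexive (sym e)) , e , ≤-pred (subst (_≤ suc N) e hi≤)
      stop-hi : ∀ p → E p hi ≡ just (suc i) ⊎ E p hi ≡ just i → ¬ p < r
      stop-hi p with last-chain
      ... | h , ch , nx = left-stop ch nx stop-r p

-- The pairing scan and the column word

-- The fold in `rightmostUnpaired` as a recursion on the number of columns, parallel to the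
-- recursion of `columns`.
scan : ∀ {n} → Filling n → ℕ → ℕ → ℕ × Maybe (ℕ × ℕ)
scan T i zero = 0 , nothing
scan T i (suc m) = stepF (suc m) (rowWith T i (suc m)) (rowWith T (suc i) (suc m)) (scan T i m)

rightmost-scan : ∀ {n} (T : Filling n) i → rightmostUnpaired i T ≡ proj₂ (scan T i (width T))
rightmost-scan T i = cong proj₂ (go (width T))
  where
  f : ℕ × Maybe (ℕ × ℕ) → ℕ → ℕ × Maybe (ℕ × ℕ)
  f s c = stepF c (rowWith T i c) (rowWith T (suc i) c) s
  go : ∀ m → foldl f (0 , nothing) (map suc (upTo m)) ≡ scan T i m
  go zero = refl
  go (suc m) = trans (cong (λ l → foldl f (0 , nothing) (map suc l)) (sym (upTo-∷ʳ m)))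
    (trans (cong (foldl f (0 , nothing)) (map-++ suc (upTo m) (m ∷ [])))
    (trans (foldl-++ f (0 , nothing) (map suc (upTo m)) (suc m ∷ [])) (cong (λ s → f s (suc m)) (go m))))

has : ∀ {n} → Filling n → ℕ → ℕ → Bool
has T v c = M.is-just (rowWith T v (suc c))

Holds : ∀ {n} → Filling n → ℕ → ℕ → Set
Holds T v d = ∃ λ p → entry T p d ≡ just v

has-true : ∀ {n} {T : Filling n} {v c} → Holds T v (suc c) → has T v c ≡ true
has-true {T = T} {v} {c} (p , e) with rowWith T v (suc c) | rowWith? T v c
... | _ | found _ _ = refl
... | _ | absent none = ⊥-elim (none p e)

has-true⁻¹ : ∀ {n} {T : Filling n} {v c} → has T v c ≡ true → Holds T v (suc c)
has-true⁻¹ {T = T} {v} {c} h with rowWith T v (suc c) | rowWith? T v c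
... | _ | found p e = p , e

has-false : ∀ {n} {T : Filling n} {v c} → (∀ p → entry T p (suc c) ≢ just v) → has T v c ≡ false
has-false {T = T} {v} {c} none with rowWith T v (suc c) | rowWith? T v c
... | _ | found p e = ⊥-elim (none p e)
... | _ | absent _ = refl

has-cong : ∀ {n} {T U : Filling n} {v c} → (Holds T v (suc c) → Holds U v (suc c)) → (Holds U v (suc c) → Holds T v (suc c)) →
  has U v c ≡ has T v c
has-cong {T = T} {U} {v} {c} to from with has T v c in t | has U v c in u
... | true | true = refl
... | false | false = refl
... | true | false = trans (sym u) (has-true {T = U} (to (has-true⁻¹ {T = T} t)))
... | false | true = sym (trans (sym t) (has-true {T = T} (from (has-true⁻¹ {T = U} u))))

κ : Bool → Bool → ℕ → ℕ
κ true true k = k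
κ true false k = suc k
κ false true k = k ∸ 1
κ false false k = k

step-κ : ∀ c m₀ m₁ s → proj₁ (stepF c m₀ m₁ s) ≡ κ (M.is-just m₀) (M.is-just m₁) (proj₁ s)
step-κ c (just _) (just _) s = refl
step-κ c (just _) nothing (k , _) = refl
step-κ c nothing (just _) (zero , _) = refl
step-κ c nothing (just _) (suc k , _) = refl
step-κ c nothing nothing s = refl

bit : Bool → ℕ
bit true = 1
bit false = 0

-- Each column contributes its set of letters in decreasing order, so the word depends on the column
-- sets only.
columns : ∀ {n} → Filling n → ℕ → List ℕ
columns T zero = []
columns {n} T (suc c) = canon (λ v → bit (has T v c)) n ++ columns T c

module CanonRaise (i : ℕ) where

  skip-φ : ∀ {v} k w → v ≢ i → v ≢ suc i → φ i (replicate k v ++ w) ≡ φ i w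
  skip-φ zero w ne ne' = refl
  skip-φ (suc k) w ne ne' rewrite letter-other ne ne' = skip-φ k w ne ne'

  skip-raise : ∀ {v} k w → v ≢ i → v ≢ suc i → raise i (replicate k v ++ w) ≡ M.map (replicate k v ++_) (raise i w)
  skip-raise zero w ne ne' with raise i w
  ... | just _ = refl
  ... | nothing = refl
  skip-raise {v} (suc k) w ne ne' rewrite letter-other ne ne' | skip-raise k w ne ne' with raise i w
  ... | just _ = refl
  ... | nothing = refl

  below-φ : ∀ o m w → m < i → φ i (canon o m ++ w) ≡ φ i w
  below-φ o zero w lt = refl
  below-φ o (suc m) w lt rewrite ++-assoc (replicate (o (suc m)) (suc m)) (canon o m) w =
    trans (skip-φ (o (suc m)) _ (λ e → <-irrefl e lt) (λ e → <-irrefl e (m<n⇒m<1+n lt))) (below-φ o m w (<-trans ≤-refl lt))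

  map-map : ∀ (xs ys : List ℕ) m → M.map (xs ++_) (M.map (ys ++_) m) ≡ M.map ((xs ++ ys) ++_) m
  map-map xs ys (just w) = cong just (sym (++-assoc xs ys w))
  map-map xs ys nothing = refl

  below-raise : ∀ o m w → m < i → raise i (canon o m ++ w) ≡ M.map (canon o m ++_) (raise i w)
  below-raise o zero w lt with raise i w
  ... | just _ = refl
  ... | nothing = refl
  below-raise o (suc m) w lt rewrite ++-assoc (replicate (o (suc m)) (suc m)) (canon o m) w =
    trans (skip-raise (o (suc m)) _ (λ e → <-irrefl e lt) (λ e → <-irrefl e (m<n⇒m<1+n lt)))
      (trans (cong (M.map (replicate (o (suc m)) (suc m) ++_)) (below-raise o m w (<-trans ≤-refl lt)))
        (map-map (replicate (o (suc m)) (suc m)) (canon o m) (raise i w)))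

  Paired : Bool → Bool → ℕ → Set
  Paired x y k = ¬ (x ≡ false × y ≡ true × k ≡ 0)

  -- A column with both letters reads `i + 1`, `i` and brackets itself; this is the pairing within a
  -- column.
  pair-φ : ∀ x y w → φ i (replicate (bit y) (suc i) ++ replicate (bit x) i ++ w) ≡ κ x y (φ i w)
  pair-φ true true w rewrite letter-low i | letter-high i = refl
  pair-φ true false w rewrite letter-low i = refl
  pair-φ false true w rewrite letter-high i = refl
  pair-φ false false w = refl

  pair-raise : ∀ x y w → Paired x y (φ i w) →
    raise i (replicate (bit y) (suc i) ++ replicate (bit x) i ++ w) ≡ M.map (λ z → replicate (bit y) (suc i) ++ replicate (bit x) i ++ z) (raise i w)
  pair-raise true true w p rewrite letter-low i | letter-high i with raise i w
  ... | just _ = refl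
  ... | nothing = refl
  pair-raise true false w p rewrite letter-low i = refl
  pair-raise false true w p rewrite letter-high i with φ i w
  ... | zero = ⊥-elim (p (refl , refl , refl))
  ... | suc k = refl
  pair-raise false false w p with raise i w
  ... | just _ = refl
  ... | nothing = refl

module _ (i' : ℕ) (o : ℕ → ℕ) {x y : Bool} (ox : o (suc i') ≡ bit x) (oy : o (suc (suc i')) ≡ bit y) where
  private
    i = suc i'
  open CanonRaise i

  unfold : ∀ w → canon o (suc i) ++ w ≡ replicate (bit y) (suc i) ++ replicate (bit x) i ++ canon o i' ++ w
  unfold w rewrite ox | oy = trans (++-assoc (replicate (bit y) (suc i)) (replicate (bit x) i ++ canon o i') w)
    (cong (replicate (bit y) (suc i) ++_) (++-assoc (replicate (bit x) i) (canon o i') w))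

  -- Writing the bound as `j + suc i` lets the induction strip the letters above `i + 1` until the
  -- two relevant ones are in front.
  canon-φ : ∀ j w → φ i (canon o (j + suc i) ++ w) ≡ κ x y (φ i w)
  canon-φ zero w rewrite unfold w = trans (pair-φ x y (canon o i' ++ w)) (cong (κ x y) (below-φ o i' w ≤-refl))
  canon-φ (suc j) w rewrite ++-assoc (replicate (o (suc (j + suc i))) (suc (j + suc i))) (canon o (j + suc i)) w =
    trans (skip-φ (o (suc (j + suc i))) _ (λ e → <-irrefl (sym e) (s≤s (≤-trans (n≤1+n i) (m≤n+m (suc i) j))))
      (λ e → <-irrefl (sym e) (s≤s (m≤n+m (suc i) j)))) (canon-φ j w)

  canon-raise : ∀ j w → Paired x y (φ i w) → raise i (canon o (j + suc i) ++ w) ≡ M.map (canon o (j + suc i) ++_) (raise i w)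
  canon-raise zero w p rewrite unfold w =
    trans (pair-raise x y (canon o i' ++ w) (subst (Paired x y) (sym (below-φ o i' w ≤-refl)) p))
      (trans (cong (M.map _) (below-raise o i' w ≤-refl)) (regroup (raise i w)))
    where
    regroup : ∀ m → M.map (λ z → replicate (bit y) (suc i) ++ replicate (bit x) i ++ z) (M.map (canon o i' ++_) m) ≡ M.map (canon o (suc i) ++_) m
    regroup (just w) = cong just (sym (unfold w))
    regroup nothing = refl
  canon-raise (suc j) w p rewrite ++-assoc (replicate (o (suc (j + suc i))) (suc (j + suc i))) (canon o (j + suc i)) w =
    trans (skip-raise (o (suc (j + suc i))) _ (λ e → <-irrefl (sym e) (s≤s (≤-trans (n≤1+n i) (m≤n+m (suc i) j))))
      (λ e → <-irrefl (sym e) (s≤s (m≤n+m (suc i) j))))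
      (trans (cong (M.map (replicate (o (suc (j + suc i))) (suc (j + suc i)) ++_)) (canon-raise j w p))
        (map-map (replicate (o (suc (j + suc i))) (suc (j + suc i))) (canon o (j + suc i)) (raise i w)))

canon-raise-here : ∀ i' o o' → o (suc i') ≡ 0 → o (suc (suc i')) ≡ 1 → o' (suc i') ≡ 1 → o' (suc (suc i')) ≡ 0 →
  (∀ v → v ≢ suc i' → v ≢ suc (suc i') → o' v ≡ o v) → ∀ j w → φ (suc i') w ≡ 0 →
  raise (suc i') (canon o (j + suc (suc i')) ++ w) ≡ just (canon o' (j + suc (suc i')) ++ w)
canon-raise-here i' o o' e₀ e₁ e₀' e₁' agree zero w ph rewrite e₀ | e₁ | e₀' | e₁' =
  trans (raise-here (suc i') (canon o i' ++ w) (trans (CanonRaise.below-φ (suc i') o i' w ≤-refl) ph))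
    (cong (λ z → just (suc i' ∷ z ++ w)) (canon-cong i' λ v _ v≤ →
      sym (agree v (λ { refl → 1+n≰n v≤ }) (λ { refl → 1+n≰n (≤-trans (n≤1+n _) v≤) }))))
canon-raise-here i' o o' e₀ e₁ e₀' e₁' agree (suc j) w ph
  rewrite ++-assoc (replicate (o (suc (j + suc (suc i')))) (suc (j + suc (suc i')))) (canon o (j + suc (suc i'))) w
  | ++-assoc (replicate (o' (suc (j + suc (suc i')))) (suc (j + suc (suc i')))) (canon o' (j + suc (suc i'))) w =
  trans (CanonRaise.skip-raise (suc i') (o (suc (j + suc (suc i')))) _ ne ne')
    (trans (cong (M.map (replicate (o (suc (j + suc (suc i')))) (suc (j + suc (suc i'))) ++_)) (canon-raise-here i' o o' e₀ e₁ e₀' e₁' agree j w ph))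
      (cong (λ k → just (replicate k (suc (j + suc (suc i'))) ++ canon o' (j + suc (suc i')) ++ w)) (sym (agree _ ne ne'))))
  where
  ne : suc (j + suc (suc i')) ≢ suc i'
  ne e = <-irrefl (sym e) (s≤s (≤-trans (n≤1+n (suc i')) (m≤n+m (suc (suc i')) j)))
  ne' : suc (j + suc (suc i')) ≢ suc (suc i')
  ne' e = <-irrefl (sym e) (s≤s (m≤n+m (suc (suc i')) j))

canon-φ′ : ∀ {i m} → 1 ≤ i → suc i ≤ m → ∀ o {x y} w → o i ≡ bit x → o (suc i) ≡ bit y →
  φ i (canon o m ++ w) ≡ κ x y (φ i w)
canon-φ′ {suc i'} {m} _ i<m o {x} {y} w ox oy = subst (λ z → φ (suc i') (canon o z ++ w) ≡ κ x y (φ (suc i') w)) (m∸n+n≡m i<m)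
  (canon-φ i' o {x} {y} ox oy (m ∸ suc (suc i')) w)

canon-raise′ : ∀ {i m} → 1 ≤ i → suc i ≤ m → ∀ o {x y} w → o i ≡ bit x → o (suc i) ≡ bit y →
  ¬ (x ≡ false × y ≡ true × φ i w ≡ 0) → raise i (canon o m ++ w) ≡ M.map (canon o m ++_) (raise i w)
canon-raise′ {suc i'} {m} _ i<m o {x} {y} w ox oy p =
  subst (λ z → raise (suc i') (canon o z ++ w) ≡ M.map (canon o z ++_) (raise (suc i') w)) (m∸n+n≡m i<m)
    (canon-raise i' o {x} {y} ox oy (m ∸ suc (suc i')) w p)

canon-raise-here′ : ∀ {i m} → 1 ≤ i → suc i ≤ m → ∀ o o' w → o i ≡ 0 → o (suc i) ≡ 1 → o' i ≡ 1 → o' (suc i) ≡ 0 →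
  (∀ v → v ≢ i → v ≢ suc i → o' v ≡ o v) → φ i w ≡ 0 → raise i (canon o m ++ w) ≡ just (canon o' m ++ w)
canon-raise-here′ {suc i'} {m} _ i<m o o' w e₀ e₁ e₀' e₁' agree ph =
  subst (λ z → raise (suc i') (canon o z ++ w) ≡ just (canon o' z ++ w)) (m∸n+n≡m i<m)
    (canon-raise-here i' o o' e₀ e₁ e₀' e₁' agree (m ∸ suc (suc i')) w ph)

columns-φ : ∀ {n} (T : Filling n) {i} → Valid n i → ∀ m → φ i (columns T m) ≡ proj₁ (scan T i m)
columns-φ T va zero = refl
columns-φ T {i} va (suc m) = trans (canon-φ′ (proj₁ va) (proj₂ va) (λ v → bit (has T v m)) {has T i m} {has T (suc i) m} (columns T m) refl refl)
  (trans (cong (κ (has T i m) (has T (suc i) m)) (columns-φ T va m))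
    (sym (step-κ (suc m) (rowWith T i (suc m)) (rowWith T (suc i) (suc m)) (scan T i m))))

module _ {n : ℕ} (T : Filling n) (i : ℕ) where

  Closing : ℕ → Set
  Closing m = ∃ λ r → rowWith T i (suc m) ≡ nothing × rowWith T (suc i) (suc m) ≡ just r ×
    proj₁ (scan T i m) ≡ 0 × scan T i (suc m) ≡ (0 , just (suc m , r))

  -- A column either has an unpaired `i + 1`, which is then the latest one, or keeps the record; in
  -- the second case it has no letter for the word operator to change, which passes on to the
  -- columns behind it in the word.
  scan-acc : ∀ m → Closing m ⊎ (proj₂ (scan T i (suc m)) ≡ proj₂ (scan T i m) ×
    ¬ (has T i m ≡ false × has T (suc i) m ≡ true × proj₁ (scan T i m) ≡ 0))
  scan-acc m with rowWith T i (suc m) | rowWith T (suc i) (suc m) | scan T i m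
  ... | just _ | just _ | s = inj₂ (refl , λ { (() , _) })
  ... | just _ | nothing | k , l = inj₂ (refl , λ { (() , _) })
  ... | nothing | just r | zero , l = inj₁ (r , refl , refl , refl , refl)
  ... | nothing | just r | suc k , l = inj₂ (refl , λ { (_ , _ , ()) })
  ... | nothing | nothing | s = inj₂ (refl , λ { (_ , () , _) })

  scan-last : ∀ m {c r} → proj₂ (scan T i m) ≡ just (c , r) → ∃ λ c₀ → c ≡ suc c₀ × suc c₀ ≤ m ×
    rowWith T i c ≡ nothing × rowWith T (suc i) c ≡ just r × proj₁ (scan T i c₀) ≡ 0 ×
    (∀ d → suc c₀ ≤ d → d ≤ m → proj₂ (scan T i d) ≡ just (c , r))
  scan-last (suc m) {c} {r} eq with scan-acc m
  ... | inj₁ (r' , e₀ , e₁ , z , s) with trans (sym (cong proj₂ s)) eq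
  ...   | refl = m , refl , ≤-refl , e₀ , e₁ , z , λ d l h → subst (λ x → proj₂ (scan T i x) ≡ just (suc m , r')) (≤-antisym l h) eq
  scan-last (suc m) {c} {r} eq | inj₂ (same' , _) with scan-last m (trans (sym same') eq)
  ... | c₀ , e , le , e₀ , e₁ , z , h = c₀ , e , m≤n⇒m≤1+n le , e₀ , e₁ , z , later
    where
    later : ∀ d → suc c₀ ≤ d → d ≤ suc m → proj₂ (scan T i d) ≡ just (c , r)
    later d l u with d ≟ suc m
    ... | yes refl = eq
    ... | no ne = h d l (≤∧≢⇒≤pred u ne)

  -- The leftmost unpaired `i` is where the number of open letters leaves 0 for the last time.
  scan-first : ∀ m → 0 < proj₁ (scan T i m) → ∃ λ c₀ → ∃ λ r → suc c₀ ≤ m × rowWith T i (suc c₀) ≡ just r ×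
    rowWith T (suc i) (suc c₀) ≡ nothing × proj₁ (scan T i c₀) ≡ 0 × (∀ d → suc c₀ ≤ d → d ≤ m → 0 < proj₁ (scan T i d))
  scan-first (suc m) pos with proj₁ (scan T i m) in k
  ... | suc k' with scan-first m (subst (0 <_) (sym k) (s≤s z≤n))
  ...   | c₀ , r , le , e₀ , e₁ , z , h = c₀ , r , m≤n⇒m≤1+n le , e₀ , e₁ , z , later
    where
    later : ∀ d → suc c₀ ≤ d → d ≤ suc m → 0 < proj₁ (scan T i d)
    later d l u with d ≟ suc m
    ... | yes refl = pos
    ... | no ne = h d l (≤∧≢⇒≤pred u ne)
  scan-first (suc m) pos | zero with rowWith T i (suc m) in e₀ | rowWith T (suc i) (suc m) in e₁ | scan T i m in s
  ... | just r | nothing | _ = m , r , ≤-refl , e₀ , e₁ , trans (cong proj₁ s) k , later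
    where
    later : ∀ d → suc m ≤ d → d ≤ suc m → 0 < proj₁ (scan T i d)
    later d l u rewrite ≤-antisym u l | e₀ | e₁ | s = s≤s z≤n
  ... | just r | just r' | _ = ⊥-elim (<-irrefl (sym k) pos)
  ... | nothing | nothing | _ = ⊥-elim (<-irrefl (sym k) pos)
  ... | nothing | just r | zero , _ = ⊥-elim (<-irrefl refl pos)
  scan-first (suc m) pos | zero | nothing | just r | suc _ , _ = case k of λ ()

module _ {n : ℕ} (T : Filling n) {i : ℕ} (va : Valid n i) where

  columns-noRaise : ∀ m → proj₂ (scan T i m) ≡ nothing → raise i (columns T m) ≡ nothing
  columns-noRaise zero eq = refl
  columns-noRaise (suc m) eq with scan-acc T i m
  ... | inj₁ (r , _ , _ , _ , s) = case trans (sym (cong proj₂ s)) eq of λ ()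
  ... | inj₂ (same' , paired) =
    trans (canon-raise′ (proj₁ va) (proj₂ va) (λ v → bit (has T v m)) {has T i m} {has T (suc i) m} (columns T m) refl refl
            (λ { (x , y , z) → paired (x , y , trans (sym (columns-φ T va m)) z) }))
      (cong (M.map _) (columns-noRaise m (trans (sym same') eq)))

  columns-raise : ∀ (U : Filling n) {c₀ r} → (∀ v d → d ≢ c₀ → has U v d ≡ has T v d) →
    has U i c₀ ≡ true → has U (suc i) c₀ ≡ false → (∀ v → v ≢ i → v ≢ suc i → has U v c₀ ≡ has T v c₀) →
    ∀ m → proj₂ (scan T i m) ≡ just (suc c₀ , r) → raise i (columns T m) ≡ just (columns U m)
  columns-raise U {c₀} {r} off at₀ at₁ at m eq = go m eq
    where
    below : ∀ m → m ≤ c₀ → columns U m ≡ columns T m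
    below zero le = refl
    below (suc m) le = cong₂ _++_ (canon-cong n λ v _ _ → cong bit (off v m λ e → <-irrefl e le)) (below m (<⇒≤ le))
    go : ∀ m → proj₂ (scan T i m) ≡ just (suc c₀ , r) → raise i (columns T m) ≡ just (columns U m)
    go (suc m) eq with scan-acc T i m
    ... | inj₁ (r' , e₀ , e₁ , z , s) with trans (sym (cong proj₂ s)) eq
    ...   | refl = trans (canon-raise-here′ (proj₁ va) (proj₂ va) (λ v → bit (has T v m)) (λ v → bit (has U v m)) (columns T m)
              (cong (bit ∘ M.is-just) e₀) (cong (bit ∘ M.is-just) e₁) (cong bit at₀) (cong bit at₁) (λ v ne ne' → cong bit (at v ne ne'))
              (trans (columns-φ T va m) z))
            (cong (λ w → just (canon (λ v → bit (has U v m)) n ++ w)) (sym (below m ≤-refl)))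
    go (suc m) eq | inj₂ (same' , paired) with scan-last T i m (trans (sym same') eq)
    ... | _ , refl , le , _ =
      trans (canon-raise′ (proj₁ va) (proj₂ va) (λ v → bit (has T v m)) {has T i m} {has T (suc i) m} (columns T m) refl refl
              (λ { (x , y , z) → paired (x , y , trans (sym (columns-φ T va m)) z) }))
        (trans (cong (M.map (canon (λ v → bit (has T v m)) n ++_)) (go m (trans (sym same') eq)))
          (cong (λ u → just (u ++ columns U m)) (canon-cong n λ v _ _ → cong bit (sym (off v m λ e → <-irrefl (sym e) le)))))

width-shape : ∀ {n} (a : Vec ℕ n) (T : Filling n) → Shape a T → width T ≡ foldr _+_ 0 (toList a)
width-shape V.[] V.[] sh = refl
width-shape (x V.∷ a) (row V.∷ T) sh = cong₂ _+_ (sh F.zero) (width-shape a T (sh ∘ F.suc))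

-- Raising and lowering a filling

module Scanning {n : ℕ} (a : Vec ℕ n) (T : Filling n) (sk : SSKD a T) (i : ℕ) (va : Valid n i) where
  open Strings a T sk i va
  private
    E = entry T
    dist = sskd-distinct sk
  open Cells a T (proj₁ sk)

  both-letters : ∀ {p q m} → E p (suc m) ≡ just i → E q (suc m) ≡ just (suc i) → scan T i (suc m) ≡ scan T i m
  both-letters {p} {q} {m} e₀ e₁ rewrite rowWith-just {T = T} {p} i m dist e₀ | rowWith-just {T = T} {q} (suc i) m dist e₁ = refl

  -- Columns with both letters do not change the number of open letters. The walk cannot begin in
  -- column 0, since the basement contains both.
  left₀-open : ∀ m → Left₀ dotSystem (suc m) → 0 < proj₁ (scan T i m)
  left₀-open zero (here (refl , _) d₀ none) = ⊥-elim (none (suc i) (basement (s≤s z≤n) (proj₂ va)))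
  left₀-open (suc m) (here {p = p} (refl , _) d₀ none)
    rewrite rowWith-just {T = T} {p} i m dist d₀ | rowWith-nothing {T = T} (suc i) m none = s≤s z≤n
  left₀-open zero (there (refl , _) d₀ d₁ (here (() , _) _ _))
  left₀-open zero (there (refl , _) d₀ d₁ (there (() , _) _ _ _))
  left₀-open (suc m) (there {p = p} {q} (refl , _) d₀ d₁ l) =
    subst (λ s → 0 < proj₁ s) (sym (both-letters {p} {q} d₀ d₁)) (left₀-open m l)

  right₁-closes : ∀ m → Right₁ dotSystem m → ∃ λ d → m ≤ d × suc d ≤ N × proj₁ (scan T i d) ≡ proj₁ (scan T i m) ×
    rowWith T i (suc d) ≡ nothing × ∃ λ r → rowWith T (suc i) (suc d) ≡ just r
  right₁-closes m (here {p = p} (refl , _) d₁ none) = m , ≤-refl , col-bound {p} d₁ , refl ,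
    rowWith-nothing {T = T} i m none , p , rowWith-just {T = T} {p} (suc i) m dist d₁
  right₁-closes m (there {p = p} {q} (refl , _) d₁ d₀ l) with right₁-closes (suc m) l
  ... | d , le , d≤ , k , e₀ , e₁ = d , <⇒≤ le , d≤ , trans k (cong proj₁ (both-letters {q} {p} d₀ d₁)) , e₀ , e₁

  absent-of : ∀ {v m} → rowWith T v (suc m) ≡ nothing → ∀ p → E p (suc m) ≢ just v
  absent-of {v} {m} e p e' = case trans (sym e) (rowWith-just {T = T} {p} v m dist e') of λ ()

  entry-of : ∀ {v m r} → rowWith T v (suc m) ≡ just r → E r (suc m) ≡ just v
  entry-of {v} {m} e with rowWith T v (suc m) | rowWith? T v m
  entry-of refl | _ | found r e' = e'

  -- Every flipped column except `c` contains both letters, so exchanging them leaves its set of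
  -- entries as it was.
  column-kept : ∀ {r c ℓ ℓ̄} (seg : Segment r c ℓ ℓ̄) {U : Filling n} →
    Flipped i (between (Segment.lo seg) (Segment.hi seg)) T U → ∀ v d → suc d ≢ c → has U v d ≡ has T v d
  column-kept {r} {c} {ℓ} {ℓ̄} seg {U} h v d ne = has-cong {T = T} {U} {v} {d} to from
    where
    open Segment seg
    G : ℕ → Bool
    G = between lo hi
    dots-in : G (suc d) ≡ true → ∃ λ p → E p (suc d) ≡ just ℓ̄
    dots-in g with Zone.in-zone seg g | <-cmp (suc d) c
    ... | l , u | tri< lt _ _ = proj₁ (ℓ̄-left (suc d) l lt) , proj₁ (proj₂ (ℓ̄-left (suc d) l lt))
    ... | l , u | tri≈ _ e _ = ⊥-elim (ne e)
    ... | l , u | tri> _ _ gt = proj₁ (ℓ̄-right (suc d) gt u) , proj₁ (proj₂ (ℓ̄-right (suc d) gt u))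
    both-in : ∀ v → G (suc d) ≡ true → Dot i v → Holds T v (suc d)
    both-in v g dv with v ≟ ℓ
    ... | yes refl = r , ℓ-in (suc d) (proj₁ (Zone.in-zone seg g)) (proj₂ (Zone.in-zone seg g))
    ... | no ne' with dots-other ℓ-dot ℓ̄-dot dv ℓ≢ℓ̄ ne'
    ...   | refl = dots-in g
    image : ∀ p {x} b → G (suc d) ≡ b → E p (suc d) ≡ just x → entry U p (suc d) ≡ just (act i b x)
    image p b refl e rewrite flips h p (suc d) | e = refl
    to : Holds T v (suc d) → Holds U v (suc d)
    to (p , e) with G (suc d) in g
    ... | false = p , image p false g e
    ... | true with dot? i v
    ...   | inj₂ nd = p , trans (image p true g e) (cong just (act-other true nd))
    ...   | inj₁ dv with both-in (act i true v) g (act-dot true dv)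
    ...     | q , e' = q , trans (image q true g e') (cong just (act-involutive i true v))
    from : Holds U v (suc d) → Holds T v (suc d)
    from (p , e) with Flip.unflip rank dist (sskd-noPassing sk) (Zone.zone seg) (entry U) (flips h) {p} {suc d} e
    ... | y , ey , v≡ with G (suc d) in g
    ...   | false = p , trans ey (cong just (sym v≡))
    ...   | true with dot? i v
    ...     | inj₁ dv = both-in v g dv
    ...     | inj₂ nd with dot? i y
    ...       | inj₁ dy = ⊥-elim (nd (subst (Dot i) (sym v≡) (act-dot true dy)))
    ...       | inj₂ ny = p , trans ey (cong just (sym (trans v≡ (act-other true ny))))

  module Changed {r c₀ ℓ ℓ̄ : ℕ} (seg : Segment r (suc c₀) ℓ ℓ̄) {U : Filling n}
    (h : Flipped i (between (Segment.lo seg) (Segment.hi seg)) T U) where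
    open Segment seg

    image : ∀ p d {x} → lo < d → d < hi → E p d ≡ just x → entry U p d ≡ just (act i true x)
    image p d l u e rewrite flips h p d | between-in l u | e = refl

    act-ℓ : act i true ℓ ≡ ℓ̄
    act-ℓ = dots-other ℓ-dot ℓ̄-dot (act-dot true ℓ-dot) ℓ≢ℓ̄ (moved ℓ-dot)
      where
      moved : ∀ {x} → Dot i x → act i true x ≢ x
      moved (inj₁ refl) e = 1+n≢n (trans (sym (act-low i)) e)
      moved (inj₂ refl) e = 1+n≢n (trans (sym e) (act-high i))

    act-ℓ̄ : act i true ℓ̄ ≡ ℓ
    act-ℓ̄ = trans (cong (act i true) (sym act-ℓ)) (act-involutive i true ℓ)

    row-changed : ∀ d → lo < d → d < hi → entry U r d ≡ just ℓ̄
    row-changed d l u = trans (image r d l u (ℓ-in d l u)) (cong just act-ℓ)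

    preimage : ∀ {p v} → entry U p (suc c₀) ≡ just v → ∃ λ y → E p (suc c₀) ≡ just y × v ≡ act i true y
    preimage {p} {v} e with Flip.unflip rank dist (sskd-noPassing sk) (Zone.zone seg) (entry U) (flips h) {p} {suc c₀} e
    ... | y , ey , v≡ = y , ey , subst (λ b → v ≡ act i b y) (between-in lo<c c<hi) v≡

    ℓ-gone : ∀ p → entry U p (suc c₀) ≢ just ℓ
    ℓ-gone p e with preimage {p} e
    ... | y , ey , ℓ≡ = ℓ̄-out p (trans ey (cong just (act-injective i true (trans (sym ℓ≡) (sym act-ℓ̄)))))

    has-ℓ̄ : has U ℓ̄ c₀ ≡ true
    has-ℓ̄ = has-true {T = U} (r , row-changed (suc c₀) lo<c c<hi)

    has-ℓ : has U ℓ c₀ ≡ false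
    has-ℓ = has-false {T = U} ℓ-gone

    has-rest : ∀ v → v ≢ i → v ≢ suc i → has U v c₀ ≡ has T v c₀
    has-rest v ne ne' = has-cong {T = T} {U} {v} {c₀}
      (λ { (p , e) → p , trans (image p (suc c₀) lo<c c<hi e) (cong just (act-other true [ ne , ne' ]′)) }) from
      where
      from : Holds U v (suc c₀) → Holds T v (suc c₀)
      from (p , e) with preimage {p} e
      ... | y , ey , v≡ with dot? i y
      ...   | inj₁ dy = ⊥-elim ([ ne , ne' ]′ (subst (Dot i) (sym v≡) (act-dot true dy)))
      ...   | inj₂ ny = p , trans ey (cong just (sym (trans v≡ (act-other true ny))))

  raising : ∀ {c r} → rightmostUnpaired i T ≡ just (c , r) →
    SSKD a (raiseAt i T (c , r)) × raise i (columns T N) ≡ just (columns (raiseAt i T (c , r)) N)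
  raising {c} {r} eq with scan-last T i N (trans (sym (rightmost-scan T i)) eq)
  ... | c₀ , refl , le , e₀ , e₁ , z , h = Zone.zone-sskd segment raised-flips ,
    columns-raise T va (raiseAt i T (suc c₀ , r)) {c₀} {r}
      (λ v d ne → column-kept segment raised-flips v d (ne ∘ suc-injective))
      (Changed.has-ℓ̄ segment raised-flips) (Changed.has-ℓ segment raised-flips) (Changed.has-rest segment raised-flips)
      N (trans (sym (rightmost-scan T i)) eq)
    where
    ¬left : ¬ Left₀ dotSystem (suc c₀)
    ¬left l = <-irrefl (sym z) (left₀-open c₀ l)
    -- The walk to the right passes paired columns only, so the number of open letters is still 0
    -- where it ends; the `i + 1` found there would be unpaired and later than the last one.
    ¬right : ¬ Right₁ dotSystem (suc c₀)
    ¬right l with right₁-closes (suc c₀) l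
    ... | d , le' , d≤ , k , e₀' , r' , e₁' with scan-acc T i d
    ...   | inj₁ (_ , _ , _ , _ , s) with trans (sym (cong proj₂ s)) (h (suc d) (m≤n⇒m≤1+n le') d≤)
    ...     | refl = 1+n≰n le'
    ¬right l | d , le' , d≤ , k , e₀' , r' , e₁' | inj₂ (_ , paired) =
      paired (cong M.is-just e₀' , cong M.is-just e₁' , trans k (trans (step-κ (suc c₀) (rowWith T i (suc c₀)) (rowWith T (suc i) (suc c₀)) (scan T i c₀))
        (trans (cong (κ (has T i c₀) (has T (suc i) c₀)) z) (cong₂ (λ x y → κ x y 0) (cong M.is-just e₀) (cong M.is-just e₁)))))
    open Raising {r} {c₀} (entry-of e₁) (absent-of e₀) ¬left ¬right

  -- The flip is an involution, so raising the flipped filling in the same interval gives back `T`.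
  -- It remains to see that the scan of the flipped filling selects column `suc c₀`: from there on
  -- it has one open letter fewer than in `T`, which is possible because in `T` the leftmost
  -- unpaired `i` remains open to the end.
  lowering : 0 < proj₁ (scan T i N) → ∀ {l} → proj₂ (scan T i N) ≡ just l → ∃ λ U → SSKD a U × eF i U ≡ just T
  lowering pos {c' , r'} eq' with scan-first T i N pos | scan-last T i N eq'
  ... | c₀ , r , le , e₀ , e₁ , z , h | c₀' , refl , le' , e₀' , e₁' , z' , h' = U , skU ,
      trans (cong (M.map (raiseAt i U)) (trans (rightmost-scan U i) unpaired)) (cong just (flipped-unique raised (flipped-sym flip)))
    where
    dot : E r (suc c₀) ≡ just i
    dot = entry-of e₀
    k-here : proj₁ (scan T i (suc c₀)) ≡ 1
    k-here = trans (step-κ (suc c₀) (rowWith T i (suc c₀)) (rowWith T (suc i) (suc c₀)) (scan T i c₀))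
        (trans (cong (κ (has T i c₀) (has T (suc i) c₀)) z) (cong₂ (λ x y → κ x y 0) (cong M.is-just e₀) (cong M.is-just e₁)))
    ¬left : ¬ Left₀ dotSystem (suc c₀)
    ¬left l = <-irrefl (sym z) (left₀-open c₀ l)
    ¬right : ¬ Right₁ dotSystem (suc c₀)
    ¬right l with right₁-closes (suc c₀) l
    ... | d , le'' , d≤ , k , e₀'' , r'' , e₁'' = <-irrefl (sym closed) (h (suc d) (m≤n⇒m≤1+n le'') d≤)
      where
      closed : proj₁ (scan T i (suc d)) ≡ 0
      closed = trans (step-κ (suc d) (rowWith T i (suc d)) (rowWith T (suc i) (suc d)) (scan T i d))
        (trans (cong (κ (has T i d) (has T (suc i) d)) (trans k k-here)) (cong₂ (λ x y → κ x y 1) (cong M.is-just e₀'') (cong M.is-just e₁'')))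
    -- From the leftmost unpaired `i` on there is always an open letter, so no `i + 1` after it is
    -- unpaired.
    earlier : suc c₀' ≤ c₀
    earlier with <-cmp c₀' c₀
    ... | tri< lt _ _ = lt
    ... | tri≈ _ refl _ = case trans (sym e₀) e₀' of λ ()
    ... | tri> _ _ gt = ⊥-elim (<-irrefl (sym z') (h c₀' gt (<⇒≤ le')))
    -- The column of the unpaired `i + 1` contains no `i`, which makes it the required gap.
    open Lowering {r} {c₀} dot (absent-of e₁) ¬left ¬right (suc c₀' , s≤s z≤n , earlier , absent-of e₀')
    G : ℕ → Bool
    G = between lo hi
    U : Filling n
    U = flipFilling i G T
    flip : Flipped i G T U
    flip = flipFilling-flipped i G T (between-≤ lo hi z≤n)
    skU : SSKD a U
    skU = Zone.zone-sskd segment flip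
    open Changed segment {U} flip
    kept : ∀ v d → suc d ≢ suc c₀ → has U v d ≡ has T v d
    kept = column-kept segment flip
    U-step : ∀ d → proj₁ (scan U i (suc d)) ≡ κ (has U i d) (has U (suc i) d) (proj₁ (scan U i d))
    U-step d = step-κ (suc d) (rowWith U i (suc d)) (rowWith U (suc i) (suc d)) (scan U i d)
    T-step : ∀ d → proj₁ (scan T i (suc d)) ≡ κ (has T i d) (has T (suc i) d) (proj₁ (scan T i d))
    T-step d = step-κ (suc d) (rowWith T i (suc d)) (rowWith T (suc i) (suc d)) (scan T i d)
    same-before : ∀ m → m ≤ c₀ → proj₁ (scan U i m) ≡ proj₁ (scan T i m)
    same-before zero le = refl
    same-before (suc m) le rewrite U-step m | T-step m | kept i m (λ e → <-irrefl (suc-injective e) le)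
      | kept (suc i) m (λ e → <-irrefl (suc-injective e) le) = cong (κ (has T i m) (has T (suc i) m)) (same-before m (<⇒≤ le))
    at-c : scan U i (suc c₀) ≡ (0 , just (suc c₀ , r))
    at-c rewrite rowWith-nothing {T = U} i c₀ ℓ-gone
      | rowWith-just {T = U} {r} (suc i) c₀ (sskd-distinct skU) (row-changed (suc c₀) (s≤s lo≤c₀) c<hi)
      with scan U i c₀ | trans (same-before c₀ ≤-refl) z
    ... | zero , l | refl = refl
    step-after : ∀ c m₀ m₁ k A → 0 < k → 0 < κ (M.is-just m₀) (M.is-just m₁) k →
      stepF c m₀ m₁ (k ∸ 1 , A) ≡ (κ (M.is-just m₀) (M.is-just m₁) k ∸ 1 , A)
    step-after c (just _) (just _) k A p q = refl
    step-after c (just _) nothing (suc k) A p q = refl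
    step-after c nothing (just _) (suc (suc k)) A p q = refl
    step-after c nothing (just _) (suc zero) A p ()
    step-after c nothing nothing k A p q = refl
    after : ∀ j → j + suc c₀ ≤ N → scan U i (j + suc c₀) ≡ (proj₁ (scan T i (j + suc c₀)) ∸ 1 , just (suc c₀ , r))
    after zero _ = trans at-c (cong (λ k → k ∸ 1 , just (suc c₀ , r)) (sym k-here))
    after (suc j) le'' = trans (cong (stepF (suc m) (rowWith U i (suc m)) (rowWith U (suc i) (suc m))) (after j (<⇒≤ le'')))
        (trans (step-after (suc m) (rowWith U i (suc m)) (rowWith U (suc i) (suc m)) (proj₁ (scan T i m)) _
            (h m (m≤n+m (suc c₀) j) (<⇒≤ le'')) (subst (0 <_) k-next (h (suc m) (m≤n⇒m≤1+n (m≤n+m (suc c₀) j)) le'')))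
          (cong (λ k → k ∸ 1 , just (suc c₀ , r)) (sym k-next)))
      where
      m : ℕ
      m = j + suc c₀
      ne : suc m ≢ suc c₀
      ne e = 1+n≰n (subst (suc c₀ ≤_) (suc-injective e) (m≤n+m (suc c₀) j))
      k-next : proj₁ (scan T i (suc m)) ≡ κ (has U i m) (has U (suc i) m) (proj₁ (scan T i m))
      k-next rewrite kept i m ne | kept (suc i) m ne = T-step m
    same-width : width U ≡ N
    same-width = trans (width-shape a U (proj₁ skU)) (sym (width-shape a T (proj₁ sk)))
    unpaired : proj₂ (scan U i (width U)) ≡ just (suc c₀ , r)
    unpaired = trans (cong (λ m → proj₂ (scan U i m)) (trans same-width (sym (m∸n+n≡m le))))
      (cong proj₂ (after (N ∸ suc c₀) (≤-reflexive (m∸n+n≡m le))))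
    linkˡ : ∀ d → lo < d → d ≤ c₀ → Loops.LinkL i U (sskd-distinct skU) r d
    linkˡ d l u with Segment.ℓ̄-left segment d l (s≤s u)
    ... | p , e , r<p , _ = row-changed d l d<hi , p , trans (image p d l d<hi e) (cong just act-ℓ̄) , r<p
      where
      d<hi : d < hi
      d<hi = ≤-trans (s≤s (m≤n⇒m≤1+n u)) c<hi
    linkʳ : ∀ d → suc c₀ < d → d < hi → Loops.LinkR i U (sskd-distinct skU) r d
    linkʳ d l u with Segment.ℓ̄-right segment d l u
    ... | p , e , p<r , _ = row-changed d lo<d u , p , trans (image p d lo<d u e) (cong just act-ℓ̄) , p<r
      where
      lo<d : lo < d
      lo<d = ≤-trans (s≤s lo≤c₀) (<⇒≤ l)
    stopˡ : ¬ Loops.LinkL i U (sskd-distinct skU) r lo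
    stopˡ (_ , p , e , r<p) = <⇒≱ r<p (Segment.lo-stop segment p i (trans (sym (flipped-at flip p lo (between-≤ lo hi ≤-refl))) e) (inj₁ refl))
    stopʳ : ¬ Loops.LinkR i U (sskd-distinct skU) r hi
    stopʳ (_ , p , e , p<r) = <⇒≱ p<r (Segment.hi-stop segment p i (trans (sym (flipped-at flip p hi (between-≥ lo hi ≤-refl))) e) (inj₁ refl))
    raised : Flipped i G U (raiseAt i U (suc c₀ , r))
    raised = Loops.raiseAt-flips i U (sskd-distinct skU) r lo c₀ hi lo≤c₀ c<hi
      (≤-trans hi≤ (s≤s (subst (λ w → N ≤ suc c₀ + w) (sym same-width) (m≤n+m N (suc c₀)))))
      (row-changed (suc c₀) (s≤s lo≤c₀) c<hi) ℓ-gone linkˡ (inj₂ stopˡ) linkʳ stopʳ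

-- Columns and words

sumTo : ℕ → (ℕ → ℕ) → ℕ
sumTo zero f = 0
sumTo (suc m) f = f m + sumTo m f

sumTo-cong : ∀ m {f g} → (∀ k → k < m → f k ≡ g k) → sumTo m f ≡ sumTo m g
sumTo-cong zero h = refl
sumTo-cong (suc m) h = cong₂ _+_ (h m ≤-refl) (sumTo-cong m λ k lt → h k (m<n⇒m<1+n lt))

+-interchange : ∀ a b c d → (a + b) + (c + d) ≡ (a + c) + (b + d)
+-interchange a b c d = trans (+-assoc a b (c + d)) (trans (cong (a +_) (trans (sym (+-assoc b c d))
  (trans (cong (_+ d) (+-comm b c)) (+-assoc c b d)))) (sym (+-assoc a c (b + d))))

sumTo-+ : ∀ m f g → sumTo m (λ k → f k + g k) ≡ sumTo m f + sumTo m g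
sumTo-+ zero f g = refl
sumTo-+ (suc m) f g rewrite sumTo-+ m f g = +-interchange (f m) (g m) (sumTo m f) (sumTo m g)

sumTo-zero : ∀ m → sumTo m (λ _ → 0) ≡ 0
sumTo-zero zero = refl
sumTo-zero (suc m) = sumTo-zero m

sumTo-head : ∀ m f → sumTo (suc m) f ≡ f 0 + sumTo m (f ∘ suc)
sumTo-head zero f = refl
sumTo-head (suc m) f rewrite sumTo-head m f = trans (sym (+-assoc (f (suc m)) (f 0) _))
  (trans (cong (_+ sumTo m (f ∘ suc)) (+-comm (f (suc m)) (f 0))) (+-assoc (f 0) (f (suc m)) _))

δ : Maybe ℕ → ℕ → ℕ
δ m v = bit (eqM m v)

occurrences : List (List ℕ) → ℕ → ℕ → ℕ
occurrences [] c v = 0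
occurrences (row ∷ rs) c v = δ (nth row c) v + occurrences rs c v

occurrences-none : ∀ rs c v → (∀ j row → nth rs j ≡ just row → nth row c ≢ just v) → occurrences rs c v ≡ 0
occurrences-none [] c v none = refl
occurrences-none (row ∷ rs) c v none with eqM (nth row c) v in e
... | true = ⊥-elim (none 0 row refl (eqM-true (nth row c) e))
... | false = occurrences-none rs c v (none ∘ suc)

findRow-occurrences : ∀ rs c v k →
  (∀ j j' row row' → nth rs j ≡ just row → nth rs j' ≡ just row' → nth row c ≡ just v → nth row' c ≡ just v → j ≡ j') →
  bit (M.is-just (findRow c v k rs)) ≡ occurrences rs c v
findRow-occurrences [] c v k uniq = refl
findRow-occurrences (row ∷ rs) c v k uniq with eqM (nth row c) v in e
... | true = cong suc (sym (occurrences-none rs c v λ j row' ej e' →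
      case uniq 0 (suc j) row row' refl ej (eqM-true (nth row c) e) e' of λ ()))
... | false = findRow-occurrences rs c v (suc k) λ j j' row row' ej ej' e e' → suc-injective (uniq (suc j) (suc j') row row' ej ej' e e')

count-row : ∀ v m row → length row ≤ m → count v row ≡ sumTo m (λ c → δ (nth row c) v)
count-row v m [] le = sym (sumTo-zero m)
count-row v (suc m) (x ∷ row) (s≤s le) rewrite count-∷ v x row | sumTo-head m (λ c → δ (nth (x ∷ row) c) v) =
  cong₂ _+_ (same-bit (x ≡ᵇ v)) (count-row v m row le)
  where
  same-bit : ∀ b → (if b then 1 else 0) ≡ bit b
  same-bit true = refl
  same-bit false = refl

count-concat : ∀ v m rs → (∀ j row → nth rs j ≡ just row → length row ≤ m) → count v (concat rs) ≡ sumTo m (λ c → occurrences rs c v)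
count-concat v m [] le = sym (sumTo-zero m)
count-concat v m (row ∷ rs) le rewrite count-++ v row (concat rs) | count-row v m row (le 0 row refl) | count-concat v m rs (le ∘ suc) =
  sym (sumTo-+ m (λ c → δ (nth row c) v) (λ c → occurrences rs c v))

count-replicate : ∀ v k x → count v (replicate k x) ≡ (if x ≡ᵇ v then k else 0)
count-replicate v zero x with x ≡ᵇ v
... | true = refl
... | false = refl
count-replicate v (suc k) x rewrite count-∷ v x (replicate k x) | count-replicate v k x with x ≡ᵇ v
... | true = refl
... | false = refl

count-canon-above : ∀ o v m → m < v → count v (canon o m) ≡ 0
count-canon-above o v zero lt = refl
count-canon-above o v (suc m) lt rewrite count-++ v (replicate (o (suc m)) (suc m)) (canon o m) | count-replicate v (o (suc m)) (suc m)
  | ≡ᵇ-false {suc m} {v} (λ e → <-irrefl e lt) = count-canon-above o v m (<-trans ≤-refl lt)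

count-canon : ∀ o v m → 1 ≤ v → v ≤ m → count v (canon o m) ≡ o v
count-canon o v zero 1≤v v≤m = ⊥-elim (1+n≰n (≤-trans 1≤v v≤m))
count-canon o v (suc m) 1≤v v≤m rewrite count-++ v (replicate (o (suc m)) (suc m)) (canon o m) | count-replicate v (o (suc m)) (suc m)
  with suc m ≟ v
... | yes refl rewrite ≡ᵇ-refl m | count-canon-above o (suc m) m ≤-refl = +-identityʳ (o (suc m))
... | no ne rewrite ≡ᵇ-false ne = count-canon o v m 1≤v (≤∧≢⇒≤pred v≤m (ne ∘ sym))

length-canon : ∀ o m → length (canon o m) ≡ sumTo m (o ∘ suc)
length-canon o zero = refl
length-canon o (suc m) rewrite length-++ (replicate (o (suc m)) (suc m)) {canon o m} | length-canon o m =
  cong (_+ sumTo m (o ∘ suc)) (length-replicate (o (suc m)))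

δ-row : ∀ n m → (∀ x → m ≡ just x → 1 ≤ x × x ≤ n) → sumTo n (λ v → δ m (suc v)) ≡ bit (M.is-just m)
δ-row n nothing h = sumTo-zero n
δ-row n (just x) h with x | h x refl
... | suc y | _ , le = go n le
  where
  zeros : ∀ n → n ≤ y → sumTo n (λ v → bit (y ≡ᵇ v)) ≡ 0
  zeros zero le = refl
  zeros (suc n) le rewrite ≡ᵇ-false {y} {n} (λ e → <-irrefl (sym e) le) = zeros n (<⇒≤ le)
  go : ∀ n → suc y ≤ n → sumTo n (λ v → bit (y ≡ᵇ v)) ≡ 1
  go (suc n) le with y ≟ n
  ... | yes refl rewrite ≡ᵇ-refl y = cong suc (zeros y ≤-refl)
  ... | no ne rewrite ≡ᵇ-false ne = go n (≤∧≢⇒< (≤-pred le) ne)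

occurrences-cells : ∀ n rs c → (∀ j row x → nth rs j ≡ just row → nth row c ≡ just x → 1 ≤ x × x ≤ n) →
  sumTo n (λ v → occurrences rs c (suc v)) ≡ foldr (λ l k → bit (c <ᵇ l) + k) 0 (map length rs)
occurrences-cells n [] c h = sumTo-zero n
occurrences-cells n (row ∷ rs) c h = trans (sumTo-+ n (λ v → δ (nth row c) (suc v)) (λ v → occurrences rs c (suc v)))
  (cong₂ _+_ (trans (δ-row n (nth row c) (λ x → h 0 row x refl)) (cong bit (is-just-nth row c))) (occurrences-cells n rs c (h ∘ suc)))
  where
  is-just-nth : ∀ (row : List ℕ) c → M.is-just (nth row c) ≡ (c <ᵇ length row)
  is-just-nth [] c = refl
  is-just-nth (x ∷ row) zero = refl
  is-just-nth (x ∷ row) (suc c) = is-just-nth row c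

lengths-shape : ∀ {n} (a : Vec ℕ n) (T : Filling n) → Shape a T → map length (toList T) ≡ toList a
lengths-shape V.[] V.[] sh = refl
lengths-shape (x V.∷ a) (row V.∷ T) sh = cong₂ _∷_ (sh F.zero) (lengths-shape a T (sh ∘ F.suc))

++-split : ∀ {A : Set} (xs ys : List A) {us vs} → length xs ≡ length ys → xs ++ us ≡ ys ++ vs → xs ≡ ys × us ≡ vs
++-split [] [] l e = refl , e
++-split (x ∷ xs) (y ∷ ys) l e with ∷-injective e
... | refl , e' with ++-split xs ys (suc-injective l) e'
...   | refl , e'' = refl , e''

bit-injective : ∀ {b b'} → bit b ≡ bit b' → b ≡ b'
bit-injective {true} {true} e = refl
bit-injective {false} {false} e = refl

module Counting {n : ℕ} (a : Vec ℕ n) (T : Filling n) (sk : SSKD a T) where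
  open Cells a T (proj₁ sk)

  entry-nth : ∀ {j row c x} → nth (toList T) j ≡ just row → nth row c ≡ just x → entry T (suc j) (suc c) ≡ just x
  entry-nth {j} {c = c} e e' = trans (cong (entryRow j (suc c)) e) e'

  has-occurrences : ∀ v c → bit (has T v c) ≡ occurrences (toList T) c v
  has-occurrences v c = findRow-occurrences (toList T) c v 0 λ j j' row row' ej ej' e e' →
    suc-injective (sskd-distinct sk (suc j) (suc j') (suc c) v (entry-nth ej e) (entry-nth ej' e'))

  width-rows : ∀ j row → nth (toList T) j ≡ just row → length row ≤ width T
  width-rows j row e = subst (_≤ width T) (row-length j e) (width-bound a T (proj₁ sk) (suc j))

  count-columns : ∀ v m → 1 ≤ v → v ≤ n → count v (columns T m) ≡ sumTo m (λ c → occurrences (toList T) c v)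
  count-columns v zero 1≤v v≤n = refl
  count-columns v (suc m) 1≤v v≤n rewrite count-++ v (canon (λ u → bit (has T u m)) n) (columns T m) =
    cong₂ _+_ (trans (count-canon (λ u → bit (has T u m)) v n 1≤v v≤n) (has-occurrences v m)) (count-columns v m 1≤v v≤n)

  weight : ∀ v → 1 ≤ v → v ≤ n → count v (columns T (width T)) ≡ count v (concat (toList T))
  weight v 1≤v v≤n = trans (count-columns v (width T) 1≤v v≤n) (sym (count-concat v (width T) (toList T) width-rows))

  -- The number of letters in a column depends on the shape alone; this allows the word to be cut
  -- back into columns.
  column-length : ∀ c → length (canon (λ v → bit (has T v c)) n) ≡ foldr (λ l k → bit (c <ᵇ l) + k) 0 (toList a)
  column-length c = trans (length-canon (λ v → bit (has T v c)) n)
    (trans (sumTo-cong n λ v _ → has-occurrences (suc v) c)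
    (trans (occurrences-cells n (toList T) c λ j row x ej e → proj₁ (proj₂ sk) (suc j) c x (entry-nth ej e))
    (cong (foldr (λ l k → bit (c <ᵇ l) + k) 0) (lengths-shape a T (proj₁ sk)))))

columns-has : ∀ {n} {a : Vec ℕ n} {T U : Filling n} → SSKD a T → SSKD a U → ∀ m → columns T m ≡ columns U m →
  ∀ c v → c < m → 1 ≤ v → v ≤ n → has T v c ≡ has U v c
columns-has {n} {a} {T} {U} skT skU (suc m) eq c v c<m 1≤v v≤n
  with ++-split (canon (λ v → bit (has T v m)) n) (canon (λ v → bit (has U v m)) n)
         (trans (Counting.column-length a T skT m) (sym (Counting.column-length a U skU m))) eq
... | top , rest with c ≟ m
...   | no ne = columns-has skT skU m rest c v (≤∧≢⇒< (≤-pred c<m) ne) 1≤v v≤n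
...   | yes refl = bit-injective (trans (sym (count-canon (λ v → bit (has T v m)) v n 1≤v v≤n))
          (trans (cong (count v) top) (count-canon (λ v → bit (has U v m)) v n 1≤v v≤n)))

-- The column word determines the filling

range : ℕ → ℕ → List ℕ
range s zero = []
range s (suc m) = s ∷ range (suc s) m

range-∈ : ∀ s m {p} → s ≤ p → p < s + m → p ∈ range s m
range-∈ s zero le lt rewrite +-identityʳ s = ⊥-elim (<⇒≱ lt le)
range-∈ s (suc m) {p} le lt with s ≟ p
... | yes refl = here refl
... | no ne = there (range-∈ (suc s) m (≤∧≢⇒< le ne) (subst (p <_) (+-suc s m) lt))

range-∈⁻¹ : ∀ s m {p} → p ∈ range s m → s ≤ p × p < s + m
range-∈⁻¹ s (suc m) (here refl) = ≤-refl , subst (s <_) (sym (+-suc s m)) (s≤s (m≤m+n s m))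
range-∈⁻¹ s (suc m) {p} (there x) with range-∈⁻¹ (suc s) m x
... | le , lt = <⇒≤ le , subst (p <_) (sym (+-suc s m)) lt

range-unique : ∀ s m → Unique (range s m)
range-unique s zero = []
range-unique s (suc m) = All.tabulate (λ x e → <-irrefl e (proj₁ (range-∈⁻¹ (suc s) m x))) ∷ range-unique (suc s) m

range-before : ∀ s m {p q} → Before (range s m) p q → p < q
range-before s (suc m) (head x) = proj₁ (range-∈⁻¹ (suc s) m x)
range-before s (suc m) (tail b) = range-before (suc s) m b

module Total {n : ℕ} (a : Vec ℕ n) (T : Filling n) (sk : SSKD a T) where
  open Cells a T (proj₁ sk)

  value : ℕ → ℕ → ℕ
  value p c = M.fromMaybe 0 (entry T p c)

  InRows : ℕ → Set
  InRows p = 1 ≤ p × p ≤ n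

  value-entry : ∀ {p c} → InRows p → c ≤ rowLen a p → entry T p c ≡ just (value p c)
  value-entry {p} {c} (1≤p , p≤n) le with cell {p} {c} 1≤p p≤n le
  ... | k , e rewrite e = refl

  valid* : Valid* InRows (rowLen a) (RankOf a) (Before (range 1 n)) value
  valid* = record
    { dist = λ {p} {q} {c} p∈ q∈ lp lq e → sskd-distinct sk p q c _ (value-entry p∈ lp) (trans (value-entry q∈ lq) (cong just (sym e)))
    ; pass = λ {p} {q} {c} p∈ q∈ p≺q le →
        (λ b lp → proj₁ (sskd-noPassing sk q c p _ _ _ p≺q (value-entry q∈ (<⇒≤ le)) (value-entry q∈ le)) (range-before 1 n b) (value-entry p∈ lp)) ,
        (λ b lp → proj₂ (sskd-noPassing sk q c p _ _ _ p≺q (value-entry q∈ (<⇒≤ le)) (value-entry q∈ le)) (range-before 1 n b) (value-entry p∈ lp)) }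

columns-injective : ∀ {n} (a : Vec ℕ n) (T U : Filling n) → SSKD a T → SSKD a U → columns T (width T) ≡ columns U (width U) → T ≡ U
columns-injective {n} a T U skT skU eq = filling-ext T U λ p c → same-entry p (suc c)
  where
  module T′ = Total a T skT
  module U′ = Total a U skU
  module CT = Cells a T (proj₁ skT)
  module CU = Cells a U (proj₁ skU)
  widths : width U ≡ width T
  widths = trans (width-shape a U (proj₁ skU)) (sym (width-shape a T (proj₁ skT)))
  eq' : columns T (width T) ≡ columns U (width T)
  eq' = trans eq (cong (columns U) widths)
  module D = Determinacy {T′.InRows} {rowLen a} (rankOf a) (rank-trans a) (rank-len a)
  shared : ∀ {V W : Filling n} (skV : SSKD a V) (skW : SSKD a W) →
    (∀ c v → c < width T → 1 ≤ v → v ≤ n → has V v c ≡ has W v c) → D.SameColumns (Total.value a V skV) (Total.value a W skW)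
  shared {V} {W} skV skW h {p} {zero} p∈ le = p , p∈ , z≤n ,
    trans (base-value W skW) (sym (base-value V skV))
    where
    base-value : ∀ X (skX : SSKD a X) → Total.value a X skX p 0 ≡ p
    base-value X skX rewrite Cells.basement a X (proj₁ skX) (proj₁ p∈) (proj₂ p∈) = refl
  shared {V} {W} skV skW h {p} {suc c} p∈ le with Total.value-entry a V skV {p} {suc c} p∈ le
  ... | e with has-true⁻¹ {T = W} {Total.value a V skV p (suc c)} {c}
                 (trans (sym (h c _ (≤-trans le (width-bound a T (proj₁ skT) p)) (proj₁ rng) (proj₂ rng))) (has-true {T = V} (p , e)))
    where
    rng : 1 ≤ Total.value a V skV p (suc c) × Total.value a V skV p (suc c) ≤ n
    rng = proj₁ (proj₂ skV) p c _ e
  ...   | u , eu = u , Cells.entry-row a W (proj₁ skW) {u} eu , Cells.entry-len a W (proj₁ skW) {u} eu , cong (M.fromMaybe 0) eu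
  agree : ∀ p c → T′.InRows p → c ≤ rowLen a p → T′.value p c ≡ U′.value p c
  agree = D.determined (range 1 n) (range-unique 1 n)
    -- Rows of equal length are ranked by height, so a row that outranks a higher one is strictly
    -- longer.
    (λ { b (inj₁ (_ , lt)) → lt ; b (inj₂ (q<p , _)) → ⊥-elim (<-asym q<p (range-before 1 n b)) })
    (λ { (1≤p , p≤n) → range-∈ 1 n 1≤p (s≤s p≤n) })
    (λ x → proj₁ (range-∈⁻¹ 1 n x) , ≤-pred (proj₂ (range-∈⁻¹ 1 n x)))
    T′.value U′.value T′.valid* U′.valid*
    (λ p p∈ → trans (cong (M.fromMaybe 0) (CT.basement {p} (proj₁ p∈) (proj₂ p∈))) (sym (cong (M.fromMaybe 0) (CU.basement {p} (proj₁ p∈) (proj₂ p∈)))))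
    (λ {p} {c} → shared skT skU (columns-has skT skU (width T) eq') {p} {c})
    (λ {p} {c} → shared skU skT (λ c v l x y → sym (columns-has skT skU (width T) eq' c v l x y)) {p} {c})
  same-entry : ∀ p c → entry T p c ≡ entry U p c
  same-entry p c with entry T p c in eT | entry U p c in eU
  ... | nothing | nothing = refl
  ... | just k | _ = trans (sym eT) (trans (T′.value-entry (CT.entry-row {p} eT) (CT.entry-len {p} eT))
        (trans (cong just (agree p c (CT.entry-row {p} eT) (CT.entry-len {p} eT)))
          (trans (sym (U′.value-entry (CT.entry-row {p} eT) (CT.entry-len {p} eT))) eU)))
  ... | nothing | just k = trans (sym eT) (trans (T′.value-entry (CU.entry-row {p} eU) (CU.entry-len {p} eU))
        (trans (cong just (agree p c (CU.entry-row {p} eU) (CU.entry-len {p} eU)))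
          (trans (sym (U′.value-entry (CU.entry-row {p} eU) (CU.entry-len {p} eU))) eU)))

-- Climbing to the highest weight word and membership in B(λ)

hwWord-canon : ∀ {n} (μ : Vec ℕ n) ν → (∀ m → lookup μ m ≡ ν (suc (toℕ m))) → hwWord μ ≡ canon ν n
hwWord-canon {n} μ ν h = trans (cong (λ z → concat (reverse (toList z))) (tabulate-cong λ m → cong (λ k → replicate k (suc (toℕ m))) (h m)))
  (trans (cong (concat ∘ reverse) (toList-tabulate block n)) (descending n))
  where
  block : ℕ → List ℕ
  block m = replicate (ν (suc m)) (suc m)
  toList-tabulate : ∀ (g : ℕ → List ℕ) n → toList (tabulate {n = n} (λ m → g (toℕ m))) ≡ applyUpTo g n
  toList-tabulate g zero = refl
  toList-tabulate g (suc n) = cong (g 0 ∷_) (toList-tabulate (g ∘ suc) n)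
  descending : ∀ n → concat (reverse (applyUpTo block n)) ≡ canon ν n
  descending zero = refl
  descending (suc n) = trans (cong (concat ∘ reverse) (sym (applyUpTo-∷ʳ block n)))
    (trans (cong concat (reverse-snoc (applyUpTo block n) (block n))) (cong (block n ++_) (descending n)))

canon-inRange : ∀ μ n m → m ≤ n → InRange n (canon μ m)
canon-inRange μ n zero le = []
canon-inRange μ n (suc m) le = go (μ (suc m))
  where
  go : ∀ k → InRange n (replicate k (suc m) ++ canon μ m)
  go zero = canon-inRange μ n m (<⇒≤ le)
  go (suc k) = (s≤s z≤n , le) ∷ go k

InRange-++ : ∀ {n u w} → InRange n u → InRange n w → InRange n (u ++ w)
InRange-++ [] s = s
InRange-++ (r ∷ rs) s = r ∷ InRange-++ rs s

columns-inRange : ∀ {n} (T : Filling n) m → InRange n (columns T m)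
columns-inRange T zero = []
columns-inRange {n} T (suc m) = InRange-++ (canon-inRange (λ v → bit (has T v m)) n n ≤-refl) (columns-inRange T m)

raise-inRange : ∀ {n} i w w' → Valid n i → InRange n w → raise i w ≡ just w' → InRange n w'
raise-inRange i (x ∷ w) w' va (r ∷ rs) eq with letter i x | letter? i x
... | low | _ with map-∷ x (raise i w) eq
...   | v , eqv , refl = r ∷ raise-inRange i w v va rs eqv
raise-inRange i (x ∷ w) w' va (r ∷ rs) eq | other | _ with map-∷ x (raise i w) eq
...   | v , eqv , refl = r ∷ raise-inRange i w v va rs eqv
raise-inRange i (x ∷ w) w' va (r ∷ rs) eq | high | _ with φ i w
raise-inRange i (x ∷ w) .(i ∷ w) va (r ∷ rs) refl | high | _ | zero = (proj₁ va , <⇒≤ (proj₂ va)) ∷ rs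
... | suc k with map-∷ x (raise i w) eq
...   | v , eqv , refl = r ∷ raise-inRange i w v va rs eqv

data Climb (n : ℕ) : List ℕ → List ℕ → Set where
  done : ∀ {w} → Climb n w w
  step : ∀ {w w' v} i → Valid n i → raise i w ≡ just w' → Climb n w' v → Climb n w v

raisable? : ∀ n w → (∃ λ i → Valid n i × ∃ λ w' → raise i w ≡ just w') ⊎ (∀ i → Valid n i → raise i w ≡ nothing)
raisable? n w = [ inj₁ , (λ h → inj₂ λ i va → h i va (<⇒≤ (proj₂ va))) ]′ (go n)
  where
  go : ∀ m → (∃ λ i → Valid n i × ∃ λ w' → raise i w ≡ just w') ⊎ (∀ i → Valid n i → i ≤ m → raise i w ≡ nothing)
  go zero = inj₂ λ i va le → ⊥-elim (1+n≰n (≤-trans (proj₁ va) le))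
  go (suc m) with go m
  ... | inj₁ found-one = inj₁ found-one
  ... | inj₂ none with suc (suc m) ≤? n | raise (suc m) w in eq
  ...   | yes le | just w' = inj₁ (suc m , (s≤s z≤n , le) , w' , eq)
  ...   | yes le | nothing = inj₂ λ i va i≤ → case i ≟ suc m of λ { (yes refl) → eq ; (no ne) → none i va (≤∧≢⇒≤pred i≤ ne) }
  ...   | no nle | _ = inj₂ λ i va i≤ → case i ≟ suc m of λ { (yes refl) → ⊥-elim (nle (proj₂ va)) ; (no ne) → none i va (≤∧≢⇒≤pred i≤ ne) }

climb : ∀ {n} k w → total w ≤ k → InRange n w → ∃ λ v → Highest n v × Climb n w v
climb {n} k w le r with raisable? n w
... | inj₂ none = w , highest r none , done
climb {n} zero w le r | inj₁ (i , va , w' , eq) = case subst (_≤ 0) (total-raise i w w' eq) le of λ ()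
climb {n} (suc k) w le r | inj₁ (i , va , w' , eq)
  with climb k w' (≤-pred (subst (_≤ suc k) (total-raise i w w' eq) le)) (raise-inRange i w w' va r eq)
... | v , hv , path = v , hv , step i va eq path

connected-trans : ∀ {n u v w} → Connected n u v → Connected n v w → Connected n u w
connected-trans c here = c
connected-trans c (up i va d eq) = up i va (connected-trans c d) eq
connected-trans c (dn i va d eq) = dn i va (connected-trans c d) eq

connected-sym : ∀ {n u v} → Connected n u v → Connected n v u
connected-sym here = here
connected-sym (up i va c eq) = connected-trans (dn i va here eq) (connected-sym c)
connected-sym (dn i va c eq) = connected-trans (up i va here eq) (connected-sym c)

climb-connected : ∀ {n w v} → Climb n w v → Connected n w v
climb-connected done = here
climb-connected (step i va eq path) = connected-trans (up i va here eq) (climb-connected path)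

climb-inB : ∀ {n μ w v} → Climb n w v → InB n μ v → InB n μ w
climb-inB done b = b
climb-inB {w = w} (step {w' = w'} i va eq path) b =
  InB.step i va (climb-inB path b) (trans (down≡fW i w') (proj₂ (raise-down i w w' eq)))

-- `InB` is generated downwards from the highest weight word. So `w` is raised as far as possible,
-- the end of the climb is identified by `highest-unique`, and the path is reversed by `raise-down`.
connected-inB : ∀ {n} (μ : Vec ℕ n) ν → hwWord μ ≡ canon ν n → Highest n (canon ν n) →
  ∀ w → InRange n w → Connected n (canon ν n) w → InB n μ w
connected-inB {n} μ ν hw≡ hc w r c with climb (total w) w ≤-refl r
... | v , hv , path = climb-inB path (subst (InB n μ) (trans hw≡ (sym (highest-unique hc hv (connected-trans c (climb-connected path))))) hw)

down-zero : ∀ i w → φ i w ≡ 0 → down i w ≡ nothing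
down-zero i w ph rewrite sym (lower≡down i w) | lowerPos-zero i w ph = refl

knuths-φ : ∀ i ps w → φ i (knuths ps w) ≡ φ i w
knuths-φ i [] w = refl
knuths-φ i (p ∷ ps) w = trans (knuths-φ i ps (knuth p w)) (knuth-φ i p w)

-- The image of a component of fillings

module Component {n : ℕ} (a : Vec ℕ n) (T₀ : Filling n) (sk₀ : SSKD a T₀) where

  ψ : Filling n → List ℕ
  ψ T = columns T (width T)

  eF-raise : ∀ {T U i} → SSKD a T → Valid n i → eF i T ≡ just U → SSKD a U × raise i (ψ T) ≡ just (ψ U)
  eF-raise {T} {U} {i} sk va eq with rightmostUnpaired i T in e
  eF-raise {T} {.(raiseAt i T (c , r))} {i} sk va refl | just (c , r) with Scanning.raising a T sk i va {c} {r} e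
  ... | skU , raised = skU , trans raised (cong (λ m → just (columns (raiseAt i T (c , r)) m)) same-width)
    where
    same-width : width T ≡ width (raiseAt i T (c , r))
    same-width = trans (width-shape a T (proj₁ sk)) (sym (width-shape a (raiseAt i T (c , r)) (proj₁ skU)))

  raise-eF : ∀ {T i w} → SSKD a T → Valid n i → raise i (ψ T) ≡ just w → ∃ λ U → eF i T ≡ just U × SSKD a U × ψ U ≡ w
  raise-eF {T} {i} sk va eq with eF i T in e
  ... | just U with eF-raise sk va e
  ...   | skU , raised = U , refl , skU , just-injective (trans (sym raised) eq)
  raise-eF {T} {i} sk va eq | nothing with rightmostUnpaired i T in e'
  ... | nothing = case trans (sym eq) (columns-noRaise T va (width T) (trans (sym (rightmost-scan T i)) e')) of λ ()

  component : ∀ {T} → Comp a T₀ T → SSKD a T × Connected n (ψ T₀) (ψ T)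
  component (base sk) = sk , here
  component (fwd i va c eq sk) with component c
  ... | sk' , con = sk , up i va con (proj₂ (eF-raise sk' va eq))
  component (bwd i va c eq sk) with component c
  ... | _ , con = sk , dn i va con (proj₂ (eF-raise sk va eq))

  -- Every raising of the word lifts to the filling, so the highest weight word of the component is
  -- itself the word of a filling in it.
  climb-filling : ∀ {T w v} → Comp a T₀ T → ψ T ≡ w → Climb n w v → ∃ λ U → Comp a T₀ U × ψ U ≡ v
  climb-filling {T} c e done = T , c , e
  climb-filling {T} c refl (step i va eq path) with raise-eF (proj₁ (component c)) va eq
  ... | U , eU , skU , ψU = climb-filling (fwd i va c eU skU) ψU path

  abstract
    top : ∃ λ v → Highest n v × Climb n (ψ T₀) v
    top = climb (total (ψ T₀)) (ψ T₀) ≤-refl (columns-inRange T₀ (width T₀))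

  v : List ℕ
  v = proj₁ top

  v-highest : Highest n v
  v-highest = proj₁ (proj₂ top)

  top-filling : ∃ λ U → Comp a T₀ U × ψ U ≡ v
  top-filling = climb-filling (base sk₀) refl (proj₂ (proj₂ top))

  ν : ℕ → ℕ
  ν j = count j v

  μ : Vec ℕ n
  μ = wtW n v

  partition : IsPartition μ
  partition p q p≤q rewrite lookup∘tabulate (λ m → ν (suc (toℕ m))) p | lookup∘tabulate (λ m → ν (suc (toℕ m))) q = antitone (s≤s z≤n) (s≤s p≤q)
    where
    antitone : ∀ {j k} → 1 ≤ j → j ≤ k → ν k ≤ ν j
    antitone {j} {k} 1≤j le = subst (λ z → ν z ≤ ν j) (m∸n+n≡m le) (go (k ∸ j))
      where
      go : ∀ d → ν (d + j) ≤ ν j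
      go zero = ≤-refl
      go (suc d) = ≤-trans (yam-antitone (highest-yam v v-highest) (d + j) (≤-trans 1≤j (m≤n+m j d))) (go d)

  hw≡ : hwWord μ ≡ canon ν n
  hw≡ = hwWord-canon μ ν (lookup∘tabulate (λ m → ν (suc (toℕ m))))

  abstract
    moves : v ≈ᴷ canon ν n
    moves = yam-canon (highest-yam v v-highest)

  ps : List ℕ
  ps = proj₁ moves

  Ψ : Filling n → List ℕ
  Ψ T = knuths ps (ψ T)

  Φ : Σ (Filling n) (Comp a T₀) → List ℕ
  Φ (T , _) = Ψ T

  X : List ℕ → Set
  X x = ∃ λ t → Φ t ≡ x

  canon-highest : Highest n (canon ν n)
  canon-highest = subst (Highest n) (proj₂ moves) (knuths-highest ps v v-highest)

  Ψ-raise : ∀ {T U i} → SSKD a T → Valid n i → eF i T ≡ just U → raise i (Ψ T) ≡ just (Ψ U)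
  Ψ-raise {T} {i = i} sk va eq = trans (knuths-raise i ps (ψ T)) (cong (M.map (knuths ps)) (proj₂ (eF-raise sk va eq)))

  raise-Ψ : ∀ {T i y} → SSKD a T → Valid n i → raise i (Ψ T) ≡ just y → ∃ λ U → eF i T ≡ just U × SSKD a U × Ψ U ≡ y
  raise-Ψ {T} {i} {y} sk va eq with raise i (ψ T) in e | trans (sym (knuths-raise i ps (ψ T))) eq
  ... | just w | refl with raise-eF sk va e
  ...   | U , eU , skU , refl = U , eU , skU , refl

  Φ-injective : ∀ t t' → Φ t ≡ Φ t' → proj₁ t ≡ proj₁ t'
  Φ-injective (T , c) (T' , c') eq = columns-injective a T T' (proj₁ (component c)) (proj₁ (component c')) (knuths-injective ps eq)

  Φ-inB : ∀ t → InB n μ (Φ t)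
  Φ-inB (T , c) = connected-inB μ ν hw≡ canon-highest (Ψ T) (InRange-knuths ps (ψ T) (columns-inRange T (width T)))
    (subst (λ z → Connected n z (Ψ T)) (proj₂ moves)
      (connected-knuths ps (connected-trans (connected-sym (climb-connected (proj₂ (proj₂ top)))) (proj₂ (component c)))))

  extremal : Extremal n μ X
  extremal = (λ { x (t , refl) → Φ-inB t }) , top-in , raise-closed , string
    where
    top-in : X (hwWord μ)
    top-in with top-filling
    ... | U , c , ψU = (U , c) , trans (cong (knuths ps) ψU) (trans (proj₂ moves) (sym hw≡))
    raise-closed : ∀ x i y → Valid n i → X x → eW i x ≡ just y → X y
    raise-closed _ i y va ((T , c) , refl) eq with raise-Ψ (proj₁ (component c)) va (trans (sym (raise≡eW i (Ψ T))) eq)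
    ... | U , eU , skU , refl = (U , fwd i va c eU skU) , refl
    string : ∀ x i y → Valid n i → X x → fW i x ≡ just y → ¬ X y → ∀ z → eW i x ≡ just z → ¬ X z
    -- A nonzero `e_i` provides the unpaired `i + 1` on which `lowering` relies, and a nonzero `f_i`
    -- the unpaired `i`. The word of the lowered filling is then `y`, which contradicts `¬y`.
    string _ i y va ((T , c) , refl) f∈ ¬y z e∈ _ = ¬y (lowered (proj₂ (scan T i (width T))) refl)
      where
      sk : SSKD a T
      sk = proj₁ (component c)
      lowers : down i (Ψ T) ≡ just y
      lowers = trans (sym (down≡fW i (Ψ T))) f∈
      open-letter : 0 < proj₁ (scan T i (width T))
      open-letter = n≢0⇒n>0 λ z → case trans (sym lowers) (down-zero i (Ψ T) (trans (knuths-φ i ps (ψ T)) (trans (columns-φ T va (width T)) z))) of λ ()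
      lowered : ∀ l → proj₂ (scan T i (width T)) ≡ l → X y
      lowered nothing s with raise-Ψ sk va (trans (sym (raise≡eW i (Ψ T))) e∈)
      ... | U , eU , _ = case trans (sym (cong (M.map (raiseAt i T)) (trans (rightmost-scan T i) s))) eU of λ ()
      lowered (just l) s with Scanning.lowering a T sk i va open-letter s
      ... | U , skU , eU = (U , bwd i va c eU skU) ,
        just-injective (trans (sym (proj₂ (raise-down i (Ψ U) (Ψ T) (Ψ-raise skU va eU)))) lowers)

  Φ-weight : ∀ t → wtW n (Φ t) ≡ wtF n (proj₁ t)
  Φ-weight (T , c) = tabulate-cong λ m → trans (count-knuths (suc (toℕ m)) ps (ψ T))
    (Counting.weight a T (proj₁ (component c)) (suc (toℕ m)) (s≤s z≤n) (toℕ<n m))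

  Φ-edge : ∀ t t' i → Valid n i → (eF i (proj₁ t) ≡ just (proj₁ t') ⇔ eW i (Φ t) ≡ just (Φ t'))
  Φ-edge (T , c) (T' , c') i va = mk⇔
    (λ eq → trans (raise≡eW i (Ψ T)) (Ψ-raise (proj₁ (component c)) va eq))
    (λ eq → back (raise-Ψ (proj₁ (component c)) va (trans (sym (raise≡eW i (Ψ T))) eq)))
    where
    back : (∃ λ U → eF i T ≡ just U × SSKD a U × Ψ U ≡ Ψ T') → eF i T ≡ just T'
    back (U , eU , skU , e) = trans eU (cong just (columns-injective a U T' skU (proj₁ (component c')) (knuths-injective ps e)))

theorem5p40 : (n : ℕ) (a : Vec ℕ n) (T₀ : Filling n) → SSKD a T₀ →
    Σ (Vec ℕ n) λ μ → IsPartition μ ×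
    Σ (List ℕ → Set) λ X → Extremal n μ X ×
    Σ (Σ (Filling n) (Comp a T₀) → List ℕ) λ Φ →
    (∀ t → X (Φ t))
    × (∀ t t' → Φ t ≡ Φ t' → proj₁ t ≡ proj₁ t')
    × (∀ x → X x → ∃ λ t → Φ t ≡ x)
    × (∀ t → wtW n (Φ t) ≡ wtF n (proj₁ t))
    × (∀ t t' i → Valid n i →
    (eF i (proj₁ t) ≡ just (proj₁ t') ⇔ eW i (Φ t) ≡ just (Φ t')))
theorem5p40 n a T₀ sk = μ , partition , X , extremal , Φ , (λ t → t , refl) , Φ-injective , (λ x x∈ → x∈) , Φ-weight , Φ-edge
  where open Component a T₀ sk
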